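{- Let $c,d$ be positive integers and let $\mathcal{C}$ be a family of graphs closed under taking induced subgraphs such that every $G'\in\mathcal{C}$ satisfies $\mathrm{tw}(G')\le(\Delta(G'))^c$. Let $G\in\mathcal{C}$ have degeneracy at most $d$. Let $k$ be a positive integer, $\mathcal{F}$ a $4d$-neighborhood-witnessing layered family of $G$ with thickness at most $k$ and set of centers $\mathcal{C}_{\mathcal{F}}$, and $X\subseteq\mathcal{C}_{\mathcal{F}}$. Then $G$ has a rooted tree decomposition $(T,\chi)$ with root $r$ such that $\chi(r)\supseteq\bigcup_{w\in X}F_w$ and for every $x\in V(T)$ there exists $X'\subseteq\mathcal{C}_{\mathcal{F}}$ with $|X'|\le\max\{|X|,\,110000k\log^2 2|V(G)|\cdot f\log 4f\}+5000k\log^2 2|V(G)|\cdot f\log 4f$, where $f=(1000000d\cdot k^2\cdot\log^3 2|V(G)|)^c$, and $\chi(x)=\bigcup_{w\in X'}F_w$.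
   Context: Logarithms are base 2; $\mathrm{tw}$ is treewidth and $\Delta$ maximum degree. A rooted tree decomposition is a tree decomposition with a distinguished root node. Layered family: given an ordered partition $\Pi=(L_1,\dots,L_m)$ of $V(G)$, the layer digraph has an arc $(u,v)$ iff $uv\in E(G)$, $u\in L_i$, $v\in L_j$, $j<i$. $v$ is a descendant of $u$ if there is a directed path from $u$ to $v$ (including $v=u$). For each vertex $u$ with no in-arcs, the set $F_u$ of $u$ and all its descendants belongs to $\mathcal{F}$ ($u$ is its center; $\mathcal{C}_{\mathcal{F}}$ is the set of centers). Thickness: smallest $k$ such that every member meets at most $k$ parts of $\Pi$. $\mathcal{F}$ is $4d$-neighborhood-witnessing if for every vertex $v$ and every $F\in\mathcal{F}$ containing $v$, $|N[v]\setminus F|\le 4d$. -}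

module Defs where

open import Data.Nat using (ℕ; zero; suc; _+_; _*_; _^_; _≤_; _<_; _⊔_)
open import Data.Bool using (Bool; true; false; _∨_)
open import Data.Fin using (Fin; toℕ; _≟_)
open import Data.Fin.Subset using (Subset; _∈_; ∣_∣; _∩_; Nonempty)
open import Data.Vec using (tabulate)
open import Data.List using (List; foldr; map; allFin)
open import Data.Product using (Σ; ∃; _×_; _,_)
open import Data.Sum using (_⊎_)
open import Relation.Nullary using (¬_)
open import Relation.Nullary.Decidable using (⌊_⌋)
open import Relation.Binary.PropositionalEquality using (_≡_; _≢_)
open import Function.Definitions using (Injective)

record Graph : Set where
  field
    size    : ℕ
    adj     : Fin size → Fin size → Bool
    adj-sym : ∀ u v → adj u v ≡ adj v u
    adj-irr : ∀ v → adj v v ≡ false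

open Graph public

V : Graph → Set
V G = Fin (size G)

Adj : (G : Graph) → V G → V G → Set
Adj G u v = adj G u v ≡ true

nbhd : (G : Graph) → V G → Subset (size G)
nbhd G v = tabulate (adj G v)

closedNbhd : (G : Graph) → V G → Subset (size G)
closedNbhd G v = tabulate (λ u → adj G v u ∨ ⌊ u ≟ v ⌋)

degree : (G : Graph) → V G → ℕ
degree G v = ∣ nbhd G v ∣

-- maximum degree Δ(G) (0 for the empty graph)
maxDegree : Graph → ℕ
maxDegree G = foldr _⊔_ 0 (map (degree G) (allFin (size G)))

InducedSubgraphOf : Graph → Graph → Set
InducedSubgraphOf H G =
  Σ (V H → V G) λ f → Injective _≡_ _≡_ f × (∀ u v → adj H u v ≡ adj G (f u) (f v))

ClosedUnderInducedSubgraphs : (Graph → Set) → Set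
ClosedUnderInducedSubgraphs 𝒞 = ∀ G H → 𝒞 G → InducedSubgraphOf H G → 𝒞 H

DegeneracyAtMost : Graph → ℕ → Set
DegeneracyAtMost G d =
  ∀ (S : Subset (size G)) → Nonempty S →
    ∃ λ v → v ∈ S × ∣ nbhd G v ∩ S ∣ ≤ d

-- Rooted trees (given by a parent function whose iteration reaches the root)

record RootedTree : Set where
  field
    nodes  : ℕ
    root   : Fin nodes
    parent : Fin nodes → Fin nodes
    depth  : Fin nodes → ℕ
    parent-closer : ∀ x → x ≢ root → depth (parent x) < depth x

open RootedTree public

TreeAdj : (T : RootedTree) → Fin (nodes T) → Fin (nodes T) → Set
TreeAdj T x y = (x ≢ root T × parent T x ≡ y) ⊎ (y ≢ root T × parent T y ≡ x)

data PathWithin (T : RootedTree) (P : Fin (nodes T) → Set) :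
       Fin (nodes T) → Fin (nodes T) → Set where
  here : ∀ {x} → P x → PathWithin T P x x
  step : ∀ {x y z} → P x → TreeAdj T x y → PathWithin T P y z → PathWithin T P x z

record RootedTreeDecomposition (G : Graph) : Set where
  field
    tree : RootedTree
    bag  : Fin (nodes tree) → Subset (size G)
    vertex-cover : ∀ v → ∃ λ x → v ∈ bag x
    edge-cover   : ∀ u v → Adj G u v → ∃ λ x → u ∈ bag x × v ∈ bag x
    bag-connected : ∀ v x y → v ∈ bag x → v ∈ bag y →
                    PathWithin tree (λ z → v ∈ bag z) x y

open RootedTreeDecomposition public

TreewidthAtMost : Graph → ℕ → Set
TreewidthAtMost G t =
  ∃ λ (D : RootedTreeDecomposition G) → ∀ x → ∣ bag D x ∣ ≤ suc t

-- Layered families.  The ordered partition Π = (L_1,…,L_m) is given by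
-- the layer map  layer : V(G) → Fin m  (L_i = layer⁻¹(i)).

module _ (G : Graph) {m : ℕ} (layer : V G → Fin m) where

  Arc : V G → V G → Set
  Arc u v = Adj G u v × toℕ (layer v) < toℕ (layer u)

  data Desc : V G → V G → Set where
    desc-refl : ∀ {u} → Desc u u
    desc-step : ∀ {u w v} → Arc u w → Desc w v → Desc u v

  -- centers: vertices with no in-arcs; F_u = { v | Desc u v }
  IsCenter : V G → Set
  IsCenter u = ∀ w → ¬ Arc w u

  ThicknessAtMost : ℕ → Set
  ThicknessAtMost k =
    ∀ u → IsCenter u →
      ∃ λ (S : Subset m) → ∣ S ∣ ≤ k × (∀ v → Desc u v → layer v ∈ S)

  NeighborhoodWitnessing : ℕ → Set
  NeighborhoodWitnessing t =
    ∀ u → IsCenter u → ∀ v → Desc u v →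
      ∃ λ (S : Subset (size G)) → ∣ S ∣ ≤ t ×
        (∀ w → w ∈ closedNbhd G v → ¬ Desc u w → w ∈ S)

-- The real-valued bound.  With n = |V(G)|, L = log₂(2n),
-- f = (1000000·d·k²·L³)^c,  E = k·L²·f·log₂(4f), the claim
--     y ≤ max{x, 110000·E} + 5000·E
-- is expressed as the negation of "max{x,110000E}+5000E < y".
-- By monotonicity and continuity, that strict inequality holds iff there
-- are rationals ℓ = a/b ≥ L and g = p/q ≥ log₂(4·f(ℓ)) with
-- max{x, 110000·E(ℓ,g)} + 5000·E(ℓ,g) < y, where f(ℓ) = N/b^(3c),
-- N = (1000000·d·k²·a³)^c, E(ℓ,g) = K/D, K = k·a²·N·p, D = b^(2+3c)·q.
-- Clearing denominators gives the purely natural-number conditions below.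

BoundExceeded : (n k d c x y : ℕ) → Set
BoundExceeded n k d c x y =
  ∃ λ a → ∃ λ b → ∃ λ p → ∃ λ q →
    let N = (1000000 * d * k ^ 2 * a ^ 3) ^ c
        K = k * a ^ 2 * N * p
        D = b ^ (2 + 3 * c) * q
    in 1 ≤ b × 1 ≤ q
     × (2 * n) ^ b ≤ 2 ^ a                      -- a/b ≥ log₂(2n)
     × (4 * N) ^ q ≤ 2 ^ p * b ^ (3 * c * q)     -- p/q ≥ log₂(4 f(a/b))
     × x * D + 5000 * K < y * D
     × 115000 * K < y * D

WithinBound : (n k d c x y : ℕ) → Set
WithinBound n k d c x y = ¬ BoundExceeded n k d c x y

{-# OPTIONS --safe #-}

-- The tree decomposition is built from balanced separators.  If Y is a set of centers, a member F_w with
-- w ∉ Y lies, outside ⋃_{y ∈ Y} F_y, in one component, because members are closed under descendants.  So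
-- it is enough to find few members whose removal leaves at most (1 - 1/8g)|X| elements of X in every
-- component, where g = ⌊log₂ 4f⌋.
--
-- Give every center a weight and let the cost of a path be the total weight of the members it meets.
-- Region growing, with a fractional hitting set of the boundary of the ball rounded greedily, either finds
-- the separator or shows that almost all pairs of X are joined by cheap paths.  In the second case
-- multiplicative weights produce path systems joining almost all pairs of X in which every member is met
-- by a small fraction of the paths.  Averaging over all maps from the vertices of the g-dimensional cube
-- to X and over the path systems yields a map whose cube edges are routed, with few failures, by paths of
-- which only O(g log n) meet any given member.  The union H of these paths, chosen shortest, has small
-- maximum degree: by thickness a shortest path meets a member in at most 2k + 1 vertices, and a vertex has
-- at most 4d neighbours outside a member containing it.  Hence H has small treewidth; but a bag of its
-- tree decomposition blocks few of the paths, so by edge isoperimetry of the cube every node of the tree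
-- has a branch containing most of the cube, which is impossible in a finite tree.
module Submission where

open import Defs
open import Data.Bool using (Bool; true; false; _∧_; _∨_; not) renaming (_≟_ to _≟ᵇ_)
open import Data.Bool.Properties using (∧-identityʳ)
open import Data.Empty using (⊥; ⊥-elim)
open import Data.Fin using (Fin; zero; suc; toℕ; _≟_; _↑ˡ_; _↑ʳ_; splitAt; join)
open import Data.Fin.Properties using (any?; all?; toℕ<n; splitAt-↑ˡ; splitAt-↑ʳ; join-splitAt)
open import Data.Fin.Subset using (Subset; _∈_; ∣_∣)
open import Data.Fin.Subset.Properties using (anySubset?; _∈?_)
open import Data.List using (List; []; _∷_; _++_; map; length; allFin; filterᵇ; foldr; cartesianProductWith; downFrom)
open import Data.List.Membership.Propositional using () renaming (_∈_ to _∈ₗ_)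
open import Data.List.Membership.Propositional.Properties using (∈-allFin)
open import Data.List.Properties using (length-downFrom)
open import Data.List.Relation.Unary.Any using (here; there)
open import Data.Maybe using (Maybe; just; nothing)
open import Data.Maybe.Properties using () renaming (≡-dec to ≡-decᵐ)
open import Data.Nat using (ℕ; zero; suc; _+_; _*_; _∸_; _^_; _≤_; _<_; _⊔_; z≤n; s≤s) renaming (_≟_ to _≟ⁿ_; _≤?_ to _≤?ⁿ_; _<?_ to _<?ⁿ_; _≤ᵇ_ to _≤ᵇⁿ_)
open import Data.Nat.Properties hiding (_≟_; _≤?_; _<?_)
open import Data.Nat.Tactic.RingSolver using (solve-∀)
open import Data.Product using (Σ; ∃; _×_; _,_; proj₁; proj₂)
open import Data.Sum using (_⊎_; inj₁; inj₂; [_,_]′)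
open import Data.Vec using (tabulate; lookup)
open import Data.Vec.Properties using (lookup∘tabulate; tabulate∘lookup; []=⇒lookup; lookup⇒[]=)
open import Function using (_∘_; id; case_of_)
open import Relation.Binary.PropositionalEquality using (_≡_; _≢_; refl; sym; trans; cong; cong₂; subst; subst₂; module ≡-Reasoning)
open import Relation.Nullary using (¬_; Dec; yes; no)
open import Relation.Nullary.Decidable using (⌊_⌋; _×-dec_; _→-dec_; ¬?; map′)

-- Finite sums

-- The hypothesis converts degree into treewidth, but degrees in `G` may be arbitrarily large, so a
-- subgraph of small degree and large treewidth has to be produced. For a routed cube the degree is
-- governed by the congestion of its paths and the treewidth by its 2^g vertices. The shape of `f`
-- records the balance: Δ = 4d + 4gℓ(2k+1) must satisfy 48ℓg Δ^c ≤ f < 2^g / 2, where ℓ and g are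
-- the logarithms of 2n and 4f rounded down, which only strengthens the bound. The load of a member
-- on one dimension of the cube must average at most ℓ over 2^g / 2 edges, so a member may carry
-- only a fraction of order ℓ/f of the routes; hence routes must be cheap by a factor σ of order
-- f/ℓ. Region growing costs σ times three logarithms, for the number of annuli, the greedy rounding
-- and the scales of the fractional hitting set, so separators have O(f ℓ²) members. A fraction 1/8g
-- of `X` must pay for a separator, which gives bags of order g f ℓ². If the claimed bound is at
-- least the number of vertices, one bag suffices.

∑ : {A : Set} → List A → (A → ℕ) → ℕ
∑ []       f = 0
∑ (x ∷ xs) f = f x + ∑ xs f

module _ {A : Set} where

  ∑-mono-∈ : (l : List A) {f g : A → ℕ} → (∀ {a} → a ∈ₗ l → f a ≤ g a) → ∑ l f ≤ ∑ l g
  ∑-mono-∈ []      h = z≤n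
  ∑-mono-∈ (x ∷ l) h = +-mono-≤ (h (here refl)) (∑-mono-∈ l (h ∘ there))

  ∑-mono : (l : List A) {f g : A → ℕ} → (∀ a → f a ≤ g a) → ∑ l f ≤ ∑ l g
  ∑-mono l h = ∑-mono-∈ l (λ {a} _ → h a)

  ∑-cong : (l : List A) {f g : A → ℕ} → (∀ a → f a ≡ g a) → ∑ l f ≡ ∑ l g
  ∑-cong []      h = refl
  ∑-cong (x ∷ l) h = cong₂ _+_ (h x) (∑-cong l h)

  ∑-+ : (l : List A) (f g : A → ℕ) → ∑ l (λ a → f a + g a) ≡ ∑ l f + ∑ l g
  ∑-+ []      f g = refl
  ∑-+ (x ∷ l) f g rewrite ∑-+ l f g = interchange (f x) (g x) (∑ l f) (∑ l g)
    where
    interchange : ∀ a b c d → a + b + (c + d) ≡ a + c + (b + d)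
    interchange = solve-∀

  ∑-*ˡ : (l : List A) (c : ℕ) (f : A → ℕ) → ∑ l (λ a → c * f a) ≡ c * ∑ l f
  ∑-*ˡ []      c f = sym (*-zeroʳ c)
  ∑-*ˡ (x ∷ l) c f rewrite ∑-*ˡ l c f = sym (*-distribˡ-+ c (f x) (∑ l f))

  ∑-*ʳ : (l : List A) (c : ℕ) (f : A → ℕ) → ∑ l (λ a → f a * c) ≡ ∑ l f * c
  ∑-*ʳ l c f = trans (∑-cong l λ a → *-comm (f a) c) (trans (∑-*ˡ l c f) (*-comm c (∑ l f)))

  ∑-const : (l : List A) (c : ℕ) → ∑ l (λ _ → c) ≡ length l * c
  ∑-const []      c = refl
  ∑-const (x ∷ l) c = cong (c +_) (∑-const l c)

  ∑-zero : (l : List A) → ∑ l (λ _ → 0) ≡ 0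
  ∑-zero l = trans (∑-const l 0) (*-zeroʳ (length l))

  ∑-++ : (l l′ : List A) (f : A → ℕ) → ∑ (l ++ l′) f ≡ ∑ l f + ∑ l′ f
  ∑-++ []      l′ f = refl
  ∑-++ (x ∷ l) l′ f = trans (cong (f x +_) (∑-++ l l′ f)) (sym (+-assoc (f x) _ _))

  ∑-∈ : (l : List A) (f : A → ℕ) {a : A} → a ∈ₗ l → f a ≤ ∑ l f
  ∑-∈ (x ∷ l) f (here refl) = m≤m+n (f x) _
  ∑-∈ (x ∷ l) f (there a∈)  = ≤-trans (∑-∈ l f a∈) (m≤n+m _ (f x))

  ∑-pigeonhole-< : (l : List A) (f g : A → ℕ) → ∑ l f < ∑ l g → ∃ λ a → a ∈ₗ l × f a < g a
  ∑-pigeonhole-< (x ∷ l) f g lt with f x <?ⁿ g x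
  ... | yes p = x , here refl , p
  ... | no ¬p with ∑-pigeonhole-< l f g (≰⇒> λ le → <⇒≱ lt (+-mono-≤ (≮⇒≥ ¬p) le))
  ...   | a , a∈ , p = a , there a∈ , p

  ∑-pigeonhole-≤ : (l : List A) (f g : A → ℕ) → 0 < length l → ∑ l f ≤ ∑ l g → ∃ λ a → a ∈ₗ l × f a ≤ g a
  ∑-pigeonhole-≤ l f g pos le with ∑-pigeonhole-< l f (λ a → suc (g a)) (<-≤-trans (s≤s le) lower)
    where
    lower : suc (∑ l g) ≤ ∑ l (λ a → suc (g a))
    lower = ≤-trans (+-monoˡ-≤ (∑ l g) (≤-trans pos (≤-reflexive (sym (trans (∑-const l 1) (*-identityʳ _))))))
                    (≤-reflexive (sym (∑-+ l (λ _ → 1) g)))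
  ... | a , a∈ , s≤s p = a , a∈ , p

∑-map : {A B : Set} (l : List A) (h : A → B) (f : B → ℕ) → ∑ (map h l) f ≡ ∑ l (f ∘ h)
∑-map []      h f = refl
∑-map (x ∷ l) h f = cong (f (h x) +_) (∑-map l h f)

∑-swap : {A B : Set} (l : List A) (l′ : List B) (f : A → B → ℕ) →
         ∑ l (λ a → ∑ l′ (f a)) ≡ ∑ l′ (λ b → ∑ l (λ a → f a b))
∑-swap []      l′ f = sym (∑-zero l′)
∑-swap (x ∷ l) l′ f = trans (cong (∑ l′ (f x) +_) (∑-swap l l′ f)) (sym (∑-+ l′ (f x) _))

∑-product : {A B C : Set} (h : A → B → C) (l : List A) (l′ : List B) (f : C → ℕ) →
            ∑ (cartesianProductWith h l l′) f ≡ ∑ l (λ a → ∑ l′ (λ b → f (h a b)))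
∑-product h []      l′ f = refl
∑-product h (x ∷ l) l′ f =
  trans (∑-++ (map (h x) l′) _ f) (cong₂ _+_ (∑-map l′ (h x) f) (∑-product h l l′ f))

∑-*-∑ : {A B : Set} (l : List A) (l′ : List B) (f : A → ℕ) (g : B → ℕ) →
        ∑ l (λ a → ∑ l′ (λ b → f a * g b)) ≡ ∑ l f * ∑ l′ g
∑-*-∑ l l′ f g = trans (∑-cong l λ a → ∑-*ˡ l′ (f a) g) (∑-*ʳ l (∑ l′ g) f)

-- Boolean predicates and counting

⟦_⟧ : Bool → ℕ
⟦ true  ⟧ = 1
⟦ false ⟧ = 0

⟦⟧≤1 : ∀ b → ⟦ b ⟧ ≤ 1
⟦⟧≤1 true  = ≤-refl
⟦⟧≤1 false = z≤n

true≢false : ∀ {b} → b ≡ true → b ≡ false → ⊥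
true≢false refl ()

true⊎false : ∀ b → b ≡ true ⊎ b ≡ false
true⊎false true  = inj₁ refl
true⊎false false = inj₂ refl

≢false⇒true : ∀ {b} → b ≢ false → b ≡ true
≢false⇒true {true}  h = refl
≢false⇒true {false} h = ⊥-elim (h refl)

≢true⇒false : ∀ {b} → b ≢ true → b ≡ false
≢true⇒false {true}  h = ⊥-elim (h refl)
≢true⇒false {false} h = refl

∧-true : ∀ {a b} → a ≡ true → b ≡ true → a ∧ b ≡ true
∧-true refl refl = refl

∧-trueˡ : ∀ {a b} → a ∧ b ≡ true → a ≡ true
∧-trueˡ {true} _ = refl

∧-trueʳ : ∀ {a b} → a ∧ b ≡ true → b ≡ true
∧-trueʳ {true} e = e

∨-trueˡ : ∀ {a b} → a ≡ true → a ∨ b ≡ true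
∨-trueˡ refl = refl

∨-trueʳ : ∀ {a b} → b ≡ true → a ∨ b ≡ true
∨-trueʳ {true}  refl = refl
∨-trueʳ {false} refl = refl

∨-true⁻ : ∀ {a b} → a ∨ b ≡ true → a ≡ true ⊎ b ≡ true
∨-true⁻ {true}  _ = inj₁ refl
∨-true⁻ {false} e = inj₂ e

not-true : ∀ {a} → a ≡ false → not a ≡ true
not-true refl = refl

not-true⁻ : ∀ {a} → not a ≡ true → a ≡ false
not-true⁻ {false} _ = refl

⌊⌋-true : {P : Set} (P? : Dec P) → P → ⌊ P? ⌋ ≡ true
⌊⌋-true (yes _) p = refl
⌊⌋-true (no ¬p) p = ⊥-elim (¬p p)

⌊⌋-true⁻ : {P : Set} {P? : Dec P} → ⌊ P? ⌋ ≡ true → P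
⌊⌋-true⁻ {P? = yes p} _ = p

⌊⌋-false : {P : Set} (P? : Dec P) → ¬ P → ⌊ P? ⌋ ≡ false
⌊⌋-false (yes p) ¬p = ⊥-elim (¬p p)
⌊⌋-false (no _)  _  = refl

⌊⌋-false⁻ : {P : Set} {P? : Dec P} → ⌊ P? ⌋ ≡ false → ¬ P
⌊⌋-false⁻ {P? = no ¬p} _ = ¬p

_∖_ : {A : Set} → (A → Bool) → (A → Bool) → A → Bool
(P ∖ Q) v = P v ∧ not (Q v)

_∪ᵇ_ : {A : Set} → (A → Bool) → (A → Bool) → A → Bool
(P ∪ᵇ Q) v = P v ∨ Q v

_⊆ᵇ_ : {A : Set} → (A → Bool) → (A → Bool) → Set
P ⊆ᵇ Q = ∀ v → P v ≡ true → Q v ≡ true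

⟦⟧-mono : ∀ {a b} → (a ≡ true → b ≡ true) → ⟦ a ⟧ ≤ ⟦ b ⟧
⟦⟧-mono {false} h = z≤n
⟦⟧-mono {true}  h rewrite h refl = ≤-refl

⟦∨⟧≤ : ∀ a b → ⟦ a ∨ b ⟧ ≤ ⟦ a ⟧ + ⟦ b ⟧
⟦∨⟧≤ true  b = s≤s z≤n
⟦∨⟧≤ false b = ≤-refl

module _ {n : ℕ} where

  # : (Fin n → Bool) → ℕ
  # P = ∑ (allFin n) (λ v → ⟦ P v ⟧)

  #-mono : {P Q : Fin n → Bool} → P ⊆ᵇ Q → # P ≤ # Q
  #-mono h = ∑-mono (allFin n) (λ v → ⟦⟧-mono (h v))

  #-∪ : (P Q : Fin n → Bool) → # (P ∪ᵇ Q) ≤ # P + # Q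
  #-∪ P Q = ≤-trans (∑-mono (allFin n) (λ v → ⟦∨⟧≤ (P v) (Q v))) (≤-reflexive (∑-+ (allFin n) _ _))

  #-pos : {P : Fin n → Bool} {v : Fin n} → P v ≡ true → 0 < # P
  #-pos {P} {v} e = ≤-trans (≤-reflexive (cong ⟦_⟧ (sym e))) (∑-∈ (allFin n) (λ v → ⟦ P v ⟧) (∈-allFin v))

  #-pos⁻ : {P : Fin n → Bool} → 0 < # P → ∃ λ v → P v ≡ true
  #-pos⁻ {P} pos with ∑-pigeonhole-< (allFin n) (λ _ → 0) (λ v → ⟦ P v ⟧) (≤-<-trans (≤-reflexive (∑-zero (allFin n))) pos)
  ... | v , _ , lt with P v in eq
  ...   | true = v , eq

allFin-suc : ∀ {n} (f : Fin (suc n) → ℕ) → ∑ (allFin (suc n)) f ≡ f zero + ∑ (allFin n) (f ∘ suc)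
allFin-suc {n} f = cong (f zero +_) (trans (cong (λ l → ∑ l f) (tabulate-suc n)) (∑-map (allFin n) suc f))
  where
  open import Data.List.Properties using (map-tabulate)
  tabulate-suc : ∀ n → Data.List.tabulate {A = Fin (suc n)} {n = n} suc ≡ map suc (allFin n)
  tabulate-suc n = sym (map-tabulate id suc)

length-allFin : ∀ n → length (allFin n) ≡ n
length-allFin n = Data.List.Properties.length-tabulate {n = n} id

#≤n : ∀ {n} (P : Fin n → Bool) → # P ≤ n
#≤n {n} P = ≤-trans (∑-mono (allFin n) (λ v → ⟦⟧≤1 (P v)))
  (≤-reflexive (trans (∑-const (allFin n) 1) (trans (*-identityʳ _) (length-allFin n))))

#-singleton : ∀ {n} (w : Fin n) → # (λ v → ⌊ v ≟ w ⌋) ≡ 1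
#-singleton {suc n} zero    = trans (allFin-suc {n} (λ v → ⟦ ⌊ v ≟ zero ⌋ ⟧)) (cong suc (∑-zero (allFin n)))
#-singleton {suc n} (suc w) = trans (allFin-suc {n} (λ v → ⟦ ⌊ v ≟ suc w ⌋ ⟧))
  (trans (∑-cong (allFin n) (λ v → cong ⟦_⟧ (suc-≟ v w))) (#-singleton w))
  where
  suc-≟ : ∀ v w → ⌊ Data.Fin.suc v ≟ suc w ⌋ ≡ ⌊ v ≟ w ⌋
  suc-≟ v w with v ≟ w
  ... | yes _ = refl
  ... | no  _ = refl

#-strict : ∀ {n} {P Q : Fin n → Bool} (w : Fin n) → P ⊆ᵇ Q → P w ≡ false → Q w ≡ true → # P < # Q
#-strict {n} {P} {Q} w P⊆Q Pw Qw = begin-strict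
  # P                                    <⟨ n<1+n _ ⟩
  1 + # P                                ≡⟨ cong (_+ # P) (sym (#-singleton w)) ⟩
  # (λ v → ⌊ v ≟ w ⌋) + # P              ≡⟨ sym (∑-+ (allFin n) _ _) ⟩
  ∑ (allFin n) (λ v → ⟦ ⌊ v ≟ w ⌋ ⟧ + ⟦ P v ⟧) ≤⟨ ∑-mono (allFin n) pointwise ⟩
  # Q                                    ∎
  where
  open ≤-Reasoning
  pointwise : ∀ v → ⟦ ⌊ v ≟ w ⌋ ⟧ + ⟦ P v ⟧ ≤ ⟦ Q v ⟧
  pointwise v with v ≟ w
  ... | yes refl rewrite Pw | Qw = ≤-refl
  ... | no _ = ⟦⟧-mono (P⊆Q v)

∣tabulate∣ : ∀ {n} (P : Fin n → Bool) → ∣ tabulate P ∣ ≡ # P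
∣tabulate∣ {zero}  P = refl
∣tabulate∣ {suc n} P = trans (∣∷∣ (P zero) (tabulate (P ∘ suc)))
  (trans (cong (⟦ P zero ⟧ +_) (∣tabulate∣ (P ∘ suc))) (sym (allFin-suc (λ v → ⟦ P v ⟧))))
  where
  ∣∷∣ : ∀ {n} b (p : Subset n) → ∣ b Data.Vec.∷ p ∣ ≡ ⟦ b ⟧ + ∣ p ∣
  ∣∷∣ true  p = refl
  ∣∷∣ false p = refl

∣_∣-lookup : ∀ {n} (p : Subset n) → ∣ p ∣ ≡ # (lookup p)
∣ p ∣-lookup = trans (cong ∣_∣ (sym (tabulate∘lookup p))) (∣tabulate∣ (lookup p))

-- Walks inside a vertex set

least : {P : ℕ → Set} → (∀ m → Dec (P m)) → ∀ N → P N → ∃ λ m → P m × (∀ j → P j → m ≤ j)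
least P? zero    p = 0 , p , λ _ _ → z≤n
least P? (suc N) p with P? 0
... | yes p₀ = 0 , p₀ , λ _ _ → z≤n
... | no ¬p₀ with least (P? ∘ suc) N p
...   | m , pm , min = suc m , pm , λ { zero q → ⊥-elim (¬p₀ q) ; (suc j) q → s≤s (min j q) }

remove : ∀ {n} → Fin n → (Fin n → Bool) → Fin n → Bool
remove a P v = P v ∧ not ⌊ v ≟ a ⌋

remove-≢ : ∀ {n} {a v : Fin n} {P : Fin n → Bool} → P v ≡ true → v ≢ a → remove a P v ≡ true
remove-≢ {a = a} {v} Pv v≢a = ∧-true Pv (not-true (⌊⌋-false (v ≟ a) v≢a))

remove-false : ∀ {n} (a : Fin n) (P : Fin n → Bool) → remove a P a ≡ false
remove-false a P with P a | a ≟ a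
... | false | _     = refl
... | true  | yes _ = refl
... | true  | no ¬p = ⊥-elim (¬p refl)

module Walks {n : ℕ} (_~_ : Fin n → Fin n → Bool) (~-sym : ∀ u v → (u ~ v) ≡ (v ~ u)) where

  data Walk (P : Fin n → Bool) : ℕ → Fin n → Fin n → Set where
    stop : ∀ {a} → P a ≡ true → Walk P 0 a a
    go   : ∀ {m a b c} → P a ≡ true → (a ~ b) ≡ true → Walk P m b c → Walk P (suc m) a c

  Conn : (Fin n → Bool) → Fin n → Fin n → Set
  Conn P a c = ∃ λ m → Walk P m a c

  module _ {P : Fin n → Bool} where

    walk-start : ∀ {m a c} → Walk P m a c → P a ≡ true
    walk-start (stop p)   = p
    walk-start (go p _ _) = p

    walk-end : ∀ {m a c} → Walk P m a c → P c ≡ true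
    walk-end (stop p)   = p
    walk-end (go _ _ w) = walk-end w

    append : ∀ {l m a b c} → Walk P l a b → Walk P m b c → Walk P (l + m) a c
    append (stop _)   w′ = w′
    append (go p e w) w′ = go p e (append w w′)

    snoc : ∀ {m a b c} → Walk P m a b → (b ~ c) ≡ true → P c ≡ true → Walk P (suc m) a c
    snoc (stop p)   e q = go p e (stop q)
    snoc (go p d w) e q = go p d (snoc w e q)

    reverse : ∀ {m a c} → Walk P m a c → Walk P m c a
    reverse (stop p)   = stop p
    reverse (go p e w) = snoc (reverse w) (trans (~-sym _ _) e) p

    walk-mono : ∀ {Q m a c} → P ⊆ᵇ Q → Walk P m a c → Walk Q m a c
    walk-mono h (stop p)   = stop (h _ p)
    walk-mono h (go p e w) = go (h _ p) e (walk-mono h w)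

    conn-refl : ∀ {a} → P a ≡ true → Conn P a a
    conn-refl p = 0 , stop p

    conn-trans : ∀ {a b c} → Conn P a b → Conn P b c → Conn P a c
    conn-trans (_ , w) (_ , w′) = _ , append w w′

    conn-sym : ∀ {a b} → Conn P a b → Conn P b a
    conn-sym (_ , w) = _ , reverse w

    conn-edge : ∀ {a b} → P a ≡ true → P b ≡ true → (a ~ b) ≡ true → Conn P a b
    conn-edge p q e = 1 , go p e (stop q)

    conn-mono : ∀ {Q a c} → P ⊆ᵇ Q → Conn P a c → Conn Q a c
    conn-mono h (_ , w) = _ , walk-mono h w

    -- Cutting a walk at its last visit of a.
    avoid : ∀ {m x c} (a : Fin n) → c ≢ a → Walk P m x c →
            Conn (remove a P) x c ⊎ ∃ λ b → (a ~ b) ≡ true × Conn (remove a P) b c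
    avoid a c≢a (stop p) = inj₁ (conn-refl′ p c≢a)
      where
      conn-refl′ : ∀ {v} → P v ≡ true → v ≢ a → Conn (remove a P) v v
      conn-refl′ p v≢a = 0 , stop (remove-≢ {P = P} p v≢a)
    avoid {x = x} a c≢a (go p e w) with avoid a c≢a w
    ... | inj₂ r = inj₂ r
    ... | inj₁ (m , w′) with x ≟ a
    ...   | yes refl = inj₂ (_ , e , m , w′)
    ...   | no x≢a   = inj₁ (suc m , go (remove-≢ {P = P} p x≢a) e w′)

  walk? : ∀ P m a c → Dec (Walk P m a c)
  walk? P zero a c with P a ≟ᵇ true | a ≟ c
  ... | yes p | yes refl = yes (stop p)
  ... | yes p | no a≢c   = no λ { (stop _) → a≢c refl }
  ... | no ¬p | _        = no (¬p ∘ walk-start)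
  walk? P (suc m) a c with P a ≟ᵇ true
  ... | no ¬p = no (¬p ∘ walk-start)
  ... | yes p = map′ (λ (b , e , w) → go p e w) (λ { (go _ e w) → _ , e , w })
                     (any? λ b → (a ~ b) ≟ᵇ true ×-dec walk? P m b c)

  -- Search with deletion of the visited vertex: a walk cut at its last visit of `a` continues from
  -- a neighbour of `a` without `a`, so nothing is lost, and `# P` drops with every call.
  conn? : ∀ P a c → Dec (Conn P a c)
  conn? P = search (# P) P ≤-refl
    where
    search : ∀ fuel P → # P ≤ fuel → ∀ a c → Dec (Conn P a c)
    search fuel P le a c with P a ≟ᵇ true
    search fuel P le a c | no ¬p = no (¬p ∘ walk-start ∘ proj₂)
    search zero P le a c | yes p = ⊥-elim (<⇒≱ (#-pos {P = P} p) le)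
    search (suc fuel) P le a c | yes p with c ≟ a
    ... | yes refl = yes (conn-refl p)
    ... | no c≢a = map′ sound complete (any? λ b → (a ~ b) ≟ᵇ true ×-dec search fuel (remove a P) le′ b c)
      where
      le′ : # (remove a P) ≤ fuel
      le′ = s≤s⁻¹ (<-≤-trans (#-strict a (λ _ → ∧-trueˡ) (remove-false a P) p) le)
        where open Data.Nat using (s≤s⁻¹)
      sound : ∃ (λ b → (a ~ b) ≡ true × Conn (remove a P) b c) → Conn P a c
      sound (b , e , _ , w) = _ , go p e (walk-mono (λ _ → ∧-trueˡ) w)
      complete : Conn P a c → ∃ λ b → (a ~ b) ≡ true × Conn (remove a P) b c
      complete (_ , w) with avoid a c≢a w
      ... | inj₂ r = r
      ... | inj₁ (_ , w′) = ⊥-elim (true≢false (walk-start w′) (remove-false a P))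

  verts : ∀ {P m a c} → Walk P m a c → List (Fin n)
  verts (stop {a} _)       = a ∷ []
  verts (go {a = a} _ _ w) = a ∷ verts w

  verts-P : ∀ {P m a c} (w : Walk P m a c) {v} → v ∈ₗ verts w → P v ≡ true
  verts-P (stop p)   (here refl) = p
  verts-P (go p _ _) (here refl) = p
  verts-P (go _ _ w) (there v∈)  = verts-P w v∈

  start∈verts : ∀ {P m a c} (w : Walk P m a c) → a ∈ₗ verts w
  start∈verts (stop _)   = here refl
  start∈verts (go _ _ _) = here refl

  Shortest : ∀ {P m a c} → Walk P m a c → Set
  Shortest {P} {m} {a} {c} _ = ∀ j → Walk P j a c → m ≤ j

  shortest : ∀ {P a c} → Conn P a c → ∃ λ m → Σ (Walk P m a c) Shortest
  shortest {P} {a} {c} (m , w) with least (λ m → walk? P m a c) m w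
  ... | m′ , w′ , min = m′ , w′ , min

  -- If Q has P-diameter at most N then a P-shortest walk visits Q at most N + 1 times:
  -- all visits have, up to N, the same distance to the end.
  module _ (P Q : Fin n → Bool) (N : ℕ)
           (close : ∀ p q → P p ≡ true → P q ≡ true → Q p ≡ true → Q q ≡ true → ∃ λ j → j ≤ N × Walk P j p q) where

    visits : ∀ {m a c} → Walk P m a c → ℕ
    visits w = ∑ (verts w) (λ v → ⟦ Q v ⟧)

    private
      tail-shortest : ∀ {m a b c} {p : P a ≡ true} {e : (a ~ b) ≡ true} {w : Walk P m b c} →
                      Shortest (go p e w) → Shortest w
      tail-shortest {p = p} {e} min j w′ = ≤-pred (min (suc j) (go p e w′))

      -- The positions of the walk have distances m, ..., 0 to its end, measured along it, and a
      -- visit to `Q` occurs only at those of distance at least `L`.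
      visits-late : ∀ {m b c} L (w : Walk P m b c) →
                    (∀ q m′ → Q q ≡ true → Walk P m′ q c → L ≤ m′) → visits w ≤ suc m ∸ L
      visits-late L (stop {a} p) h with Q a in eq
      ... | false = z≤n
      ... | true  with z≤n ← h a 0 eq (stop p) = ≤-refl
      visits-late L (go {m} {a} p e w) h with Q a in eq
      ... | false = ≤-trans (visits-late L w h) (∸-monoˡ-≤ L (n≤1+n (suc m)))
      ... | true  = ≤-trans (s≤s (visits-late L w h))
                            (≤-reflexive (sym (+-∸-assoc 1 (h a (suc m) eq (go p e w)))))

      visits-from : ∀ {m b c} (w : Walk P m b c) → Shortest w → Q b ≡ true → visits w ≤ suc N
      visits-from {m} {b} {c} w min Qb = ≤-trans (visits-late (m ∸ N) w far) bound
        where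
        far : ∀ q m′ → Q q ≡ true → Walk P m′ q c → m ∸ N ≤ m′
        far q m′ Qq w′ with close b q (walk-start w) (walk-start w′) Qb Qq
        ... | j , j≤N , v = m≤n+o⇒m∸n≤o m N (≤-trans (min (j + m′) (append v w′)) (+-monoˡ-≤ m′ j≤N))
        bound : suc m ∸ (m ∸ N) ≤ suc N
        bound = m≤n+o⇒m∸n≤o (suc m) (m ∸ N)
          (≤-trans (s≤s (m≤n+m∸n m N)) (≤-reflexive (trans (cong suc (+-comm N _)) (sym (+-suc (m ∸ N) N)))))

    visits≤ : ∀ {m a c} (w : Walk P m a c) → Shortest w → visits w ≤ suc N
    visits≤ (stop {a} p) min with Q a
    ... | true  = s≤s z≤n
    ... | false = z≤n
    visits≤ w@(go {a = a} p e w′) min with Q a in eq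
    ... | false = visits≤ w′ (tail-shortest {p = p} {e} {w′} min)
    ... | true  = ≤-trans (≤-reflexive (cong (λ b → ⟦ b ⟧ + visits w′) (sym eq))) (visits-from w min eq)

-- Bernoulli inequalities

-- This is (1 + c/q)^m ≥ 1 + mc/q multiplied by q^(m+1); without division it also covers q = 0.
bernoulli : ∀ q c m → q ^ m * (q + m * c) ≤ q * (q + c) ^ m
bernoulli q c zero    = ≤-reflexive (lhs q)
  where
  lhs : ∀ q → 1 * (q + 0) ≡ q * 1
  lhs = solve-∀
bernoulli q c (suc m) = begin
  q * q ^ m * (q + suc m * c)      ≡⟨ e₁ q (q ^ m) m c ⟩
  q ^ m * (q * (q + suc m * c))    ≤⟨ *-monoʳ-≤ (q ^ m) (≤-trans (m≤m+n _ (m * c * c)) (≤-reflexive (e₂ q m c))) ⟩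
  q ^ m * ((q + m * c) * (q + c))  ≡⟨ sym (*-assoc (q ^ m) _ _) ⟩
  q ^ m * (q + m * c) * (q + c)    ≤⟨ *-monoˡ-≤ (q + c) (bernoulli q c m) ⟩
  q * (q + c) ^ m * (q + c)        ≡⟨ e₃ q ((q + c) ^ m) (q + c) ⟩
  q * ((q + c) * (q + c) ^ m)      ∎
  where
  open ≤-Reasoning
  e₁ : ∀ q x m c → q * x * (q + suc m * c) ≡ x * (q * (q + suc m * c))
  e₁ = solve-∀
  e₂ : ∀ q m c → q * (q + suc m * c) + m * c * c ≡ (q + m * c) * (q + c)
  e₂ = solve-∀
  e₃ : ∀ a b c → a * b * c ≡ a * (c * b)
  e₃ = solve-∀

double-^ : ∀ q c m → 0 < q → q ≤ m * c → 2 * q ^ m ≤ (q + c) ^ m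
double-^ q@(suc _) c m _ le = *-cancelˡ-≤ q (begin
  q * (2 * q ^ m)       ≡⟨ e q (q ^ m) ⟩
  q ^ m * (q + q)       ≤⟨ *-monoʳ-≤ (q ^ m) (+-monoʳ-≤ q le) ⟩
  q ^ m * (q + m * c)   ≤⟨ bernoulli q c m ⟩
  q * (q + c) ^ m       ∎)
  where
  open ≤-Reasoning
  e : ∀ q x → q * (2 * x) ≡ x * (q + q)
  e = solve-∀

double-^-suc : ∀ q → 2 * q ^ suc q ≤ suc q ^ suc q
double-^-suc zero      = z≤n
double-^-suc q@(suc _) = ≤-trans (double-^ q 1 (suc q) (s≤s z≤n) (≤-trans (n≤1+n q) (≤-reflexive (sym (*-identityʳ (suc q))))))
                                 (≤-reflexive (cong (_^ suc q) (+-comm q 1)))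

*-pos : ∀ {a b} → 0 < a → 0 < b → 0 < a * b
*-pos (s≤s _) (s≤s _) = s≤s z≤n

^-pos : ∀ {a} m → 0 < a → 0 < a ^ m
^-pos {suc a} m _ = m^n>0 (suc a) m

power-≤ : ∀ {a b} m → a ≤ b → a ^ m ≤ b ^ m
power-≤ m = ^-monoˡ-≤ m

2^-cancel-≤ : ∀ {x y} → 2 ^ x ≤ 2 ^ y → x ≤ y
2^-cancel-≤ le = ≮⇒≥ λ lt → <⇒≱ (^-monoʳ-< 2 (s≤s (s≤s z≤n)) lt) le

*-^ : ∀ m a b → (a * b) ^ m ≡ a ^ m * b ^ m
*-^ zero    a b = refl
*-^ (suc m) a b = trans (cong (a * b *_) (*-^ m a b)) (e a b (a ^ m) (b ^ m))
  where
  e : ∀ a b x y → a * b * (x * y) ≡ a * x * (b * y)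
  e = solve-∀

-- (1 + c/Q)^(2Q) ≥ 2^c for c ≤ Q, the factor 2 in the exponent absorbing the rounding of Q/c.
exp-lower : ∀ Q c → 0 < Q → c ≤ Q → 2 ^ c * Q ^ (2 * Q) ≤ (Q + c) ^ (2 * Q)
exp-lower Q zero Q>0 _ = ≤-reflexive (trans (*-identityˡ _) (cong (_^ (2 * Q)) (sym (+-identityʳ Q))))
exp-lower Q c@(suc _) Q>0 c≤Q = begin
  2 ^ c * Q ^ (2 * Q)               ≡⟨ cong (λ x → 2 ^ c * Q ^ x) (sym (m+[n∸m]≡n mc≤2Q)) ⟩
  2 ^ c * Q ^ (m * c + r)           ≡⟨ cong (2 ^ c *_) (^-distribˡ-+-* Q (m * c) r) ⟩
  2 ^ c * (Q ^ (m * c) * Q ^ r)     ≡⟨ sym (*-assoc (2 ^ c) _ _) ⟩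
  2 ^ c * Q ^ (m * c) * Q ^ r       ≡⟨ cong (λ x → 2 ^ c * x * Q ^ r) (sym (^-*-assoc Q m c)) ⟩
  2 ^ c * (Q ^ m) ^ c * Q ^ r       ≡⟨ cong (_* Q ^ r) (sym (*-^ c 2 (Q ^ m))) ⟩
  (2 * Q ^ m) ^ c * Q ^ r           ≤⟨ *-mono-≤ (power-≤ c (double-^ Q c m Q>0 Q≤mc)) (power-≤ r (m≤m+n Q c)) ⟩
  ((Q + c) ^ m) ^ c * (Q + c) ^ r   ≡⟨ cong (_* (Q + c) ^ r) (^-*-assoc (Q + c) m c) ⟩
  (Q + c) ^ (m * c) * (Q + c) ^ r   ≡⟨ sym (^-distribˡ-+-* (Q + c) (m * c) r) ⟩
  (Q + c) ^ (m * c + r)             ≡⟨ cong ((Q + c) ^_) (m+[n∸m]≡n mc≤2Q) ⟩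
  (Q + c) ^ (2 * Q)                 ∎
  where
  open ≤-Reasoning
  open import Data.Nat.DivMod using (_/_; m≡m%n+[m/n]*n; m%n<n; m/n*n≤m)
  m = suc (Q / c)
  r = 2 * Q ∸ m * c
  Q≤mc : Q ≤ m * c
  Q≤mc = ≤-trans (≤-reflexive (m≡m%n+[m/n]*n Q c)) (+-monoˡ-≤ (Q / c * c) (<⇒≤ (m%n<n Q c)))
  mc≤2Q : m * c ≤ 2 * Q
  mc≤2Q = +-mono-≤ c≤Q (≤-trans (m/n*n≤m Q c) (≤-reflexive (sym (+-identityʳ Q))))

-- Bernoulli for the base q/(q+1): with i = q + 1 - j it reads (1 + 1/q)^j ≤ 1/(1 - j/(q+1)).
-- Carrying `i` along avoids truncated subtraction.
bernoulli-upper : ∀ q j i → i + j ≡ suc q → suc q ^ j * i ≤ q ^ j * suc q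
bernoulli-upper q zero    i e = ≤-reflexive (cong (1 *_) (trans (sym (+-identityʳ i)) e))
bernoulli-upper q (suc j) i e = begin
  suc q * suc q ^ j * i     ≡⟨ e₁ (suc q) (suc q ^ j) i ⟩
  suc q ^ j * (suc q * i)   ≤⟨ *-monoʳ-≤ (suc q ^ j) (≤-trans (+-monoˡ-≤ (q * i) i≤q) (≤-reflexive (sym (*-suc q i)))) ⟩
  suc q ^ j * (q * suc i)   ≡⟨ e₂ (suc q ^ j) q (suc i) ⟩
  q * (suc q ^ j * suc i)   ≤⟨ *-monoʳ-≤ q (bernoulli-upper q j (suc i) (trans (sym (+-suc i j)) e)) ⟩
  q * (q ^ j * suc q)       ≡⟨ sym (*-assoc q (q ^ j) (suc q)) ⟩
  q * q ^ j * suc q         ∎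
  where
  open ≤-Reasoning
  e₁ : ∀ a b c → a * b * c ≡ b * (a * c)
  e₁ = solve-∀
  e₂ : ∀ a b c → a * (b * c) ≡ b * (a * c)
  e₂ = solve-∀
  i≤q : i ≤ q
  i≤q = ≤-trans (m≤m+n i j) (≤-reflexive (suc-injective (trans (sym (+-suc i j)) e)))

-- The case j = m, q = 2m of the previous estimate gives (1 + 1/2m)^m ≤ (2m+1)/(m+1) ≤ 2, and the
-- exponent 2mt consists of 2t blocks of length m.
exp-upper : ∀ m t → suc (2 * m) ^ (2 * m * t) ≤ 4 ^ t * (2 * m) ^ (2 * m * t)
exp-upper m t = begin
  suc (2 * m) ^ (2 * m * t)              ≡⟨ expo (suc (2 * m)) ⟩
  (suc (2 * m) ^ m) ^ (2 * t)            ≤⟨ power-≤ (2 * t) half ⟩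
  (2 * (2 * m) ^ m) ^ (2 * t)            ≡⟨ *-^ (2 * t) 2 ((2 * m) ^ m) ⟩
  2 ^ (2 * t) * ((2 * m) ^ m) ^ (2 * t)  ≡⟨ cong₂ _*_ (sym (^-*-assoc 2 2 t)) (sym (expo (2 * m))) ⟩
  4 ^ t * (2 * m) ^ (2 * m * t)          ∎
  where
  open ≤-Reasoning
  comm : ∀ m t → 2 * m * t ≡ m * (2 * t)
  comm = solve-∀
  expo : ∀ x → x ^ (2 * m * t) ≡ (x ^ m) ^ (2 * t)
  expo x = trans (cong (x ^_) (comm m t)) (sym (^-*-assoc x m (2 * t)))
  sum≡ : ∀ m → suc m + m ≡ suc (2 * m)
  sum≡ = solve-∀
  shape : ∀ x m → x * suc (2 * m) + x ≡ 2 * x * suc m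
  shape = solve-∀
  half : suc (2 * m) ^ m ≤ 2 * (2 * m) ^ m
  half = *-cancelʳ-≤ _ _ (suc m) (begin
    suc (2 * m) ^ m * suc m                    ≤⟨ bernoulli-upper (2 * m) m (suc m) (sum≡ m) ⟩
    (2 * m) ^ m * suc (2 * m)                  ≤⟨ m≤m+n _ ((2 * m) ^ m) ⟩
    (2 * m) ^ m * suc (2 * m) + (2 * m) ^ m    ≡⟨ shape ((2 * m) ^ m) m ⟩
    2 * (2 * m) ^ m * suc m                    ∎)

-- Greedy hitting sets

-- `y` divided by `D` is a fractional hitting set of total value at most q + 1; the separate scale
-- `D` keeps all values natural numbers.
module HittingSet {n : ℕ} (hit : Fin n → Fin n → Bool) (y : Fin n → ℕ) (D q : ℕ) (D>0 : 0 < D)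
                  (total : ∑ (allFin n) y ≤ suc q * D) where

  Heavy : (Fin n → Bool) → Set
  Heavy b = ∀ v → b v ≡ true → D ≤ ∑ (allFin n) (λ w → y w * ⟦ hit v w ⟧)

  Hits : (Fin n → Bool) → (Fin n → Bool) → Set
  Hits Y b = ∀ v → b v ≡ true → ∃ λ w → Y w ≡ true × hit v w ≡ true

  private
    covered : (Fin n → Bool) → Fin n → ℕ
    covered b w = # (λ v → b v ∧ hit v w)

    weighted-double-count : ∀ b → Heavy b → # b * D ≤ ∑ (allFin n) (λ w → y w * covered b w)
    weighted-double-count b heavy = begin
      # b * D                                                           ≡⟨ sym (∑-*ʳ (allFin n) D _) ⟩
      ∑ (allFin n) (λ v → ⟦ b v ⟧ * D)                                  ≤⟨ ∑-mono (allFin n) pointwise ⟩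
      ∑ (allFin n) (λ v → ∑ (allFin n) (λ w → y w * ⟦ b v ∧ hit v w ⟧)) ≡⟨ ∑-swap (allFin n) (allFin n) _ ⟩
      ∑ (allFin n) (λ w → ∑ (allFin n) (λ v → y w * ⟦ b v ∧ hit v w ⟧)) ≡⟨ ∑-cong (allFin n) (λ w → ∑-*ˡ (allFin n) (y w) _) ⟩
      ∑ (allFin n) (λ w → y w * covered b w)                            ∎
      where
      open ≤-Reasoning
      pointwise : ∀ v → ⟦ b v ⟧ * D ≤ ∑ (allFin n) (λ w → y w * ⟦ b v ∧ hit v w ⟧)
      pointwise v with b v in eq
      ... | false = z≤n
      ... | true  = ≤-trans (≤-reflexive (+-identityʳ D)) (heavy v eq)

    -- Averaging with `y` as the distribution: if every `w` fell short, integrality would give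
    -- `suc q * covered b w + 1 ≤ # b`. Weighted by `y`, the extra 1 adds up to the sum of `y`,
    -- which then has to vanish, and `Heavy` fails.
    popular : ∀ b → 0 < # b → Heavy b → ∃ λ w → # b ≤ suc q * covered b w
    popular b pos heavy with any? (λ w → # b ≤?ⁿ suc q * covered b w)
    ... | yes r = r
    ... | no none = ⊥-elim (<⇒≱ (*-pos pos D>0) (begin
        # b * D                                  ≤⟨ weighted-double-count b heavy ⟩
        ∑ (allFin n) (λ w → y w * covered b w)   ≤⟨ ∑-mono (allFin n) (λ w → *-monoʳ-≤ (y w) (#-mono {P = λ v → b v ∧ hit v w} (λ _ → ∧-trueˡ))) ⟩
        ∑ (allFin n) (λ w → y w * # b)           ≡⟨ ∑-*ʳ (allFin n) (# b) y ⟩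
        ∑ (allFin n) y * # b                     ≡⟨ cong (_* # b) y≡0 ⟩
        0                                        ∎))
      where
      open ≤-Reasoning
      e₁ : ∀ a b c → a * (b * c) ≡ b * (a * c)
      e₁ = solve-∀
      e₂ : ∀ y q c → y + q * (y * c) ≡ y * suc (q * c)
      e₂ = solve-∀
      excess : ∑ (allFin n) y + suc q * (# b * D) ≤ suc q * (# b * D)
      excess = begin
        ∑ (allFin n) y + suc q * (# b * D)                                     ≤⟨ +-monoʳ-≤ (∑ (allFin n) y) (*-monoʳ-≤ (suc q) (weighted-double-count b heavy)) ⟩
        ∑ (allFin n) y + suc q * ∑ (allFin n) (λ w → y w * covered b w)        ≡⟨ cong (∑ (allFin n) y +_) (sym (∑-*ˡ (allFin n) (suc q) _)) ⟩
        ∑ (allFin n) y + ∑ (allFin n) (λ w → suc q * (y w * covered b w))      ≡⟨ sym (∑-+ (allFin n) _ _) ⟩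
        ∑ (allFin n) (λ w → y w + suc q * (y w * covered b w))                 ≡⟨ ∑-cong (allFin n) (λ w → e₂ (y w) (suc q) (covered b w)) ⟩
        ∑ (allFin n) (λ w → y w * suc (suc q * covered b w))                   ≤⟨ ∑-mono (allFin n) (λ w → *-monoʳ-≤ (y w) (≰⇒> λ le → none (w , le))) ⟩
        ∑ (allFin n) (λ w → y w * # b)                                         ≡⟨ ∑-*ʳ (allFin n) (# b) y ⟩
        ∑ (allFin n) y * # b                                                   ≤⟨ *-monoˡ-≤ (# b) total ⟩
        suc q * D * # b                                                        ≡⟨ trans (*-assoc (suc q) D (# b)) (cong (suc q *_) (*-comm D (# b))) ⟩
        suc q * (# b * D)                                                      ∎
      y≡0 : ∑ (allFin n) y ≡ 0
      y≡0 = n≤0⇒n≡0 (+-cancelʳ-≤ (suc q * (# b * D)) _ 0 excess)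

  -- Each chosen `w` hits at least a fraction 1/(q+1) of what is left, so m choices leave at most
  -- the fraction (q/(q+1))^m of `b`; the hypothesis says that this is less than one vertex.
  greedy : ∀ m b → Heavy b → # b * q ^ m < suc q ^ m → ∃ λ Y → # Y ≤ m × Hits Y b
  greedy zero b heavy lt = (λ _ → false) , ≤-reflexive (∑-zero (allFin n)) , λ v bv → ⊥-elim (<⇒≱ (#-pos {P = b} bv) small)
    where
    small : # b ≤ 0
    small = ≤-pred (≤-trans (s≤s (≤-reflexive (sym (*-identityʳ (# b))))) lt)
  greedy (suc m) b heavy lt with # b ≟ⁿ 0
  ... | yes b≡0 = (λ _ → false) , ≤-trans (≤-reflexive (∑-zero (allFin n))) z≤n ,
                  λ v bv → ⊥-elim (<⇒≱ (#-pos {P = b} bv) (≤-reflexive b≡0))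
  ... | no b≢0 with popular b (n≢0⇒n>0 b≢0) heavy
  ...   | w , pop with greedy m b′ (λ v e → heavy v (∧-trueˡ e)) lt′
    where
    open ≤-Reasoning
    b′ : Fin n → Bool
    b′ v = b v ∧ not (hit v w)
    split : # b′ + covered b w ≡ # b
    split = trans (sym (∑-+ (allFin n) _ _)) (∑-cong (allFin n) λ v → cases (b v) (hit v w))
      where
      cases : ∀ x h → ⟦ x ∧ not h ⟧ + ⟦ x ∧ h ⟧ ≡ ⟦ x ⟧
      cases true  true  = refl
      cases true  false = refl
      cases false h     = refl
    shrink : # b′ * suc q ≤ # b * q
    shrink = +-cancelˡ-≤ (# b) _ _ (begin
      # b + # b′ * suc q                       ≤⟨ +-monoˡ-≤ _ pop ⟩
      suc q * covered b w + # b′ * suc q       ≡⟨ e (suc q) (covered b w) (# b′) ⟩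
      (# b′ + covered b w) * suc q             ≡⟨ cong (_* suc q) split ⟩
      # b * suc q                              ≡⟨ *-suc (# b) q ⟩
      # b + # b * q                            ∎)
      where
      e : ∀ a c b → a * c + b * a ≡ (b + c) * a
      e = solve-∀
    assoc : ∀ a b c → a * b * c ≡ a * c * b
    assoc = solve-∀
    lt′ : # b′ * q ^ m < suc q ^ m
    lt′ = *-cancelʳ-< (suc q) _ _ (begin-strict
      # b′ * q ^ m * suc q     ≡⟨ assoc (# b′) (q ^ m) (suc q) ⟩
      # b′ * suc q * q ^ m     ≤⟨ *-monoˡ-≤ (q ^ m) shrink ⟩
      # b * q * q ^ m          ≡⟨ *-assoc (# b) q (q ^ m) ⟩
      # b * (q * q ^ m)        <⟨ lt ⟩
      suc q * suc q ^ m        ≡⟨ *-comm (suc q) _ ⟩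
      suc q ^ m * suc q        ∎)
  ...     | Y , Y≤m , hits = (λ v → ⌊ v ≟ w ⌋ ∨ Y v) ,
            ≤-trans (#-∪ (λ v → ⌊ v ≟ w ⌋) Y) (+-mono-≤ (≤-reflexive (#-singleton w)) Y≤m) , hits′
    where
    hits′ : Hits (λ v → ⌊ v ≟ w ⌋ ∨ Y v) b
    hits′ v bv with hit v w in eq
    ... | true  = w , ∨-trueˡ (⌊⌋-true (w ≟ w) refl) , eq
    ... | false with hits v (∧-true bv (not-true eq))
    ...   | w′ , Yw′ , h = w′ , ∨-trueʳ {⌊ w′ ≟ w ⌋} Yw′ , h

  opaque
    -- Blocks of q + 1 greedy steps halve the remainder, since (1 + 1/q)^(q+1) ≥ 2, and ℓ halvings
    -- exhaust fewer than 2^ℓ vertices.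
    hitting-set : ∀ ℓ → 1 ≤ ℓ → n < 2 ^ ℓ → ∀ b → Heavy b → ∃ λ Y → # Y ≤ suc q * ℓ × Hits Y b
    hitting-set ℓ ℓ≥1 n<2^ℓ b heavy = greedy (suc q * ℓ) b heavy (begin-strict
      # b * q ^ (suc q * ℓ)         ≤⟨ *-monoˡ-≤ _ (#≤n b) ⟩
      n * q ^ (suc q * ℓ)           <⟨ decay q ⟩
      suc q ^ (suc q * ℓ)           ∎)
      where
      open ≤-Reasoning
      decay : ∀ q → n * q ^ (suc q * ℓ) < suc q ^ (suc q * ℓ)
      decay zero = ≤-<-trans (≤-reflexive (trans (cong (n *_) (zero-^ (1 * ℓ) (≤-trans ℓ≥1 (m≤m+n ℓ 0)))) (*-zeroʳ n)))
                              (^-pos {1} (1 * ℓ) (s≤s z≤n))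
        where
        zero-^ : ∀ m → 1 ≤ m → 0 ^ m ≡ 0
        zero-^ (suc m) _ = refl
      decay q@(suc _) = begin-strict
        n * q ^ (suc q * ℓ)            <⟨ *-monoˡ-< (q ^ (suc q * ℓ)) {{m^n≢0 q (suc q * ℓ)}} n<2^ℓ ⟩
        2 ^ ℓ * q ^ (suc q * ℓ)        ≡⟨ cong (2 ^ ℓ *_) (sym (^-*-assoc q (suc q) ℓ)) ⟩
        2 ^ ℓ * (q ^ suc q) ^ ℓ        ≡⟨ sym (*-^ ℓ 2 (q ^ suc q)) ⟩
        (2 * q ^ suc q) ^ ℓ            ≤⟨ power-≤ ℓ (double-^-suc q) ⟩
        (suc q ^ suc q) ^ ℓ            ≡⟨ ^-*-assoc (suc q) (suc q) ℓ ⟩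
        suc q ^ (suc q * ℓ)            ∎

-- Set systems

module _ {n : ℕ} where

  opaque
    -- The vertices that survive the deletion of all members with centers outside `S`. The first
    -- conjunct discards vertices in no member at all, which appear once the family is restricted to
    -- fewer centers.
    inside : (Fin n → Fin n → Bool) → (Fin n → Bool) → Fin n → Bool
    inside hit S v = ⌊ any? (λ w → hit v w ≟ᵇ true) ⌋ ∧ ⌊ all? (λ w → (hit v w ≟ᵇ true) →-dec (S w ≟ᵇ true)) ⌋

    inside-hit : ∀ {hit S v} → inside hit S v ≡ true → ∃ λ w → hit v w ≡ true
    inside-hit {hit} {S} {v} e = ⌊⌋-true⁻ (∧-trueˡ {⌊ any? (λ w → hit v w ≟ᵇ true) ⌋} e)

    inside-⊆ : ∀ {hit S v} → inside hit S v ≡ true → hit v ⊆ᵇ S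
    inside-⊆ {hit} {S} {v} e = ⌊⌋-true⁻ (∧-trueʳ {⌊ any? (λ w → hit v w ≟ᵇ true) ⌋} e)

    inside-intro : ∀ {hit S v w} → hit v w ≡ true → hit v ⊆ᵇ S → inside hit S v ≡ true
    inside-intro {hit} {S} {v} {w} h sub = ∧-true (⌊⌋-true (any? (λ w → hit v w ≟ᵇ true)) (w , h))
      (⌊⌋-true (all? (λ w → (hit v w ≟ᵇ true) →-dec (S w ≟ᵇ true))) sub)

  inside-mono : ∀ {hit S S′} → S ⊆ᵇ S′ → inside hit S ⊆ᵇ inside hit S′
  inside-mono sub v e with inside-hit e
  ... | w , h = inside-intro h (λ w′ h′ → sub w′ (inside-⊆ e w′ h′))

-- A minimum truncated at `K`: the value `K` may stand for a failed search, whence the guard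
-- `m < K`.
firstBelow : {P : ℕ → Set} → (∀ m → Dec (P m)) → ∀ K → ∃ λ m → m ≤ K × (m < K → P m) × (∀ j → P j → m ≤ j)
firstBelow P? zero    = 0 , z≤n , (λ ()) , λ _ _ → z≤n
firstBelow P? (suc K) with P? 0
... | yes p₀ = 0 , z≤n , (λ _ → p₀) , λ _ _ → z≤n
... | no ¬p₀ with firstBelow (P? ∘ suc) K
...   | m , m≤K , sound , min =
        suc m , s≤s m≤K , (λ { (s≤s lt) → sound lt }) , λ { zero q → ⊥-elim (¬p₀ q) ; (suc j) q → s≤s (min j q) }

∑-downFrom-interval : ∀ (P : ℕ → Bool) L c → (∀ t → P t ≡ true → L ≤ t × t < L + c) →
                      ∀ N → ∑ (downFrom N) (λ t → ⟦ P t ⟧) ≤ c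
∑-downFrom-interval P L c h = total
  where
  before : ∀ N → ∑ (downFrom N) (λ t → ⟦ P t ⟧) ≤ N ∸ L
  before zero = z≤n
  before (suc N) with P N in eq
  ... | true  = ≤-trans (s≤s (before N)) (≤-reflexive (sym (+-∸-assoc 1 (proj₁ (h N eq)))))
  ... | false = ≤-trans (before N) (∸-monoˡ-≤ L (n≤1+n N))
  total : ∀ N → ∑ (downFrom N) (λ t → ⟦ P t ⟧) ≤ c
  total zero = z≤n
  total (suc N) with P N in eq
  ... | true  = ≤-trans (s≤s (before N)) (≤-trans (≤-reflexive (sym (+-∸-assoc 1 (proj₁ (h N eq))))) (m≤n+o⇒m∸n≤o (suc N) L (proj₂ (h N eq))))
  ... | false = total N

∈-downFrom⇒< : ∀ {N t} → t ∈ₗ downFrom N → t < N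
∈-downFrom⇒< {suc N} (here refl) = n<1+n N
∈-downFrom⇒< {suc N} (there t∈)  = m<n⇒m<1+n (∈-downFrom⇒< t∈)

<⇒∈-downFrom : ∀ {N t} → t < N → t ∈ₗ downFrom N
<⇒∈-downFrom {suc N} {t} t<N with t ≟ⁿ N
... | yes refl = here refl
... | no t≢N   = there (<⇒∈-downFrom (≤∧≢⇒< (≤-pred t<N) t≢N))

opaque
  quotient : ∀ a b → 0 < b → ∃ λ q → a ≤ suc q * b × q * b ≤ a
  quotient a b@(suc _) _ = a / b ,
    ≤-trans (≤-reflexive (m≡m%n+[m/n]*n a b)) (+-monoˡ-≤ (a / b * b) (<⇒≤ (m%n<n a b))) , m/n*n≤m a b
    where open import Data.Nat.DivMod using (_/_; m≡m%n+[m/n]*n; m%n<n; m/n*n≤m)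

-- hit v w says that v lies in the member with center w.
module SetSystem {n : ℕ} (_~_ : Fin n → Fin n → Bool) (~-sym : ∀ u v → (u ~ v) ≡ (v ~ u))
                 (hit : Fin n → Fin n → Bool) where

  open Walks _~_ ~-sym public

  center : Fin n → Bool
  center w = hit w w

  -- What region growing needs from a layered family. A center lies in no member but its own. In
  -- `up`, the vertices of the walk lie only in members that also contain `v`, so the climb survives
  -- every deletion that spares `v`; the length bound `k` reflects the thickness.
  record Axioms (k : ℕ) : Set where
    field
      hit-center : ∀ v w w′ → hit v w ≡ true → hit w w′ ≡ true → w′ ≡ w
      up         : ∀ v w → hit v w ≡ true → ∃ λ m → m ≤ k × Walk (inside hit (hit v)) m v w

    hit⇒center : ∀ {v w} → hit v w ≡ true → center w ≡ true
    hit⇒center {v} {w} h with inside-hit (walk-end (proj₂ (proj₂ (up v w h))))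
    ... | w′ , h′ = subst (λ x → hit w x ≡ true) (hit-center v w w′ h h′) h′

    up-conn : ∀ {v w S} → hit v w ≡ true → hit v ⊆ᵇ S → Conn (inside hit S) v w
    up-conn {v} {w} {S} h sub with up v w h
    ... | m , _ , walk = m , walk-mono (inside-mono sub) walk

  weight : (Fin n → ℕ) → (Fin n → Bool) → ℕ
  weight ω S = ∑ (allFin n) (λ w → ω w * ⟦ S w ⟧)

  weight-mono : ∀ ω {S S′} → S ⊆ᵇ S′ → weight ω S ≤ weight ω S′
  weight-mono ω sub = ∑-mono (allFin n) (λ w → *-monoʳ-≤ (ω w) (⟦⟧-mono (sub w)))

  weight-∪ : ∀ ω S S′ → weight ω (S ∪ᵇ S′) ≤ weight ω S + weight ω S′
  weight-∪ ω S S′ = ≤-trans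
    (∑-mono (allFin n) (λ w → ≤-trans (*-monoʳ-≤ (ω w) (⟦∨⟧≤ (S w) (S′ w))) (≤-reflexive (*-distribˡ-+ (ω w) ⟦ S w ⟧ ⟦ S′ w ⟧))))
    (≤-reflexive (∑-+ (allFin n) _ _))

  weight-∈ : ∀ ω {S w} → S w ≡ true → ω w ≤ weight ω S
  weight-∈ ω {S} {w} e = ≤-trans (≤-reflexive (trans (sym (*-identityʳ (ω w))) (cong (λ b → ω w * ⟦ b ⟧) (sym e))))
                                 (∑-∈ (allFin n) (λ w → ω w * ⟦ S w ⟧) (∈-allFin w))

  -- Region growing

  reachable : (X Y : Fin n → Bool) → Fin n → Fin n → Bool
  reachable X Y x₀ x = X x ∧ ⌊ conn? (inside hit (center ∖ Y)) x₀ x ⌋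

  -- At most the fraction 1 - 1/g of `X` remains reachable, with the denominator cleared and without
  -- subtraction.
  Balanced : (g : ℕ) (X Y : Fin n → Bool) → Fin n → Set
  Balanced g X Y x₀ = g * # (reachable X Y x₀) + # X ≤ g * # X

  Near : (ω : Fin n → ℕ) (R : ℕ) → Fin n → Fin n → Set
  Near ω R u v = ∃ λ S → weight ω S ≤ R × Conn (inside hit S) u v

  -- `ρ` is the unit of length and `U` a lower bound for all weights. A total of at most (q+1)ρ
  -- limits the size of the separator; a total below 2^(ℓ+1) U limits how often a ball can double.
  module Rounding
    {k : ℕ} (axioms : Axioms k) (ω : Fin n → ℕ) (ℓ q ρ U g : ℕ) (X : Fin n → Bool)
    (ℓ≥1 : 1 ≤ ℓ) (n<2^ℓ : n < 2 ^ ℓ) (ρ>0 : 0 < ρ) (U>0 : 0 < U) (U≤ω : ∀ w → U ≤ ω w) (ρ≤ : ρ ≤ 2 ^ ℓ * U)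
    (total≤ : weight ω center ≤ suc q * ρ) (total< : weight ω center < 2 ^ suc ℓ * U)
    where

    open Axioms axioms

    -- The price of a cut, in centers per volume ρ. The factor ℓ comes from the greedy rounding, ℓ +
    -- 1 is the number of scales, and 24 = 2·3·2·2 collects the coefficient in `y`, the radii near a
    -- center in `near-count`, the growth in a thin annulus, and the rounding of a quotient.
    κ : ℕ
    κ = ℓ * (24 * suc ℓ)

    -- An annulus has width 2ρ: one ρ for the choice of the radius, another for the load of a
    -- boundary vertex, so that all centers of boundary vertices lie within `radius (suc i)`. The
    -- start at ρ puts `u` into every ball.
    radius : ℕ → ℕ
    radius i = suc (2 * i) * ρ

    radius-upper : ∀ {i t} → i ≤ ℓ → t < ρ → radius i + t ≤ radius (suc ℓ)
    radius-upper {i} {t} i≤ℓ t<ρ = ≤-trans (+-mono-≤ (≤-refl {radius i}) (≤-trans (<⇒≤ t<ρ) (m≤m+n ρ (ρ + 0))))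
      (≤-trans (≤-reflexive (e i ρ)) (*-monoˡ-≤ ρ (s≤s (*-monoʳ-≤ 2 (s≤s i≤ℓ)))))
      where
      e : ∀ i ρ → suc (2 * i) * ρ + 2 * ρ ≡ suc (2 * suc i) * ρ
      e = solve-∀

    radius-lower : ∀ i t → radius 0 ≤ radius i + t
    radius-lower i t = ≤-trans (*-monoˡ-≤ ρ {1} {suc (2 * i)} (s≤s z≤n)) (m≤m+n (radius i) t)

    load : Fin n → ℕ
    load v = weight ω (hit v)

    Separated : Set
    Separated = ∃ λ Y → # Y ≤ suc q * (ℓ + κ) × (∀ x₀ → center x₀ ≡ true → Y x₀ ≡ false → Balanced g X Y x₀)

    Clustered : Set
    Clustered = ∃ λ u → Σ (Fin n → Bool) λ K →
      (∀ v → K v ≡ true → Near ω (radius (suc ℓ)) u v) × g * # X < g * # (λ x → X x ∧ K x) + # X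

    module Ball (alive : Fin n → Bool) (alive⊆ : alive ⊆ᵇ center)
                (light : ∀ v → inside hit alive v ≡ true → load v ≤ ρ)
                (u : Fin n) (u-alive : alive u ≡ true) where

      -- `S` is a `Subset` rather than a Boolean function so that `anySubset?` decides its
      -- existence.
      Reach : Fin n → ℕ → Set
      Reach v r = ∃ λ (S : Subset n) → (lookup S ⊆ᵇ alive) × weight ω (lookup S) ≤ r × Conn (inside hit (lookup S)) u v

      reach? : ∀ v r → Dec (Reach v r)
      reach? v r = anySubset? λ S → all? (λ w → (lookup S w ≟ᵇ true) →-dec (alive w ≟ᵇ true))
                     ×-dec (weight ω (lookup S) ≤?ⁿ r) ×-dec conn? (inside hit (lookup S)) u v

      cap : ℕ
      cap = suc (radius (suc ℓ))

      opaque
        -- Distance from `u`, the price of a path being the weight of the live members that it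
        -- meets. It is truncated at `cap`, beyond every radius in use, so a value within such a
        -- radius is always attained by some `S`.
        φ : Fin n → ℕ
        φ v = proj₁ (firstBelow (reach? v) cap)

        φ≤cap : ∀ v → φ v ≤ cap
        φ≤cap v = proj₁ (proj₂ (firstBelow (reach? v) cap))

        φ-reach : ∀ v → φ v < cap → Reach v (φ v)
        φ-reach v = proj₁ (proj₂ (proj₂ (firstBelow (reach? v) cap)))

        φ-min : ∀ v r → Reach v r → φ v ≤ r
        φ-min v = proj₂ (proj₂ (proj₂ (firstBelow (reach? v) cap)))

      reach-intro : ∀ {v r} S → S ⊆ᵇ alive → weight ω S ≤ r → Conn (inside hit S) u v → Reach v r
      reach-intro {v} {r} S sub le conn = tabulate S ,
        (λ w e → sub w (trans (sym (lookup∘tabulate S w)) e)) ,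
        ≤-trans (weight-mono ω (λ w e → trans (sym (lookup∘tabulate S w)) e)) le ,
        conn-mono (inside-mono (λ w e → trans (lookup∘tabulate S w) e)) conn

      -- The climb from `v` to the center `w` meets only members containing `v`, all of which are
      -- already paid for.
      φ-up : ∀ {v w} → hit v w ≡ true → φ w ≤ φ v
      φ-up {v} {w} h with φ v <?ⁿ cap
      ... | no  v≥ = ≤-trans (φ≤cap w) (≮⇒≥ v≥)
      ... | yes v< with φ-reach v v<
      ...   | S , sub , le , conn = φ-min w (φ v)
              (S , sub , le , conn-trans conn (up-conn h (inside-⊆ (walk-end (proj₂ conn)))))

      -- Paying for all members through `v` costs at most `load v`, and with them present `link`
      -- leads from `v′` to `v`.
      φ-extend : ∀ {v′ v} → inside hit alive v ≡ true →
                 (∀ S → inside hit S v′ ≡ true → hit v ⊆ᵇ S → Conn (inside hit S) v′ v) → φ v ≤ φ v′ + load v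
      φ-extend {v′} {v} v-in link with φ v′ <?ⁿ cap
      ... | no  v≥ = ≤-trans (φ≤cap v) (≤-trans (≮⇒≥ v≥) (m≤m+n _ _))
      ... | yes v< with φ-reach v′ v<
      ...   | S , sub , le , conn = φ-min v (φ v′ + load v) (reach-intro S′ S′⊆
                (≤-trans (weight-∪ ω (lookup S) (hit v)) (+-monoˡ-≤ (load v) le))
                (conn-trans conn′ (link S′ (walk-end (proj₂ conn′)) (λ w e → ∨-trueʳ {lookup S w} e))))
        where
        S′ : Fin n → Bool
        S′ = lookup S ∪ᵇ hit v
        S′⊆ : S′ ⊆ᵇ alive
        S′⊆ w e with ∨-true⁻ {lookup S w} e
        ... | inj₁ s = sub w s
        ... | inj₂ h = inside-⊆ v-in w h
        conn′ : Conn (inside hit S′) u v′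
        conn′ = conn-mono (inside-mono (λ w → ∨-trueˡ)) conn

      φ-edge : ∀ {v′ v} → (v′ ~ v) ≡ true → inside hit alive v ≡ true → φ v ≤ φ v′ + load v
      φ-edge e v-in = φ-extend v-in λ S v′-in sub →
        conn-edge v′-in (inside-intro (proj₂ (inside-hit v-in)) sub) e

      φ-down : ∀ {v w} → hit v w ≡ true → inside hit alive v ≡ true → φ v ≤ φ w + load v
      φ-down h v-in = φ-extend v-in λ S _ sub → conn-sym (up-conn h sub)

      u-hit : hit u ⊆ᵇ alive
      u-hit w h = subst (λ x → alive x ≡ true) (sym (hit-center u u w (alive⊆ u u-alive) h)) u-alive

      φ-root : φ u ≤ ρ
      φ-root = ≤-trans (φ-min u (load u) (reach-intro (hit u) u-hit ≤-refl
                 (conn-refl (inside-intro (alive⊆ u u-alive) (λ _ e → e)))))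
               (light u (inside-intro (alive⊆ u u-alive) u-hit))

      within : ℕ → Fin n → Bool
      within r w = alive w ∧ ⌊ φ w ≤?ⁿ r ⌋

      vol : ℕ → ℕ
      vol r = weight ω (within r)

      vol-mono : ∀ {r r′} → r ≤ r′ → vol r ≤ vol r′
      vol-mono {r} {r′} le = weight-mono ω λ w e →
        ∧-true (∧-trueˡ e) (⌊⌋-true (φ w ≤?ⁿ r′) (≤-trans (⌊⌋-true⁻ {P? = φ w ≤?ⁿ r} (∧-trueʳ {alive w} e)) le))

      -- The smallest ball contains `u` and hence has volume at least `U`; as long as no annulus is
      -- thin, the volume doubles with each of them.
      doubling : ∀ j → (∃ λ i → i < j × vol (radius (suc i)) ≤ 2 * vol (radius i)) ⊎ 2 ^ j * U ≤ vol (radius j)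
      doubling zero = inj₂ (≤-trans (≤-reflexive (+-identityʳ U)) (≤-trans (U≤ω u)
        (weight-∈ ω (∧-true u-alive (⌊⌋-true (φ u ≤?ⁿ radius 0) (≤-trans φ-root (m≤m+n ρ 0)))))))
      doubling (suc j) with doubling j
      ... | inj₁ (i , i<j , le) = inj₁ (i , m<n⇒m<1+n i<j , le)
      ... | inj₂ ge with vol (radius (suc j)) ≤?ⁿ 2 * vol (radius j)
      ...   | yes le = inj₁ (j , n<1+n j , le)
      ...   | no ¬le = inj₂ (≤-trans (≤-reflexive (*-assoc 2 (2 ^ j) U)) (≤-trans (*-monoʳ-≤ 2 ge) (<⇒≤ (≰⇒> ¬le))))

      thin-annulus : ∃ λ i → i ≤ ℓ × vol (radius (suc i)) ≤ 2 * vol (radius i)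
      thin-annulus with doubling (suc ℓ)
      ... | inj₁ (i , i<j , le) = i , ≤-pred i<j , le
      ... | inj₂ ge = ⊥-elim (<⇒≱ total< (≤-trans ge (weight-mono ω λ w e → alive⊆ w (∧-trueˡ e))))

      Boundary : ℕ → Fin n → Set
      Boundary r v = inside hit alive v ≡ true × r < φ v × ∃ λ v′ → (v′ ~ v) ≡ true × φ v′ ≤ r

      opaque
        boundary? : ∀ r v → Dec (Boundary r v)
        boundary? r v = (inside hit alive v ≟ᵇ true) ×-dec (r <?ⁿ φ v) ×-dec any? (λ v′ → (v′ ~ v) ≟ᵇ true ×-dec (φ v′ ≤?ⁿ r))

      near : ℕ → ℕ → Fin n → Bool
      near a r w = ⌊ r ≤?ⁿ φ w + a ⌋ ∧ ⌊ φ w ≤?ⁿ r + a ⌋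

      -- A boundary vertex v at radius r only has centers w with |r − φ w| ≤ load v; choosing w with
      -- weight ω w / 2ʲU at every scale j with |r − φ w| ≤ 2ʲU therefore hits v fractionally.
      y : ℕ → ℕ → Fin n → ℕ
      y i r w = ∑ (downFrom (suc ℓ)) (λ j → ω w * ⟦ within (radius (suc i)) w ⟧ * (2 * 2 ^ (ℓ ∸ j) * ⟦ near (2 ^ j * U) r w ⟧))

      D : ℕ
      D = 2 ^ ℓ * U

      D>0 : 0 < D
      D>0 = *-pos (^-pos ℓ (s≤s z≤n)) U>0

      -- Radii within distance `a` of `φ w` form an interval of 2a + 1 integers, and 2a + 1 ≤ 3a
      -- because `a` is positive.
      near-count : ∀ a b w → 0 < a → ∀ N → ∑ (downFrom N) (λ t → ⟦ near a (b + t) w ⟧) ≤ 3 * a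
      near-count a b w a>0 N = ≤-trans (∑-downFrom-interval (λ t → near a (b + t) w) (φ w ∸ (b + a)) (suc (2 * a)) bounds N)
                                       (+-monoˡ-≤ (2 * a) a>0)
        where
        e₁ : ∀ b t a → b + t + a ≡ b + a + t
        e₁ = solve-∀
        e₂ : ∀ b a L → b + a + L + a ≡ b + (L + 2 * a)
        e₂ = solve-∀
        bounds : ∀ t → near a (b + t) w ≡ true → φ w ∸ (b + a) ≤ t × t < φ w ∸ (b + a) + suc (2 * a)
        bounds t e = m≤n+o⇒m∸n≤o (φ w) (b + a) (≤-trans lower (≤-reflexive (e₁ b t a))) ,
          ≤-<-trans (+-cancelˡ-≤ b t _ (≤-trans upper (≤-trans (+-monoˡ-≤ a (m≤n+m∸n (φ w) (b + a))) (≤-reflexive (e₂ b a _)))))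
                    (≤-reflexive (sym (+-suc (φ w ∸ (b + a)) (2 * a))))
          where
          upper : b + t ≤ φ w + a
          upper = ⌊⌋-true⁻ {P? = (b + t) ≤?ⁿ (φ w + a)} (∧-trueˡ e)
          lower : φ w ≤ b + t + a
          lower = ⌊⌋-true⁻ {P? = φ w ≤?ⁿ (b + t + a)} (∧-trueʳ {⌊ (b + t) ≤?ⁿ (φ w + a) ⌋} e)

      -- At scale j a center gets the coefficient 2·2^(ℓ-j) for at most 3·2^j U radii. The product
      -- is 6D whatever the scale, which is the purpose of these coefficients.
      total-y : ∀ i b → ∑ (downFrom ρ) (λ t → ∑ (allFin n) (y i (b + t))) ≤ suc ℓ * (6 * D) * vol (radius (suc i))
      total-y i b = begin
        ∑ (downFrom ρ) (λ t → ∑ (allFin n) (y i (b + t)))     ≡⟨ ∑-swap (downFrom ρ) (allFin n) _ ⟩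
        ∑ (allFin n) (λ w → ∑ (downFrom ρ) (λ t → y i (b + t) w)) ≤⟨ ∑-mono (allFin n) per-center ⟩
        ∑ (allFin n) (λ w → ω w * ⟦ within (radius (suc i)) w ⟧ * (suc ℓ * (6 * D))) ≡⟨ ∑-*ʳ (allFin n) (suc ℓ * (6 * D)) _ ⟩
        vol (radius (suc i)) * (suc ℓ * (6 * D))               ≡⟨ *-comm (vol (radius (suc i))) _ ⟩
        suc ℓ * (6 * D) * vol (radius (suc i))                 ∎
        where
        open ≤-Reasoning
        per-center : ∀ w → ∑ (downFrom ρ) (λ t → y i (b + t) w) ≤ ω w * ⟦ within (radius (suc i)) w ⟧ * (suc ℓ * (6 * D))
        per-center w = begin
          ∑ (downFrom ρ) (λ t → y i (b + t) w)   ≡⟨ ∑-swap (downFrom ρ) (downFrom (suc ℓ)) _ ⟩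
          ∑ (downFrom (suc ℓ)) (λ j → ∑ (downFrom ρ) (λ t → c * (2 * 2 ^ (ℓ ∸ j) * ⟦ near (2 ^ j * U) (b + t) w ⟧)))
                                                 ≤⟨ ∑-mono-∈ (downFrom (suc ℓ)) per-scale ⟩
          ∑ (downFrom (suc ℓ)) (λ j → c * (6 * D)) ≡⟨ ∑-const (downFrom (suc ℓ)) (c * (6 * D)) ⟩
          length (downFrom (suc ℓ)) * (c * (6 * D)) ≡⟨ cong (_* (c * (6 * D))) (length-downFrom (suc ℓ)) ⟩
          suc ℓ * (c * (6 * D))                  ≡⟨ e₀ (suc ℓ) c (6 * D) ⟩
          c * (suc ℓ * (6 * D))                  ∎
          where
          c : ℕ
          c = ω w * ⟦ within (radius (suc i)) w ⟧
          e₀ : ∀ a b c → a * (b * c) ≡ b * (a * c)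
          e₀ = solve-∀
          e₁ : ∀ c x s → c * (2 * x * s) ≡ c * (2 * x) * s
          e₁ = solve-∀
          e₂ : ∀ c x z U → c * (2 * x) * (3 * (z * U)) ≡ c * (6 * (x * z * U))
          e₂ = solve-∀
          per-scale : ∀ {j} → j ∈ₗ downFrom (suc ℓ) →
            ∑ (downFrom ρ) (λ t → c * (2 * 2 ^ (ℓ ∸ j) * ⟦ near (2 ^ j * U) (b + t) w ⟧)) ≤ c * (6 * D)
          per-scale {j} j∈ = begin
            ∑ (downFrom ρ) (λ t → c * (2 * 2 ^ (ℓ ∸ j) * ⟦ near (2 ^ j * U) (b + t) w ⟧)) ≡⟨ ∑-cong (downFrom ρ) (λ t → e₁ c (2 ^ (ℓ ∸ j)) _) ⟩
            ∑ (downFrom ρ) (λ t → c * (2 * 2 ^ (ℓ ∸ j)) * ⟦ near (2 ^ j * U) (b + t) w ⟧) ≡⟨ ∑-*ˡ (downFrom ρ) (c * (2 * 2 ^ (ℓ ∸ j))) _ ⟩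
            c * (2 * 2 ^ (ℓ ∸ j)) * ∑ (downFrom ρ) (λ t → ⟦ near (2 ^ j * U) (b + t) w ⟧) ≤⟨ *-monoʳ-≤ (c * (2 * 2 ^ (ℓ ∸ j)))
                                                              (near-count (2 ^ j * U) b w (*-pos (^-pos j (s≤s z≤n)) U>0) ρ) ⟩
            c * (2 * 2 ^ (ℓ ∸ j)) * (3 * (2 ^ j * U))  ≡⟨ e₂ c (2 ^ (ℓ ∸ j)) (2 ^ j) U ⟩
            c * (6 * (2 ^ (ℓ ∸ j) * 2 ^ j * U))        ≡⟨ cong (λ x → c * (6 * (x * U)))
                                                             (trans (sym (^-distribˡ-+-* 2 (ℓ ∸ j) j)) (cong (2 ^_) (m∸n+n≡m (≤-pred (∈-downFrom⇒< j∈))))) ⟩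
            c * (6 * D)                                ∎

      scale : ∀ x → U ≤ x → x ≤ D → ∃ λ j → j ≤ ℓ × x ≤ 2 ^ j * U × 2 ^ j * U ≤ 2 * x
      scale x U≤x x≤D with least (λ j → x ≤?ⁿ 2 ^ j * U) ℓ x≤D
      ... | zero  , le , min = 0 , z≤n , le , ≤-trans (≤-reflexive (+-identityʳ U)) (≤-trans U≤x (m≤m+n x (x + 0)))
      ... | suc j , le , min = suc j , min ℓ x≤D , le ,
            ≤-trans (≤-reflexive (*-assoc 2 (2 ^ j) U)) (*-monoʳ-≤ 2 (<⇒≤ (≰⇒> λ le′ → 1+n≰n (min j le′))))

      -- At the scale with load v ≤ 2^j U ≤ 2 load v, the centers of all members through `v` are
      -- near `r`; their joint contribution 2·2^(ℓ-j) load v is at least 2^ℓ U.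
      boundary-heavy : ∀ i r v → r ≤ radius i + ρ → Boundary r v → D ≤ ∑ (allFin n) (λ w → y i r w * ⟦ hit v w ⟧)
      boundary-heavy i r v r≤ (v-in , r<φ , v′ , e , φ′≤r) = begin
        2 ^ ℓ * U                                  ≡⟨ cong (_* U) (trans (cong (2 ^_) (sym (m∸n+n≡m j≤ℓ))) (^-distribˡ-+-* 2 (ℓ ∸ j) j)) ⟩
        2 ^ (ℓ ∸ j) * 2 ^ j * U                    ≡⟨ *-assoc (2 ^ (ℓ ∸ j)) (2 ^ j) U ⟩
        2 ^ (ℓ ∸ j) * (2 ^ j * U)                  ≤⟨ *-monoʳ-≤ (2 ^ (ℓ ∸ j)) scale≤ ⟩
        2 ^ (ℓ ∸ j) * (2 * load v)                 ≡⟨ e₁ (2 ^ (ℓ ∸ j)) (load v) ⟩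
        load v * (2 * 2 ^ (ℓ ∸ j))                 ≡⟨ sym (∑-*ʳ (allFin n) (2 * 2 ^ (ℓ ∸ j)) _) ⟩
        ∑ (allFin n) (λ w → ω w * ⟦ hit v w ⟧ * (2 * 2 ^ (ℓ ∸ j))) ≤⟨ ∑-mono (allFin n) pointwise ⟩
        ∑ (allFin n) (λ w → y i r w * ⟦ hit v w ⟧) ∎
        where
        open ≤-Reasoning
        e₁ : ∀ a x → a * (2 * x) ≡ x * (2 * a)
        e₁ = solve-∀
        load≤ρ : load v ≤ ρ
        load≤ρ = light v v-in
        scaled : ∃ λ j → j ≤ ℓ × load v ≤ 2 ^ j * U × 2 ^ j * U ≤ 2 * load v
        scaled = scale (load v) (≤-trans (U≤ω _) (weight-∈ ω (proj₂ (inside-hit v-in)))) (≤-trans load≤ρ ρ≤)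
        j = proj₁ scaled
        j≤ℓ = proj₁ (proj₂ scaled)
        load≤ = proj₁ (proj₂ (proj₂ scaled))
        scale≤ = proj₂ (proj₂ (proj₂ scaled))
        φ≤ : φ v ≤ r + load v
        φ≤ = ≤-trans (φ-edge e v-in) (+-monoˡ-≤ (load v) φ′≤r)
        e₂ : ∀ i ρ → suc (2 * i) * ρ + ρ + ρ ≡ suc (2 * suc i) * ρ
        e₂ = solve-∀
        inner : ∀ w → hit v w ≡ true → within (radius (suc i)) w ≡ true
        inner w h = ∧-true (inside-⊆ v-in w h) (⌊⌋-true (φ w ≤?ⁿ radius (suc i))
          (≤-trans (φ-up h) (≤-trans φ≤ (≤-trans (+-mono-≤ r≤ load≤ρ) (≤-reflexive (e₂ i ρ))))))
        close : ∀ w → hit v w ≡ true → near (2 ^ j * U) r w ≡ true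
        close w h = ∧-true
          (⌊⌋-true (r ≤?ⁿ φ w + 2 ^ j * U) (≤-trans (<⇒≤ r<φ) (≤-trans (φ-down h v-in) (+-monoʳ-≤ (φ w) load≤))))
          (⌊⌋-true (φ w ≤?ⁿ r + 2 ^ j * U) (≤-trans (φ-up h) (≤-trans φ≤ (+-monoʳ-≤ r load≤))))
        pointwise : ∀ w → ω w * ⟦ hit v w ⟧ * (2 * 2 ^ (ℓ ∸ j)) ≤ y i r w * ⟦ hit v w ⟧
        pointwise w with hit v w in h
        ... | false = ≤-trans (≤-reflexive (trans (cong (_* (2 * 2 ^ (ℓ ∸ j))) (*-zeroʳ (ω w))) refl)) z≤n
        ... | true = ≤-trans (≤-reflexive eq) (≤-trans
                (∑-∈ (downFrom (suc ℓ)) (λ j → ω w * ⟦ within (radius (suc i)) w ⟧ * (2 * 2 ^ (ℓ ∸ j) * ⟦ near (2 ^ j * U) r w ⟧)) (<⇒∈-downFrom (s≤s j≤ℓ)))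
                (≤-reflexive (sym (*-identityʳ _))))
          where
          eq : ω w * 1 * (2 * 2 ^ (ℓ ∸ j)) ≡ ω w * ⟦ within (radius (suc i)) w ⟧ * (2 * 2 ^ (ℓ ∸ j) * ⟦ near (2 ^ j * U) r w ⟧)
          eq rewrite inner w h | close w h = cong (ω w * 1 *_) (sym (*-identityʳ _))

      average-radius : ∀ i → vol (radius (suc i)) ≤ 2 * vol (radius i) →
        ∃ λ t → t < ρ × ρ * ∑ (allFin n) (y i (radius i + t)) ≤ 12 * suc ℓ * D * vol (radius i)
      average-radius i thin = case ∑-pigeonhole-≤ (downFrom ρ) (λ t → ρ * ∑ (allFin n) (y i (radius i + t))) (λ _ → C)
                                 (≤-trans ρ>0 (≤-reflexive (sym (length-downFrom ρ)))) average of
          λ (t , t∈ , cheap) → t , ∈-downFrom⇒< t∈ , cheap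
        where
        open ≤-Reasoning
        C : ℕ
        C = 12 * suc ℓ * D * vol (radius i)
        e₁ : ∀ ρ ℓ D v → ρ * (suc ℓ * (6 * D) * (2 * v)) ≡ ρ * (12 * suc ℓ * D * v)
        e₁ = solve-∀
        average : ∑ (downFrom ρ) (λ t → ρ * ∑ (allFin n) (y i (radius i + t))) ≤ ∑ (downFrom ρ) (λ _ → C)
        average = begin
          ∑ (downFrom ρ) (λ t → ρ * ∑ (allFin n) (y i (radius i + t)))   ≡⟨ ∑-*ˡ (downFrom ρ) ρ _ ⟩
          ρ * ∑ (downFrom ρ) (λ t → ∑ (allFin n) (y i (radius i + t)))   ≤⟨ *-monoʳ-≤ ρ (total-y i (radius i)) ⟩
          ρ * (suc ℓ * (6 * D) * vol (radius (suc i)))                   ≤⟨ *-monoʳ-≤ ρ (*-monoʳ-≤ (suc ℓ * (6 * D)) thin) ⟩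
          ρ * (suc ℓ * (6 * D) * (2 * vol (radius i)))                   ≡⟨ e₁ ρ ℓ D (vol (radius i)) ⟩
          ρ * C                                                          ≡⟨ cong (_* C) (sym (length-downFrom ρ)) ⟩
          length (downFrom ρ) * C                                        ≡⟨ sym (∑-const (downFrom ρ) C) ⟩
          ∑ (downFrom ρ) (λ _ → C)                                       ∎

      Cut : ℕ → ℕ → Set
      Cut i r = Σ (Fin n → Bool) λ Z →
        # Z * ρ ≤ κ * vol (radius i) × (∀ v → Boundary r v → ∃ λ w → Z w ≡ true × hit v w ≡ true)

      -- A boundary vertex forces the sum of `y` to be at least `D`, so rounding its quotient by `D`
      -- up to `suc q′` costs only a factor 2. Hence the separate treatment of an empty boundary.
      cut-at : ∀ i r → r ≤ radius i + ρ → ρ * ∑ (allFin n) (y i r) ≤ 12 * suc ℓ * D * vol (radius i) →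
               ∃ (Boundary r) → Cut i r
      cut-at i r r≤ cheap (v₀ , bd₀) = proj₁ chosen , few ,
          λ v bd → proj₂ (proj₂ chosen) v (⌊⌋-true (boundary? r v) bd)
        where
        open ≤-Reasoning
        Ytot = ∑ (allFin n) (y i r)
        division = quotient Ytot D D>0
        q′ = proj₁ division
        D≤Ytot : D ≤ Ytot
        D≤Ytot = ≤-trans (boundary-heavy i r v₀ r≤ bd₀)
          (∑-mono (allFin n) λ w → ≤-trans (*-monoʳ-≤ (y i r w) (⟦⟧≤1 (hit v₀ w))) (≤-reflexive (*-identityʳ _)))
        chosen = HittingSet.hitting-set hit (y i r) D q′ D>0 (proj₁ (proj₂ division)) ℓ ℓ≥1 n<2^ℓ
          (λ v → ⌊ boundary? r v ⌋) (λ v e → boundary-heavy i r v r≤ (⌊⌋-true⁻ {P? = boundary? r v} e))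
        count : suc q′ * ρ ≤ 24 * suc ℓ * vol (radius i)
        count = *-cancelˡ-≤ D {{Data.Nat.>-nonZero D>0}} (begin
          D * (suc q′ * ρ)             ≡⟨ e₃ D q′ ρ ⟩
          (D + q′ * D) * ρ             ≤⟨ *-monoˡ-≤ ρ (+-mono-≤ D≤Ytot (proj₂ (proj₂ division))) ⟩
          (Ytot + Ytot) * ρ            ≡⟨ e₄ Ytot ρ ⟩
          2 * (ρ * Ytot)               ≤⟨ *-monoʳ-≤ 2 cheap ⟩
          2 * (12 * suc ℓ * D * vol (radius i)) ≡⟨ e₅ ℓ D (vol (radius i)) ⟩
          D * (24 * suc ℓ * vol (radius i)) ∎)
          where
          e₃ : ∀ D q ρ → D * (suc q * ρ) ≡ (D + q * D) * ρ
          e₃ = solve-∀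
          e₄ : ∀ y ρ → (y + y) * ρ ≡ 2 * (ρ * y)
          e₄ = solve-∀
          e₅ : ∀ ℓ D v → 2 * (12 * suc ℓ * D * v) ≡ D * (24 * suc ℓ * v)
          e₅ = solve-∀
        few : # (proj₁ chosen) * ρ ≤ κ * vol (radius i)
        few = begin
          # (proj₁ chosen) * ρ                 ≤⟨ *-monoˡ-≤ ρ (proj₁ (proj₂ chosen)) ⟩
          suc q′ * ℓ * ρ                       ≡⟨ trans (cong (_* ρ) (*-comm (suc q′) ℓ)) (*-assoc ℓ (suc q′) ρ) ⟩
          ℓ * (suc q′ * ρ)                     ≤⟨ *-monoʳ-≤ ℓ count ⟩
          ℓ * (24 * suc ℓ * vol (radius i))    ≡⟨ sym (*-assoc ℓ (24 * suc ℓ) _) ⟩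
          κ * vol (radius i)                   ∎

      no-boundary : ∀ i r → ¬ ∃ (Boundary r) → Cut i r
      no-boundary i r ¬bd = (λ _ → false) , ≤-trans (≤-reflexive (cong (_* ρ) (∑-zero (allFin n)))) z≤n ,
        λ v bd → ⊥-elim (¬bd (v , bd))

      cut-near : ∀ i r → r ≤ radius i + ρ → ρ * ∑ (allFin n) (y i r) ≤ 12 * suc ℓ * D * vol (radius i) → Cut i r
      cut-near i r r≤ cheap = from-dec (any? (boundary? r))
        where
        from-dec : Dec (∃ (Boundary r)) → Cut i r
        from-dec (yes bd) = cut-at i r r≤ cheap bd
        from-dec (no ¬bd) = no-boundary i r ¬bd

      record SmallCut : Set where
        constructor small-cut
        field
          r      : ℕ
          r≤     : r ≤ radius (suc ℓ)
          r≥     : radius 0 ≤ r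
          Z      : Fin n → Bool
          few    : # Z * ρ ≤ κ * vol r
          hits   : ∀ v → Boundary r v → ∃ λ w → Z w ≡ true × hit v w ≡ true

      cut-in : ∀ i → i ≤ ℓ → ∀ t → t < ρ → Cut i (radius i + t) → SmallCut
      cut-in i i≤ℓ t t<ρ (Z , few , hits) = small-cut (radius i + t) (radius-upper i≤ℓ t<ρ) (radius-lower i t) Z
        (≤-trans few (*-monoʳ-≤ κ (vol-mono (m≤m+n (radius i) t)))) hits

      cut-from-radius : ∀ i → i ≤ ℓ →
        (∃ λ t → t < ρ × ρ * ∑ (allFin n) (y i (radius i + t)) ≤ 12 * suc ℓ * D * vol (radius i)) → SmallCut
      cut-from-radius i i≤ℓ (t , t<ρ , cheap) =
        cut-in i i≤ℓ t t<ρ (cut-near i (radius i + t) (+-monoʳ-≤ (radius i) (<⇒≤ t<ρ)) cheap)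

      cut-from-annulus : (∃ λ i → i ≤ ℓ × vol (radius (suc i)) ≤ 2 * vol (radius i)) → SmallCut
      cut-from-annulus (i , i≤ℓ , thin) = cut-from-radius i i≤ℓ (average-radius i thin)

      opaque
        cut : SmallCut
        cut = cut-from-annulus thin-annulus

    -- Peeling off balls until no live center is left

    bound : ℕ
    bound = suc q * (ℓ + κ)

    -- Invariant of the peeling: `Y` is the separator so far and `alive` the centers neither removed
    -- nor in a ball already cut off. `closed` makes the live part a union of components after the
    -- deletion of `Y`, and in `budget` the volume of each ball pays for its cut at the rate κ/ρ.
    record State (alive Y : Fin n → Bool) : Set where
      field
        alive⊆ : alive ⊆ᵇ center
        fresh  : ∀ w → alive w ≡ true → Y w ≡ false
        closed : ∀ v′ v → (v′ ~ v) ≡ true → inside hit alive v′ ≡ true → inside hit (center ∖ Y) v ≡ true → inside hit alive v ≡ true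
        dead   : ∀ x₀ → center x₀ ≡ true → Y x₀ ≡ false → alive x₀ ≡ false → Balanced g X Y x₀
        light  : ∀ v → inside hit alive v ≡ true → load v ≤ ρ
        budget : # Y * ρ + κ * weight ω alive ≤ bound * ρ

    module Shrink {alive Y : Fin n → Bool} (state : State alive Y) (u : Fin n) (u-alive : alive u ≡ true) where

      open State state
      open Ball alive alive⊆ light u u-alive
      open SmallCut cut

      K : Fin n → Bool
      K v = inside hit alive v ∧ ⌊ φ v ≤?ⁿ r ⌋

      K-near : ∀ v → K v ≡ true → Near ω (radius (suc ℓ)) u v
      K-near v e = near-of (φ-reach v (s≤s (≤-trans φv≤r r≤)))
        where
        φv≤r : φ v ≤ r
        φv≤r = ⌊⌋-true⁻ {P? = φ v ≤?ⁿ r} (∧-trueʳ {inside hit alive v} e)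
        near-of : Reach v (φ v) → Near ω (radius (suc ℓ)) u v
        near-of (S , _ , le , conn) = lookup S , ≤-trans le (≤-trans φv≤r r≤) , conn

      alive′ Y′ : Fin n → Bool
      alive′ = alive ∖ (within r ∪ᵇ Z)
      Y′ = Y ∪ᵇ Z

      Y′-false : ∀ {w} → (center ∖ Y′) w ≡ true → Y w ≡ false × Z w ≡ false
      Y′-false {w} e with Y w | Z w | not-true⁻ (∧-trueʳ {center w} e)
      ... | false | false | _ = refl , refl

      shrink⊆ : (center ∖ Y′) ⊆ᵇ (center ∖ Y)
      shrink⊆ w e = ∧-true (∧-trueˡ e) (not-true (proj₁ (Y′-false e)))

      -- Leaving `K` by an edge would lead from within `r` to a vertex beyond `r`, thus to a
      -- boundary vertex, and `Z` meets a member through each of those.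
      K-step : ∀ a b → (a ~ b) ≡ true → inside hit (center ∖ Y′) b ≡ true → K a ≡ true → K b ≡ true
      K-step a b e b-in Ka = ∧-true b-alive (⌊⌋-true (φ b ≤?ⁿ r) (≮⇒≥ outside))
        where
        b-alive : inside hit alive b ≡ true
        b-alive = closed a b e (∧-trueˡ Ka) (inside-mono shrink⊆ b b-in)
        outside : ¬ r < φ b
        outside lt = let w , Zw , h = hits b (b-alive , lt , a , e , ⌊⌋-true⁻ {P? = φ a ≤?ⁿ r} (∧-trueʳ {inside hit alive a} Ka))
                     in true≢false Zw (proj₂ (Y′-false (inside-⊆ b-in w h)))

      K-walk : ∀ {m a b} → Walk (inside hit (center ∖ Y′)) m a b → K a ≡ true → K b ≡ true
      K-walk (stop _)   Ka = Ka
      K-walk (go _ e w) Ka = K-walk w (K-step _ _ e (walk-start w) Ka)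

      K-center : ∀ w → within r w ≡ true → K w ≡ true
      K-center w e = ∧-true (inside-intro (alive⊆ w (∧-trueˡ e)) λ w′ h →
          subst (λ x → alive x ≡ true) (sym (hit-center w w w′ (alive⊆ w (∧-trueˡ e)) h)) (∧-trueˡ e))
        (∧-trueʳ {alive w} e)

      alive′-elim : ∀ {w} → alive′ w ≡ true → alive w ≡ true × within r w ≡ false × Z w ≡ false
      alive′-elim {w} e with alive w | within r w | Z w
      ... | true | false | false = refl , refl , refl

      alive′-intro : ∀ {w} → alive w ≡ true → within r w ≡ false → Z w ≡ false → alive′ w ≡ true
      alive′-intro {w} p e₁ e₂ = ∧-true p (not-true (trans (cong (_∨ Z w) e₁) e₂))

      alive′⊆ : alive′ ⊆ᵇ alive
      alive′⊆ _ = ∧-trueˡ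

      next : ¬ g * # X < g * # (λ x → X x ∧ K x) + # X → State alive′ Y′
      next ¬clustered = record
        { alive⊆ = λ w e → alive⊆ w (alive′⊆ w e)
        ; fresh  = λ w e → trans (cong (_∨ Z w) (fresh w (alive′⊆ w e))) (proj₂ (proj₂ (alive′-elim e)))
        ; closed = closed′
        ; dead   = dead′
        ; light  = λ v e → light v (inside-mono alive′⊆ v e)
        ; budget = budget′
        }
        where
        remaining : ∀ v → inside hit alive′ v ≡ true → inside hit (center ∖ Y′) v ≡ true
        remaining v = inside-mono (λ w e → ∧-true (alive⊆ w (alive′⊆ w e))
          (not-true (trans (cong (_∨ Z w) (fresh w (alive′⊆ w e))) (proj₂ (proj₂ (alive′-elim e)))))) v

        closed′ : ∀ v′ v → (v′ ~ v) ≡ true → inside hit alive′ v′ ≡ true → inside hit (center ∖ Y′) v ≡ true → inside hit alive′ v ≡ true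
        closed′ v′ v e v′-in v-in = inside-intro (proj₂ (inside-hit v-in)) λ w h →
          -- A center `w` of `v` inside the ball would put `w`, then `v`, then `v′` into `K`; but no
          -- center of `v′` is in the ball, and by `φ-up` this keeps `v′` out of `K`.
          alive′-intro (inside-⊆ v-alive w h) (≢true⇒false (λ b → not-K v′ v′-in (K-step v v′ (trans (~-sym v v′) e) (remaining v′ v′-in)
              (K-walk (proj₂ (conn-sym (up-conn h (inside-⊆ v-in)))) (K-center w b)))))
            (proj₂ (Y′-false (inside-⊆ v-in w h)))
          where
          v-alive : inside hit alive v ≡ true
          v-alive = closed v′ v e (inside-mono alive′⊆ v′ v′-in) (inside-mono shrink⊆ v v-in)
          not-K : ∀ p → inside hit alive′ p ≡ true → K p ≡ true → ⊥
          not-K p p-in Kp = let w , h = inside-hit p-in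
                                w-alive , w-out , _ = alive′-elim (inside-⊆ p-in w h)
                            in true≢false (∧-true w-alive (⌊⌋-true (φ w ≤?ⁿ r)
                                 (≤-trans (φ-up h) (⌊⌋-true⁻ {P? = φ p ≤?ⁿ r} (∧-trueʳ {inside hit alive p} Kp))))) w-out

        dead′ : ∀ x₀ → center x₀ ≡ true → Y′ x₀ ≡ false → alive′ x₀ ≡ false → Balanced g X Y′ x₀
        dead′ x₀ c Y′x₀ dead-x₀ = [ was-alive , was-dead ]′ (true⊎false (alive x₀))
          where
          Yx₀ : Y x₀ ≡ false × Z x₀ ≡ false
          Yx₀ = Y′-false (∧-true c (not-true Y′x₀))
          was-dead : alive x₀ ≡ false → Balanced g X Y′ x₀
          was-dead e = ≤-trans (+-monoˡ-≤ (# X) (*-monoʳ-≤ g (#-mono {P = reachable X Y′ x₀} {reachable X Y x₀} λ x h →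
            ∧-true (∧-trueˡ {X x} h) (⌊⌋-true (conn? (inside hit (center ∖ Y)) x₀ x)
              (conn-mono (inside-mono shrink⊆) (⌊⌋-true⁻ {P? = conn? (inside hit (center ∖ Y′)) x₀ x} (∧-trueʳ {X x} h)))))))
            (dead x₀ c (proj₁ Yx₀) e)
          was-alive : alive x₀ ≡ true → Balanced g X Y′ x₀
          was-alive e = ≤-trans (+-monoˡ-≤ (# X) (*-monoʳ-≤ g (#-mono {P = reachable X Y′ x₀} {λ x → X x ∧ K x} λ x h →
            ∧-true (∧-trueˡ {X x} h) (K-walk (proj₂ (⌊⌋-true⁻ {P? = conn? (inside hit (center ∖ Y′)) x₀ x} (∧-trueʳ {X x} h)))
              (K-center x₀ in-ball)))))
            (≮⇒≥ ¬clustered)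
            where
            in-ball : within r x₀ ≡ true
            in-ball = ≢false⇒true λ eq → true≢false (alive′-intro e eq (proj₂ Yx₀)) dead-x₀

        split : weight ω alive′ + vol r ≤ weight ω alive
        split = ≤-trans (≤-reflexive (sym (∑-+ (allFin n) _ _))) (∑-mono (allFin n) λ w →
          ≤-trans (≤-reflexive (sym (*-distribˡ-+ (ω w) ⟦ alive′ w ⟧ ⟦ within r w ⟧))) (*-monoʳ-≤ (ω w) (disjoint (alive w) ⌊ φ w ≤?ⁿ r ⌋ (Z w))))
          where
          disjoint : ∀ a b z → ⟦ a ∧ not (a ∧ b ∨ z) ⟧ + ⟦ a ∧ b ⟧ ≤ ⟦ a ⟧
          disjoint false b     z     = z≤n
          disjoint true  true  z     = ≤-refl
          disjoint true  false true  = z≤n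
          disjoint true  false false = ≤-refl

        budget′ : # Y′ * ρ + κ * weight ω alive′ ≤ bound * ρ
        budget′ = begin
          # Y′ * ρ + κ * weight ω alive′               ≤⟨ +-monoˡ-≤ (κ * weight ω alive′) (*-monoˡ-≤ ρ (#-∪ Y Z)) ⟩
          (# Y + # Z) * ρ + κ * weight ω alive′        ≡⟨ e₁ (# Y) (# Z) ρ (κ * weight ω alive′) ⟩
          # Y * ρ + (κ * weight ω alive′ + # Z * ρ)    ≤⟨ +-monoʳ-≤ (# Y * ρ) (+-monoʳ-≤ (κ * weight ω alive′) few) ⟩
          # Y * ρ + (κ * weight ω alive′ + κ * vol r)  ≡⟨ cong (# Y * ρ +_) (sym (*-distribˡ-+ κ (weight ω alive′) (vol r))) ⟩
          # Y * ρ + κ * (weight ω alive′ + vol r)      ≤⟨ +-monoʳ-≤ (# Y * ρ) (*-monoʳ-≤ κ split) ⟩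
          # Y * ρ + κ * weight ω alive                 ≤⟨ budget ⟩
          bound * ρ                                    ∎
          where
          open ≤-Reasoning
          e₁ : ∀ a b c d → (a + b) * c + d ≡ a * c + (d + b * c)
          e₁ = solve-∀

      shrinks : # alive′ < # alive
      shrinks = #-strict u alive′⊆ (≢true⇒false λ e → true≢false u-within (proj₁ (proj₂ (alive′-elim e)))) u-alive
        where
        u-within : within r u ≡ true
        u-within = ∧-true u-alive (⌊⌋-true (φ u ≤?ⁿ r) (≤-trans φ-root (≤-trans (m≤m+n ρ 0) r≥)))

    loop : ∀ fuel {alive Y} → State alive Y → # alive ≤ fuel → Separated ⊎ Clustered
    loop fuel {alive} {Y} state le = by-cases (any? λ w → alive w ≟ᵇ true)
      where
      open State state
      continue : ∀ fuel → # alive ≤ fuel → ∀ u (u-alive : alive u ≡ true) → Dec (g * # X < g * # (λ x → X x ∧ Shrink.K state u u-alive x) + # X) → Separated ⊎ Clustered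
      continue fuel le u u-alive (yes clustered) = inj₂ (u , Shrink.K state u u-alive , Shrink.K-near state u u-alive , clustered)
      continue zero le u u-alive (no _) = ⊥-elim (<⇒≱ (#-pos {P = alive} u-alive) le)
      continue (suc fuel) le u u-alive (no ¬clustered) =
        loop fuel (Shrink.next state u u-alive ¬clustered) (≤-pred (≤-trans (Shrink.shrinks state u u-alive) le))
      by-cases : Dec (∃ λ w → alive w ≡ true) → Separated ⊎ Clustered
      by-cases (yes (u , u-alive)) = continue fuel le u u-alive (_ <?ⁿ _)
      by-cases (no none) = inj₁ (Y , *-cancelʳ-≤ (# Y) bound ρ {{Data.Nat.>-nonZero ρ>0}} (≤-trans (m≤m+n _ _) budget) ,
        λ x₀ c Yx₀ → dead x₀ c Yx₀ (≢true⇒false λ e → none (x₀ , e)))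

    -- For vertices of load at least ρ the weights themselves, at scale ρ, form a fractional hitting
    -- set. This is the summand ℓ in `bound`, and it makes every surviving vertex light.
    heavy-hit : ∃ λ Y → # Y ≤ suc q * ℓ × HittingSet.Hits hit (λ w → ω w * ⟦ center w ⟧) ρ q ρ>0 total≤ Y (λ v → ⌊ ρ ≤?ⁿ load v ⌋)
    heavy-hit = HittingSet.hitting-set hit (λ w → ω w * ⟦ center w ⟧) ρ q ρ>0 total≤ ℓ ℓ≥1 n<2^ℓ (λ v → ⌊ ρ ≤?ⁿ load v ⌋)
      λ v e → ≤-trans (⌊⌋-true⁻ {P? = ρ ≤?ⁿ load v} e) (∑-mono (allFin n) (pointwise v))
      where
      pointwise : ∀ v w → ω w * ⟦ hit v w ⟧ ≤ ω w * ⟦ center w ⟧ * ⟦ hit v w ⟧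
      pointwise v w with hit v w in h
      ... | false = ≤-trans (≤-reflexive (*-zeroʳ (ω w))) z≤n
      ... | true rewrite hit⇒center h = ≤-reflexive (sym (*-identityʳ (ω w * 1)))

    initial : State (center ∖ proj₁ heavy-hit) (proj₁ heavy-hit)
    initial = record
      { alive⊆ = λ w → ∧-trueˡ
      ; fresh  = λ w e → not-true⁻ (∧-trueʳ {center w} e)
      ; closed = λ _ _ _ _ e → e
      ; dead   = λ x₀ c e d → ⊥-elim (true≢false (∧-true c (not-true e)) d)
      ; light  = light₀
      ; budget = begin
          # Y₀ * ρ + κ * weight ω (center ∖ Y₀)    ≤⟨ +-mono-≤ (*-monoˡ-≤ ρ (proj₁ (proj₂ heavy-hit)))
                                                       (*-monoʳ-≤ κ (≤-trans (weight-mono ω λ _ → ∧-trueˡ) total≤)) ⟩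
          suc q * ℓ * ρ + κ * (suc q * ρ)          ≡⟨ e₁ (suc q) ℓ κ ρ ⟩
          bound * ρ                                ∎
      }
      where
      open ≤-Reasoning
      Y₀ = proj₁ heavy-hit
      e₁ : ∀ q ℓ κ ρ → q * ℓ * ρ + κ * (q * ρ) ≡ q * (ℓ + κ) * ρ
      e₁ = solve-∀
      light₀ : ∀ v → inside hit (center ∖ Y₀) v ≡ true → load v ≤ ρ
      light₀ v v-in = <⇒≤ (≰⇒> λ heavy → let w , Yw , h = proj₂ (proj₂ heavy-hit) v (⌊⌋-true (ρ ≤?ⁿ load v) heavy)
                                          in true≢false Yw (not-true⁻ (∧-trueʳ {center w} (inside-⊆ v-in w h))))

    opaque
      separate-or-cluster : Separated ⊎ Clustered
      separate-or-cluster = loop _ initial ≤-refl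

-- Multiplicative weights

∑-filterᵇ : {A : Set} (P : A → Bool) (l : List A) (f : A → ℕ) → ∑ (filterᵇ P l) f ≡ ∑ l (λ a → ⟦ P a ⟧ * f a)
∑-filterᵇ P []      f = refl
∑-filterᵇ P (a ∷ l) f with P a
... | true  = cong₂ _+_ (sym (+-identityʳ (f a))) (∑-filterᵇ P l f)
... | false = ∑-filterᵇ P l f

module Routings {n : ℕ} (_~_ : Fin n → Fin n → Bool) (~-sym : ∀ u v → (u ~ v) ≡ (v ~ u))
                (hit : Fin n → Fin n → Bool) {k : ℕ} (axioms : SetSystem.Axioms _~_ ~-sym hit k)
                (X : Fin n → Bool) where

  open SetSystem _~_ ~-sym hit public
  open Axioms axioms public

  elements : List (Fin n)
  elements = filterᵇ X (allFin n)

  pairs : ℕ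
  pairs = length elements * length elements

  #≡elements : ∀ (K : Fin n → Bool) → # (λ x → X x ∧ K x) ≡ ∑ elements (λ x → ⟦ K x ⟧)
  #≡elements K = sym (trans (∑-filterᵇ X (allFin n) (λ x → ⟦ K x ⟧)) (∑-cong (allFin n) λ x → product (X x) (K x)))
    where
    product : ∀ a b → ⟦ a ⟧ * ⟦ b ⟧ ≡ ⟦ a ∧ b ⟧
    product true  b = *-identityˡ ⟦ b ⟧
    product false b = refl

  #X≡length : # X ≡ length elements
  #X≡length = trans (∑-cong (allFin n) (λ x → cong ⟦_⟧ (sym (∧-identityʳ (X x)))))
    (trans (#≡elements (λ _ → true)) (trans (∑-const elements 1) (*-identityʳ _)))

  record Routing : Set where
    field
      through : Fin n → Fin n → Fin n → Bool
      fail    : Fin n → Fin n → Bool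
      route   : ∀ x y → fail x y ≡ false → Conn (inside hit (through x y)) x y

  open Routing public

  congestion : Routing → Fin n → ℕ
  congestion R w = ∑ elements (λ x → ∑ elements (λ y → ⟦ through R x y w ⟧))

  failures : Routing → ℕ
  failures R = ∑ elements (λ x → ∑ elements (λ y → ⟦ fail R x y ⟧))

  congestion≤ : ∀ R w → congestion R w ≤ pairs
  congestion≤ R w = ≤-trans (∑-mono elements λ x → ≤-trans (∑-mono elements λ y → ⟦⟧≤1 (through R x y w))
      (≤-reflexive (trans (∑-const elements 1) (*-identityʳ _))))
    (≤-reflexive (∑-const elements (length elements)))

  Cheap : ℕ → (Fin n → ℕ) → Routing → Set
  Cheap σ ω R = ∀ x y → σ * weight ω (through R x y) ≤ weight ω center

  -- Updating ω w to ω w * (pairs + congestion R w) is the multiplicative-weights step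
  -- ω w * (1 + congestion / pairs) with the denominator cleared.
  reweigh : (Fin n → ℕ) → Routing → Fin n → ℕ
  reweigh ω R w = ω w * (pairs + congestion R w)

  -- Transcript of a play: each routing is cheap with respect to the weights that the earlier ones
  -- have produced.
  data Rounds (σ g : ℕ) : ℕ → (Fin n → ℕ) → Set where
    done  : ∀ {ω} → Rounds σ g 0 ω
    round : ∀ {m ω} (R : Routing) → Cheap σ ω R → g * failures R ≤ 2 * pairs →
            Rounds σ g m (reweigh ω R) → Rounds σ g (suc m) ω

  routings : ∀ {σ g m ω} → Rounds σ g m ω → List Routing
  routings done            = []
  routings (round R _ _ r) = R ∷ routings r

  length-routings : ∀ {σ g m ω} (r : Rounds σ g m ω) → length (routings r) ≡ m
  length-routings done            = refl
  length-routings (round _ _ _ r) = cong suc (length-routings r)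

  failures-routings : ∀ {σ g m ω} (r : Rounds σ g m ω) → g * ∑ (routings r) failures ≤ m * (2 * pairs)
  failures-routings {g = g} done = ≤-reflexive (*-zeroʳ g)
  failures-routings {g = g} (round R _ f r) =
    ≤-trans (≤-reflexive (*-distribˡ-+ g (failures R) _)) (+-mono-≤ f (failures-routings r))

  average-weight : ∀ {σ ω} R → Cheap σ ω R → σ * ∑ (allFin n) (λ w → ω w * congestion R w) ≤ pairs * weight ω center
  average-weight {σ} {ω} R cheap = begin
    σ * ∑ (allFin n) (λ w → ω w * congestion R w)            ≡⟨ cong (σ *_) exchange ⟩
    σ * ∑ elements (λ x → ∑ elements (λ y → weight ω (through R x y))) ≡⟨ sym (trans (∑-cong elements λ x → ∑-*ˡ elements σ _) (∑-*ˡ elements σ _)) ⟩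
    ∑ elements (λ x → ∑ elements (λ y → σ * weight ω (through R x y))) ≤⟨ ∑-mono elements (λ x → ∑-mono elements (cheap x)) ⟩
    ∑ elements (λ x → ∑ elements (λ y → weight ω center))    ≡⟨ trans (∑-cong elements λ x → ∑-const elements _) (∑-const elements _) ⟩
    length elements * (length elements * weight ω center)    ≡⟨ sym (*-assoc (length elements) _ _) ⟩
    pairs * weight ω center                                  ∎
    where
    open ≤-Reasoning
    exchange : ∑ (allFin n) (λ w → ω w * congestion R w) ≡ ∑ elements (λ x → ∑ elements (λ y → weight ω (through R x y)))
    exchange = trans (∑-cong (allFin n) λ w → trans (sym (∑-*ˡ elements (ω w) _)) (∑-cong elements λ x → sym (∑-*ˡ elements (ω w) _)))
      (trans (∑-swap (allFin n) elements _) (∑-cong elements λ x → ∑-swap (allFin n) elements _))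

  -- Cheapness bounds the average congestion under `ω`, so apart from the common factor `pairs` a
  -- round multiplies the total weight by at most 1 + 1/σ.
  reweigh-total : ∀ {σ ω} R → Cheap σ ω R → weight (reweigh ω R) center * σ ≤ weight ω center * (pairs * suc σ)
  reweigh-total {σ} {ω} R cheap = begin
    weight (reweigh ω R) center * σ                                     ≤⟨ *-monoˡ-≤ σ expand ⟩
    (weight ω center * pairs + ∑ (allFin n) (λ w → ω w * congestion R w)) * σ ≡⟨ e₁ (weight ω center) pairs _ σ ⟩
    weight ω center * pairs * σ + σ * ∑ (allFin n) (λ w → ω w * congestion R w) ≤⟨ +-monoʳ-≤ (weight ω center * pairs * σ) (average-weight {σ} {ω} R cheap) ⟩
    weight ω center * pairs * σ + pairs * weight ω center               ≡⟨ e₂ (weight ω center) pairs σ ⟩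
    weight ω center * (pairs * suc σ)                                   ∎
    where
    open ≤-Reasoning
    e₁ : ∀ a b c σ → (a * b + c) * σ ≡ a * b * σ + σ * c
    e₁ = solve-∀
    e₂ : ∀ a b σ → a * b * σ + b * a ≡ a * (b * suc σ)
    e₂ = solve-∀
    e₃ : ∀ o p c b → o * (p + c) * b ≡ o * b * p + o * c * b
    e₃ = solve-∀
    expand : weight (reweigh ω R) center ≤ weight ω center * pairs + ∑ (allFin n) (λ w → ω w * congestion R w)
    expand = ≤-trans (∑-mono (allFin n) λ w → ≤-trans (≤-reflexive (e₃ (ω w) pairs (congestion R w) ⟦ center w ⟧))
        (+-monoʳ-≤ (ω w * ⟦ center w ⟧ * pairs) (≤-trans (*-monoʳ-≤ (ω w * congestion R w) (⟦⟧≤1 (center w))) (≤-reflexive (*-identityʳ _)))))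
      (≤-reflexive (trans (∑-+ (allFin n) _ _) (cong (_+ ∑ (allFin n) (λ w → ω w * congestion R w)) (∑-*ʳ (allFin n) pairs _))))

  -- The weight of `w` alone is compared with the total. By `exp-lower` a round multiplies the
  -- former by at least pairs · 2^(congestion / 2 pairs), and by `reweigh-total` the latter by at
  -- most pairs · (1 + 1/σ). The exponent `2 * pairs` clears the root.
  congestion-growth : 0 < pairs → ∀ {σ g m ω} (r : Rounds σ g m ω) w → center w ≡ true →
    2 ^ ∑ (routings r) (λ R → congestion R w) * (ω w * σ ^ m) ^ (2 * pairs) ≤ (weight ω center * suc σ ^ m) ^ (2 * pairs)
  congestion-growth pos {σ} {ω = ω} done w c = ≤-trans (≤-reflexive (*-identityˡ _))
    (power-≤ (2 * pairs) (*-monoˡ-≤ 1 (weight-∈ ω c)))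
  congestion-growth pos {σ} {g} {suc m} {ω} (round R cheap _ r) w c =
    *-cancelˡ-≤ (pairs ^ A) {{Data.Nat.>-nonZero (^-pos A pos)}} (begin
      pairs ^ A * (2 ^ (c₁ + c₂) * (ω w * (σ * σ ^ m)) ^ A)      ≡⟨ cong (λ x → pairs ^ A * (x * (ω w * (σ * σ ^ m)) ^ A)) (^-distribˡ-+-* 2 c₁ c₂) ⟩
      pairs ^ A * (2 ^ c₁ * 2 ^ c₂ * (ω w * (σ * σ ^ m)) ^ A)    ≡⟨ e₁ (pairs ^ A) (2 ^ c₁) (2 ^ c₂) _ ⟩
      2 ^ c₁ * pairs ^ A * (2 ^ c₂ * (ω w * (σ * σ ^ m)) ^ A)    ≤⟨ *-monoˡ-≤ _ (exp-lower pairs c₁ pos (congestion≤ R w)) ⟩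
      (pairs + c₁) ^ A * (2 ^ c₂ * (ω w * (σ * σ ^ m)) ^ A)      ≡⟨ e₂ ((pairs + c₁) ^ A) (2 ^ c₂) _ ⟩
      2 ^ c₂ * ((pairs + c₁) ^ A * (ω w * (σ * σ ^ m)) ^ A)      ≡⟨ cong (2 ^ c₂ *_) (trans (sym (*-^ A _ _)) (trans (cong (_^ A) (e₃ (pairs + c₁) (ω w) σ (σ ^ m))) (*-^ A _ _))) ⟩
      2 ^ c₂ * ((reweigh ω R w * σ ^ m) ^ A * σ ^ A)             ≡⟨ sym (*-assoc (2 ^ c₂) _ _) ⟩
      2 ^ c₂ * (reweigh ω R w * σ ^ m) ^ A * σ ^ A               ≤⟨ *-monoˡ-≤ (σ ^ A) (congestion-growth pos r w c) ⟩
      (weight (reweigh ω R) center * suc σ ^ m) ^ A * σ ^ A      ≡⟨ trans (sym (*-^ A _ _)) (cong (_^ A) (e₄ (weight (reweigh ω R) center) (suc σ ^ m) σ)) ⟩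
      (weight (reweigh ω R) center * σ * suc σ ^ m) ^ A          ≤⟨ power-≤ A (*-monoˡ-≤ (suc σ ^ m) (reweigh-total {σ} {ω} R cheap)) ⟩
      (weight ω center * (pairs * suc σ) * suc σ ^ m) ^ A        ≡⟨ trans (cong (_^ A) (e₅ (weight ω center) pairs (suc σ) (suc σ ^ m))) (*-^ A _ _) ⟩
      pairs ^ A * (weight ω center * (suc σ * suc σ ^ m)) ^ A    ∎)
    where
    open ≤-Reasoning
    A = 2 * pairs
    c₁ = congestion R w
    c₂ = ∑ (routings r) (λ R → congestion R w)
    e₁ : ∀ p a b x → p * (a * b * x) ≡ a * p * (b * x)
    e₁ = solve-∀
    e₂ : ∀ p b x → p * (b * x) ≡ b * (p * x)
    e₂ = solve-∀
    e₃ : ∀ p o σ s → p * (o * (σ * s)) ≡ o * p * s * σ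
    e₃ = solve-∀
    e₄ : ∀ w s σ → w * s * σ ≡ w * σ * s
    e₄ = solve-∀
    e₅ : ∀ w p σ s → w * (p * σ) * s ≡ p * (w * (σ * s))
    e₅ = solve-∀

  -- With σ = 2μ the growth over 2μℓ rounds is at most 4^ℓ, and the initial total is at most 2^ℓ;
  -- the 6 is twice the exponent of 2·4 = 2^3. In proportion, a member meets at most 3/μ of the
  -- routes.
  congestion-bound : ∀ μ ℓ {g} → 0 < μ → n < 2 ^ ℓ → 0 < pairs → (r : Rounds (2 * μ) g (2 * μ * ℓ) (λ _ → 1)) →
    ∀ w → center w ≡ true → ∑ (routings r) (λ R → congestion R w) ≤ 6 * ℓ * pairs
  congestion-bound μ ℓ μ>0 n<2^ℓ pos r w c = 2^-cancel-≤ (*-cancelʳ-≤ _ _ (B ^ A) {{Data.Nat.>-nonZero (^-pos A B>0)}} (begin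
      2 ^ C * B ^ A                        ≡⟨ cong (λ x → 2 ^ C * x ^ A) (sym (*-identityˡ B)) ⟩
      2 ^ C * (1 * B) ^ A                  ≤⟨ congestion-growth pos r w c ⟩
      (weight (λ _ → 1) center * suc (2 * μ) ^ (2 * μ * ℓ)) ^ A ≤⟨ power-≤ A (*-mono-≤ centers≤ (exp-upper μ ℓ)) ⟩
      (2 ^ ℓ * (4 ^ ℓ * B)) ^ A            ≡⟨ cong (_^ A) (sym (*-assoc (2 ^ ℓ) (4 ^ ℓ) B)) ⟩
      (2 ^ ℓ * 4 ^ ℓ * B) ^ A              ≡⟨ *-^ A _ _ ⟩
      (2 ^ ℓ * 4 ^ ℓ) ^ A * B ^ A          ≡⟨ cong (_* B ^ A) eight ⟩
      2 ^ (6 * ℓ * pairs) * B ^ A          ∎))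
    where
    open ≤-Reasoning
    A = 2 * pairs
    B = (2 * μ) ^ (2 * μ * ℓ)
    C = ∑ (routings r) (λ R → congestion R w)
    B>0 : 0 < B
    B>0 = ^-pos (2 * μ * ℓ) (*-pos (s≤s (z≤n {1})) μ>0)
    centers≤ : weight (λ _ → 1) center ≤ 2 ^ ℓ
    centers≤ = ≤-trans (≤-reflexive (∑-cong (allFin n) λ w → *-identityˡ ⟦ center w ⟧)) (≤-trans (#≤n center) (<⇒≤ n<2^ℓ))
    e : ∀ ℓ p → 3 * ℓ * (2 * p) ≡ 6 * ℓ * p
    e = solve-∀
    e′ : ∀ ℓ → ℓ + 2 * ℓ ≡ 3 * ℓ
    e′ = solve-∀
    eight : (2 ^ ℓ * 4 ^ ℓ) ^ A ≡ 2 ^ (6 * ℓ * pairs)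
    eight = trans (cong (_^ A) (trans (cong (2 ^ ℓ *_) (^-*-assoc 2 2 ℓ)) (trans (sym (^-distribˡ-+-* 2 ℓ (2 * ℓ))) (cong (2 ^_) (e′ ℓ)))))
      (trans (^-*-assoc 2 (3 * ℓ) A) (cong (2 ^_) (e ℓ pairs)))

-- One round of the game: a balanced separator or a cheap routing

scaled-separator-size : ℕ → ℕ → ℕ
scaled-separator-size σ ℓ = 2 * (4 * σ * (2 + ℓ)) * (ℓ + ℓ * (24 * suc ℓ))

module Play {n : ℕ} (_~_ : Fin n → Fin n → Bool) (~-sym : ∀ u v → (u ~ v) ≡ (v ~ u))
            (hit : Fin n → Fin n → Bool) {k : ℕ} (axioms : SetSystem.Axioms _~_ ~-sym hit k)
            (X : Fin n → Bool) (σ ℓ g : ℕ) (σ>0 : 0 < σ) (ℓ≥1 : 1 ≤ ℓ) (n<2^ℓ : n < 2 ^ ℓ)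
            (x⋆ : Fin n) (x⋆-center : hit x⋆ x⋆ ≡ true) where

  open Routings _~_ ~-sym hit axioms X public

  Separation : Set
  Separation = ∃ λ Y → # Y ≤ scaled-separator-size σ ℓ × (∀ x₀ → center x₀ ≡ true → Y x₀ ≡ false → Balanced g X Y x₀)

  module Round (ω : Fin n → ℕ) (ω>0 : ∀ w → 0 < ω w) where

    -- With respect to `smooth`, a route costs at most twice `radius (suc ℓ)`, that is 2(2ℓ+3)ρ ≤
    -- 4(2+ℓ)nW. As `smooth` is at least c n ω, this `c` leaves weight at most W/σ under `ω`.
    W c ρ : ℕ
    W = weight ω center
    c = 4 * σ * (2 + ℓ)
    ρ = n * W

    -- Adding the uniform weight bounds the ratio of any two weights by 2n.
    smooth : Fin n → ℕ
    smooth w = c * (n * ω w + W)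

    W>0 : 0 < W
    W>0 = ≤-trans (ω>0 x⋆) (weight-∈ ω x⋆-center)

    n>0 : 0 < n
    n>0 = ≤-<-trans z≤n (toℕ<n x⋆)

    c>0 : 0 < c
    c>0 = *-pos (*-pos (s≤s (z≤n {3})) σ>0) (s≤s z≤n)

    ρ>0 : 0 < ρ
    ρ>0 = *-pos n>0 W>0

    U>0 : 0 < c * W
    U>0 = *-pos c>0 W>0

    total : weight smooth center ≤ 2 * c * ρ
    total = begin
      weight smooth center                                        ≡⟨ ∑-cong (allFin n) (λ w → e₁ c n (ω w) W ⟦ center w ⟧) ⟩
      ∑ (allFin n) (λ w → c * n * (ω w * ⟦ center w ⟧) + c * W * ⟦ center w ⟧) ≡⟨ trans (∑-+ (allFin n) _ _) (cong₂ _+_ (∑-*ˡ (allFin n) (c * n) _) (∑-*ˡ (allFin n) (c * W) _)) ⟩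
      c * n * W + c * W * # center                                ≤⟨ +-monoʳ-≤ (c * n * W) (*-monoʳ-≤ (c * W) (#≤n center)) ⟩
      c * n * W + c * W * n                                       ≡⟨ e₂ c n W ⟩
      2 * c * (n * W)                                             ∎
      where
      open ≤-Reasoning
      e₁ : ∀ c n o W b → c * (n * o + W) * b ≡ c * n * (o * b) + c * W * b
      e₁ = solve-∀
      e₂ : ∀ c n W → c * n * W + c * W * n ≡ 2 * c * (n * W)
      e₂ = solve-∀

    total< : weight smooth center < 2 ^ suc ℓ * (c * W)
    total< = ≤-<-trans total (≤-<-trans (≤-reflexive (e c n W))
        (*-monoˡ-< (c * W) {{Data.Nat.>-nonZero U>0}} (*-monoʳ-< 2 n<2^ℓ)))
      where
      e : ∀ c n W → 2 * c * (n * W) ≡ 2 * n * (c * W)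
      e = solve-∀

    2c≡ : ∃ λ q → suc q ≡ 2 * c
    2c≡ = positive (*-pos (s≤s (z≤n {1})) c>0)
      where
      positive : ∀ {a} → 0 < a → ∃ λ q → suc q ≡ a
      positive (s≤s {n = q} _) = q , refl

    q : ℕ
    q = proj₁ 2c≡

    module R = Rounding axioms smooth ℓ q ρ (c * W) g X ℓ≥1 n<2^ℓ ρ>0 U>0
      (λ w → *-monoʳ-≤ c (m≤n+m W (n * ω w)))
      (*-mono-≤ (<⇒≤ n<2^ℓ) (≤-trans (≤-reflexive (sym (*-identityˡ W))) (*-monoˡ-≤ W c>0)))
      (≤-trans total (≤-reflexive (cong (_* ρ) (sym (proj₂ 2c≡)))))
      total<

    module FromCluster (u : Fin n) (K : Fin n → Bool) (K-near : ∀ v → K v ≡ true → Near smooth (R.radius (suc ℓ)) u v)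
                       (many : g * # X < g * # (λ x → X x ∧ K x) + # X) where

      region : ∀ v → K v ≡ true ⊎ K v ≡ false → Fin n → Bool
      region v (inj₁ e) = proj₁ (K-near v e)
      region v (inj₂ _) = λ _ → false

      S : Fin n → Fin n → Bool
      S v = region v (true⊎false (K v))

      S-weight : ∀ v → weight smooth (S v) ≤ R.radius (suc ℓ)
      S-weight v = go′ (true⊎false (K v))
        where
        go′ : ∀ d → weight smooth (region v d) ≤ R.radius (suc ℓ)
        go′ (inj₁ e) = proj₁ (proj₂ (K-near v e))
        go′ (inj₂ _) = ≤-trans (≤-reflexive (trans (∑-cong (allFin n) λ w → *-zeroʳ (smooth w)) (∑-zero (allFin n)))) z≤n

      S-conn : ∀ v → K v ≡ true → Conn (inside hit (S v)) u v
      S-conn v Kv = go′ (true⊎false (K v))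
        where
        go′ : ∀ d → Conn (inside hit (region v d)) u v
        go′ (inj₁ e) = proj₂ (proj₂ (K-near v e))
        go′ (inj₂ e) = ⊥-elim (true≢false Kv e)

      -- Pairs are routed through the center `u` of the cluster. At most 1/g of `X` lies outside
      -- `K`, so at most 2/g of the pairs fail.
      R′ : Routing
      R′ = record
        { through = λ x y → S x ∪ᵇ S y
        ; fail    = λ x y → not (K x ∧ K y)
        ; route   = λ x y e → let Kxy = K∧ (K x) (K y) e in
            conn-trans (conn-sym (conn-mono (inside-mono λ w → ∨-trueˡ) (S-conn x (proj₁ Kxy))))
                       (conn-mono (inside-mono λ w → ∨-trueʳ {S x w}) (S-conn y (proj₂ Kxy)))
        }
        where
        K∧ : ∀ a b → not (a ∧ b) ≡ false → a ≡ true × b ≡ true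
        K∧ true true _ = refl , refl

      cheap : Cheap σ ω R′
      cheap x y = *-cancelˡ-≤ (4 * (2 + ℓ) * n) {{Data.Nat.>-nonZero (*-pos (*-pos (s≤s (z≤n {3})) (s≤s (z≤n {suc ℓ}))) n>0)}} (begin
        4 * (2 + ℓ) * n * (σ * weight ω (S x ∪ᵇ S y))       ≡⟨ e₁ ℓ n σ (weight ω (S x ∪ᵇ S y)) ⟩
        c * n * weight ω (S x ∪ᵇ S y)                       ≡⟨ sym (∑-*ˡ (allFin n) (c * n) _) ⟩
        ∑ (allFin n) (λ w → c * n * (ω w * ⟦ (S x ∪ᵇ S y) w ⟧)) ≤⟨ ∑-mono (allFin n) (λ w → pointwise (ω w) ⟦ (S x ∪ᵇ S y) w ⟧) ⟩
        weight smooth (S x ∪ᵇ S y)                          ≤⟨ weight-∪ smooth (S x) (S y) ⟩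
        weight smooth (S x) + weight smooth (S y)           ≤⟨ +-mono-≤ (S-weight x) (S-weight y) ⟩
        R.radius (suc ℓ) + R.radius (suc ℓ)                 ≤⟨ ≤-trans (m≤m+n _ (2 * ρ)) (≤-reflexive (e₂ ℓ n W)) ⟩
        4 * (2 + ℓ) * n * W                                 ∎)
        where
        open ≤-Reasoning
        e₁ : ∀ ℓ n σ x → 4 * (2 + ℓ) * n * (σ * x) ≡ 4 * σ * (2 + ℓ) * n * x
        e₁ = solve-∀
        e₂ : ∀ ℓ n W → suc (2 * suc ℓ) * (n * W) + suc (2 * suc ℓ) * (n * W) + 2 * (n * W) ≡ 4 * (2 + ℓ) * n * W
        e₂ = solve-∀
        e₃ : ∀ c n o W b → c * n * (o * b) + c * W * b ≡ c * (n * o + W) * b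
        e₃ = solve-∀
        pointwise : ∀ o b → c * n * (o * b) ≤ c * (n * o + W) * b
        pointwise o b = ≤-trans (m≤m+n _ (c * W * b)) (≤-reflexive (e₃ c n o W b))

      N out : ℕ
      N = length elements
      out = ∑ elements (λ x → ⟦ not (K x) ⟧)

      out< : g * out ≤ N
      out< = +-cancelˡ-≤ (g * ∑ elements (λ x → ⟦ K x ⟧)) _ _ (begin
        g * ∑ elements (λ x → ⟦ K x ⟧) + g * out      ≡⟨ sym (*-distribˡ-+ g _ out) ⟩
        g * (∑ elements (λ x → ⟦ K x ⟧) + out)        ≡⟨ cong (g *_) complement ⟩
        g * N                                         ≡⟨ cong (g *_) (sym #X≡length) ⟩
        g * # X                                       ≤⟨ <⇒≤ many ⟩
        g * # (λ x → X x ∧ K x) + # X                 ≡⟨ cong₂ (λ a b → g * a + b) (#≡elements K) #X≡length ⟩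
        g * ∑ elements (λ x → ⟦ K x ⟧) + N            ∎)
        where
        open ≤-Reasoning
        complement : ∑ elements (λ x → ⟦ K x ⟧) + out ≡ N
        complement = trans (sym (∑-+ elements _ _)) (trans (∑-cong elements λ x → cases (K x)) (trans (∑-const elements 1) (*-identityʳ N)))
          where
          cases : ∀ b → ⟦ b ⟧ + ⟦ not b ⟧ ≡ 1
          cases true  = refl
          cases false = refl

      few-failures : g * failures R′ ≤ 2 * pairs
      few-failures = begin
        g * failures R′                          ≤⟨ *-monoʳ-≤ g (∑-mono elements λ x → ∑-mono elements λ y → cases (K x) (K y)) ⟩
        g * ∑ elements (λ x → ∑ elements (λ y → ⟦ not (K x) ⟧ + ⟦ not (K y) ⟧)) ≡⟨ cong (g *_) expand ⟩
        g * (N * out + N * out)                  ≡⟨ e g N out ⟩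
        2 * (N * (g * out))                      ≤⟨ *-monoʳ-≤ 2 (*-monoʳ-≤ N out<) ⟩
        2 * (N * N)                              ∎
        where
        open ≤-Reasoning
        e : ∀ g N o → g * (N * o + N * o) ≡ 2 * (N * (g * o))
        e = solve-∀
        cases : ∀ a b → ⟦ not (a ∧ b) ⟧ ≤ ⟦ not a ⟧ + ⟦ not b ⟧
        cases true  b = ≤-refl
        cases false b = s≤s z≤n
        expand : ∑ elements (λ x → ∑ elements (λ y → ⟦ not (K x) ⟧ + ⟦ not (K y) ⟧)) ≡ N * out + N * out
        expand = trans (∑-cong elements λ x → trans (∑-+ elements _ _) (cong (_+ out) (∑-const elements ⟦ not (K x) ⟧)))
          (trans (∑-+ elements _ _) (cong₂ _+_ (∑-*ˡ elements N _) (∑-const elements out)))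

    from-cluster : R.Clustered → ∃ λ R → Cheap σ ω R × g * failures R ≤ 2 * pairs
    from-cluster (u , K , K-near , many) = FromCluster.R′ u K K-near many ,
      FromCluster.cheap u K K-near many , FromCluster.few-failures u K K-near many

    separation : R.Separated → Separation
    separation (Y , le , balanced) = Y , ≤-trans le (≤-reflexive (cong (_* (ℓ + ℓ * (24 * suc ℓ))) (proj₂ 2c≡))) , balanced

    opaque
      separate-or-route : Separation ⊎ ∃ λ R → Cheap σ ω R × g * failures R ≤ 2 * pairs
      separate-or-route = [ inj₁ ∘ separation , inj₂ ∘ from-cluster ]′ R.separate-or-cluster

  play : 0 < pairs → ∀ m ω → (∀ w → 0 < ω w) → Separation ⊎ Rounds σ g m ω
  play pos zero    ω ω>0 = inj₂ done
  play pos (suc m) ω ω>0 = [ inj₁ , continue ]′ (Round.separate-or-route ω ω>0)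
    where
    continue : (∃ λ R → Cheap σ ω R × g * failures R ≤ 2 * pairs) → Separation ⊎ Rounds σ g (suc m) ω
    continue (R , cheap , few) = [ inj₁ , (λ r → inj₂ (round R cheap few r)) ]′
      (play pos m (reweigh ω R) λ w → *-pos (ω>0 w) (≤-trans pos (m≤m+n pairs _)))

-- Labelled hypercubes

data Cube (A : Set) : ℕ → Set where
  leaf : A → Cube A 0
  node : ∀ {h} → Cube A h → Cube A h → Cube A (suc h)

module _ {A : Set} where

  leaves : ∀ {h} → Cube A h → List A
  leaves (leaf a)   = a ∷ []
  leaves (node l r) = leaves l ++ leaves r

  matched : ∀ {h} → Cube A h → Cube A h → List (A × A)
  matched (leaf a)   (leaf b)     = (a , b) ∷ []
  matched (node l r) (node l′ r′) = matched l l′ ++ matched r r′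

  -- The edges in one direction form a perfect matching of the cube, so under a random labelling
  -- their label pairs are independent. For this reason loads are estimated one direction at a time.
  dimension : ∀ {h} → ℕ → Cube A h → List (A × A)
  dimension i       (leaf _)   = []
  dimension zero    (node l r) = matched l r
  dimension (suc i) (node l r) = dimension i l ++ dimension i r

  edges : ∀ {h} → Cube A h → List (A × A)
  edges (leaf _)   = []
  edges (node l r) = matched l r ++ (edges l ++ edges r)

  ∑-downFrom-suc : ∀ h (u : ℕ → ℕ) → ∑ (downFrom (suc h)) u ≡ u 0 + ∑ (downFrom h) (u ∘ suc)
  ∑-downFrom-suc zero    u = refl
  ∑-downFrom-suc (suc h) u rewrite ∑-downFrom-suc h u = swap (u (suc h)) (u 0) _
    where
    swap : ∀ a b c → a + (b + c) ≡ b + (a + c)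
    swap = solve-∀

  ∑-edges : ∀ {h} (π : Cube A h) (f : A × A → ℕ) → ∑ (edges π) f ≡ ∑ (downFrom h) (λ i → ∑ (dimension i π) f)
  ∑-edges (leaf _) f = refl
  ∑-edges {suc h} (node l r) f = begin
    ∑ (matched l r ++ (edges l ++ edges r)) f            ≡⟨ trans (∑-++ (matched l r) _ f) (cong (∑ (matched l r) f +_) (∑-++ (edges l) _ f)) ⟩
    ∑ (matched l r) f + (∑ (edges l) f + ∑ (edges r) f)  ≡⟨ cong₂ (λ a b → ∑ (matched l r) f + (a + b)) (∑-edges l f) (∑-edges r f) ⟩
    ∑ (matched l r) f + (∑ (downFrom h) (λ i → ∑ (dimension i l) f) + ∑ (downFrom h) (λ i → ∑ (dimension i r) f))
      ≡⟨ cong (∑ (matched l r) f +_) (sym (trans (∑-cong (downFrom h) λ i → ∑-++ (dimension i l) _ f) (∑-+ (downFrom h) _ _))) ⟩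
    ∑ (matched l r) f + ∑ (downFrom h) (λ i → ∑ (dimension i l ++ dimension i r) f) ≡⟨ sym (∑-downFrom-suc h (λ i → ∑ (dimension i (node l r)) f)) ⟩
    ∑ (downFrom (suc h)) (λ i → ∑ (dimension i (node l r)) f) ∎
    where open ≡-Reasoning

  ∑-matched : ∀ {h} (l r : Cube A h) (f : A → ℕ) → ∑ (matched l r) (λ (a , b) → f a + f b) ≡ ∑ (leaves l) f + ∑ (leaves r) f
  ∑-matched (leaf a)   (leaf b)     f = e (f a) (f b)
    where
    e : ∀ a b → a + b + 0 ≡ a + 0 + (b + 0)
    e = solve-∀
  ∑-matched (node l r) (node l′ r′) f = begin
    ∑ (matched l l′ ++ matched r r′) f₂                              ≡⟨ ∑-++ (matched l l′) (matched r r′) f₂ ⟩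
    ∑ (matched l l′) f₂ + ∑ (matched r r′) f₂                        ≡⟨ cong₂ _+_ (∑-matched l l′ f) (∑-matched r r′ f) ⟩
    ∑ (leaves l) f + ∑ (leaves l′) f + (∑ (leaves r) f + ∑ (leaves r′) f)   ≡⟨ e (∑ (leaves l) f) _ _ _ ⟩
    ∑ (leaves l) f + ∑ (leaves r) f + (∑ (leaves l′) f + ∑ (leaves r′) f)   ≡⟨ sym (cong₂ _+_ (∑-++ (leaves l) _ f) (∑-++ (leaves l′) _ f)) ⟩
    ∑ (leaves l ++ leaves r) f + ∑ (leaves l′ ++ leaves r′) f        ∎
    where
    open ≡-Reasoning
    f₂ : A × A → ℕ
    f₂ (a , b) = f a + f b
    e : ∀ a b c d → a + b + (c + d) ≡ a + c + (b + d)
    e = solve-∀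

  -- Edge isoperimetry: a colouring of the cube without a dominant colour has many bichromatic edges.
  module Colouring {C : Set} (_≟ᶜ_ : (a b : C) → Dec (a ≡ b)) (colour : A → C) where

    coloured : C → A → Bool
    coloured c a = ⌊ colour a ≟ᶜ c ⌋

    bichromatic : A × A → Bool
    bichromatic (a , b) = not ⌊ colour a ≟ᶜ colour b ⌋

    count : ∀ {h} → C → Cube A h → ℕ
    count c π = ∑ (leaves π) (λ a → ⟦ coloured c a ⟧)

    private
      matched-edge : ∀ c a b → ⟦ coloured c a ⟧ ≤ ⟦ bichromatic (a , b) ⟧ + ⟦ coloured c b ⟧
      matched-edge c a b with colour a ≟ᶜ colour b
      ... | no _ = ≤-trans (⟦⟧≤1 (coloured c a)) (s≤s z≤n)
      ... | yes e = ≤-reflexive (cong (λ x → ⟦ ⌊ x ≟ᶜ c ⌋ ⟧) e)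

      matched-edge′ : ∀ c a b → ⟦ coloured c b ⟧ ≤ ⟦ bichromatic (a , b) ⟧ + ⟦ coloured c a ⟧
      matched-edge′ c a b with colour a ≟ᶜ colour b
      ... | no _ = ≤-trans (⟦⟧≤1 (coloured c b)) (s≤s z≤n)
      ... | yes e = ≤-reflexive (cong (λ x → ⟦ ⌊ x ≟ᶜ c ⌋ ⟧) (sym e))

      interchange : ∀ {a b c d e f} → a ≤ c + e → b ≤ d + f → a + b ≤ c + d + (e + f)
      interchange {a} {b} {c} {d} {e} {f} p q = ≤-trans (+-mono-≤ p q) (≤-reflexive (lemma c e d f))
        where
        lemma : ∀ c e d f → c + e + (d + f) ≡ c + d + (e + f)
        lemma = solve-∀

      across : ∀ {h} c (l r : Cube A h) → count c l ≤ ∑ (matched l r) (⟦_⟧ ∘ bichromatic) + count c r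
      across c (leaf a) (leaf b) = ≤-trans (+-monoˡ-≤ 0 (matched-edge c a b)) (≤-reflexive (e ⟦ bichromatic (a , b) ⟧ _))
        where
        e : ∀ a b → a + b + 0 ≡ a + 0 + (b + 0)
        e = solve-∀
      across c (node l r) (node l′ r′)
        rewrite ∑-++ (matched l l′) (matched r r′) (⟦_⟧ ∘ bichromatic) | ∑-++ (leaves l) (leaves r) (⟦_⟧ ∘ coloured c)
              | ∑-++ (leaves l′) (leaves r′) (⟦_⟧ ∘ coloured c) =
        interchange {c = ∑ (matched l l′) (⟦_⟧ ∘ bichromatic)} {∑ (matched r r′) (⟦_⟧ ∘ bichromatic)} (across c l l′) (across c r r′)

      across′ : ∀ {h} c (l r : Cube A h) → count c r ≤ ∑ (matched l r) (⟦_⟧ ∘ bichromatic) + count c l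
      across′ c (leaf a) (leaf b) = ≤-trans (+-monoˡ-≤ 0 (matched-edge′ c a b)) (≤-reflexive (e ⟦ bichromatic (a , b) ⟧ _))
        where
        e : ∀ a b → a + b + 0 ≡ a + 0 + (b + 0)
        e = solve-∀
      across′ c (node l r) (node l′ r′)
        rewrite ∑-++ (matched l l′) (matched r r′) (⟦_⟧ ∘ bichromatic) | ∑-++ (leaves l) (leaves r) (⟦_⟧ ∘ coloured c)
              | ∑-++ (leaves l′) (leaves r′) (⟦_⟧ ∘ coloured c) =
        interchange {c = ∑ (matched l l′) (⟦_⟧ ∘ bichromatic)} {∑ (matched r r′) (⟦_⟧ ∘ bichromatic)} (across′ c l l′) (across′ c r r′)

    -- Of the dominant colours of the two halves, the one with the larger count is kept. The
    -- matching between the halves carries this count over to the other half, losing no more than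
    -- its bichromatic edges.
    dominant-colour : ∀ {h} (π : Cube A h) → ∃ λ c → 2 ^ h ≤ ∑ (edges π) (⟦_⟧ ∘ bichromatic) + count c π
    dominant-colour (leaf a) = colour a , ≤-reflexive (cong (λ b → ⟦ b ⟧ + 0) (sym (⌊⌋-true (colour a ≟ᶜ colour a) refl)))
    dominant-colour {suc h} (node l r) = combine (dominant-colour l) (dominant-colour r)
      where
      open ≤-Reasoning
      B : List (A × A) → ℕ
      B es = ∑ es (⟦_⟧ ∘ bichromatic)
      m = B (matched l r)
      assemble : ∀ c {x y} → 2 ^ h ≤ B (edges l) + x → 2 ^ h ≤ B (edges r) + y → x + y ≤ m + (count c l + count c r) →
                 2 ^ suc h ≤ B (edges (node l r)) + count c (node l r)
      assemble c {x} {y} p q le = begin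
        2 ^ h + (2 ^ h + 0)                               ≤⟨ +-mono-≤ p (≤-trans (≤-reflexive (+-identityʳ (2 ^ h))) q) ⟩
        B (edges l) + x + (B (edges r) + y)               ≡⟨ e₁ (B (edges l)) x (B (edges r)) y ⟩
        B (edges l) + B (edges r) + (x + y)               ≤⟨ +-monoʳ-≤ (B (edges l) + B (edges r)) le ⟩
        B (edges l) + B (edges r) + (m + (count c l + count c r)) ≡⟨ e₂ (B (edges l)) (B (edges r)) m (count c l + count c r) ⟩
        m + (B (edges l) + B (edges r)) + (count c l + count c r)
          ≡⟨ sym (cong₂ _+_ (trans (∑-++ (matched l r) _ _) (cong (m +_) (∑-++ (edges l) _ _))) (∑-++ (leaves l) _ _)) ⟩
        B (edges (node l r)) + count c (node l r)         ∎
        where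
        e₁ : ∀ a b c d → a + b + (c + d) ≡ a + c + (b + d)
        e₁ = solve-∀
        e₂ : ∀ a b m c → a + b + (m + c) ≡ m + (a + b) + c
        e₂ = solve-∀
      e₃ : ∀ a b c → a + (b + c) ≡ b + (a + c)
      e₃ = solve-∀
      combine : (∃ λ c → 2 ^ h ≤ B (edges l) + count c l) → (∃ λ c → 2 ^ h ≤ B (edges r) + count c r) →
                ∃ λ c → 2 ^ suc h ≤ B (edges (node l r)) + count c (node l r)
      combine (c , p) (c′ , q) = [ (λ le → c′ , assemble c′ p q
                                       (≤-trans (+-monoˡ-≤ (count c′ r) (≤-trans le (across′ c′ l r))) (≤-reflexive (+-assoc m _ _))))
                                 , (λ le → c , assemble c p q
                                       (≤-trans (+-monoʳ-≤ (count c l) (≤-trans le (across c l r))) (≤-reflexive (e₃ (count c l) m _)))) ]′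
                                 (≤-total (count c l) (count c′ r))

    touching : C → A × A → Bool
    touching c (a , b) = coloured c a ∨ coloured c b

    -- The matching in the first direction already covers all vertices, and an edge covers only two.
    count≤touching : ∀ {h} c (π : Cube A (suc h)) → count c π ≤ 2 * ∑ (edges π) (⟦_⟧ ∘ touching c)
    count≤touching c (node l r) = begin
      count c (node l r)                                        ≡⟨ trans (∑-++ (leaves l) _ _) (sym (∑-matched l r (⟦_⟧ ∘ coloured c))) ⟩
      ∑ (matched l r) (λ (a , b) → ⟦ coloured c a ⟧ + ⟦ coloured c b ⟧) ≤⟨ ∑-mono (matched l r) (λ (a , b) → cases (coloured c a) (coloured c b)) ⟩
      ∑ (matched l r) (λ e → 2 * ⟦ touching c e ⟧)              ≡⟨ ∑-*ˡ (matched l r) 2 _ ⟩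
      2 * ∑ (matched l r) (⟦_⟧ ∘ touching c)                    ≤⟨ *-monoʳ-≤ 2 (≤-trans (m≤m+n (∑ (matched l r) (⟦_⟧ ∘ touching c)) _) (≤-reflexive (sym (∑-++ (matched l r) _ _)))) ⟩
      2 * ∑ (edges (node l r)) (⟦_⟧ ∘ touching c)               ∎
      where
      open ≤-Reasoning
      cases : ∀ x y → ⟦ x ⟧ + ⟦ y ⟧ ≤ 2 * ⟦ x ∨ y ⟧
      cases true  true  = ≤-refl
      cases true  false = s≤s z≤n
      cases false true  = s≤s z≤n
      cases false false = z≤n

-- Averaging over all labellings of the cube

∏ : {A : Set} → List A → (A → ℕ) → ℕ
∏ []      f = 1
∏ (x ∷ l) f = f x * ∏ l f

∏-++ : {A : Set} (l l′ : List A) (f : A → ℕ) → ∏ (l ++ l′) f ≡ ∏ l f * ∏ l′ f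
∏-++ []      l′ f = sym (+-identityʳ _)
∏-++ (x ∷ l) l′ f = trans (cong (f x *_) (∏-++ l l′ f)) (sym (*-assoc (f x) _ _))

∏-2^ : {A : Set} (l : List A) (b : A → Bool) → ∏ l (λ a → suc ⟦ b a ⟧) ≡ 2 ^ ∑ l (⟦_⟧ ∘ b)
∏-2^ []      b = refl
∏-2^ (x ∷ l) b with b x
... | true  = cong (2 *_) (∏-2^ l b)
... | false = trans (+-identityʳ _) (∏-2^ l b)

module Averaging {A : Set} (labels : List A) where

  cubes : ∀ h → List (Cube A h)
  cubes zero    = map leaf labels
  cubes (suc h) = cartesianProductWith node (cubes h) (cubes h)

  N : ℕ
  N = length labels

  #cubes : ℕ → ℕ
  #cubes h = ∑ (cubes h) (λ _ → 1)

  #cubes-suc : ∀ h → #cubes (suc h) ≡ #cubes h * #cubes h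
  #cubes-suc h = trans (∑-product node (cubes h) (cubes h) (λ _ → 1)) (∑-*-∑ (cubes h) (cubes h) (λ _ → 1) (λ _ → 1))

  #cubes≡ : ∀ h → #cubes h ≡ N ^ (2 ^ h)
  #cubes≡ zero    = trans (∑-map labels leaf (λ _ → 1)) (trans (∑-const labels 1) refl)
  #cubes≡ (suc h) = trans (#cubes-suc h) (trans (cong₂ _*_ (#cubes≡ h) (#cubes≡ h))
    (trans (sym (^-distribˡ-+-* N (2 ^ h) (2 ^ h))) (cong (λ x → N ^ (2 ^ h + x)) (sym (+-identityʳ (2 ^ h))))))

  pair-sum : (A × A → ℕ) → ℕ
  pair-sum f = ∑ labels (λ a → ∑ labels (λ b → f (a , b)))

  private
    ∑² : ∀ h → (Cube A h → Cube A h → ℕ) → ℕ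
    ∑² h F = ∑ (cubes h) (λ l → ∑ (cubes h) (F l))

    ∑²-suc : ∀ h (F : Cube A (suc h) → Cube A (suc h) → ℕ) →
      ∑² (suc h) F ≡ ∑² h (λ a c → ∑² h (λ b d → F (node a b) (node c d)))
    ∑²-suc h F = trans (∑-product node (cubes h) (cubes h) _)
      (∑-cong (cubes h) λ a → trans (∑-cong (cubes h) λ b → ∑-product node (cubes h) (cubes h) (F (node a b)))
                                    (∑-swap (cubes h) (cubes h) _))

    ∑²-* : ∀ h (P Q : Cube A h → Cube A h → ℕ) → ∑² h (λ a c → ∑² h (λ b d → P a c * Q b d)) ≡ ∑² h P * ∑² h Q
    ∑²-* h P Q = trans (∑-cong (cubes h) λ a → ∑-cong (cubes h) λ c →
                     trans (∑-cong (cubes h) λ b → ∑-*ˡ (cubes h) (P a c) _) (∑-*ˡ (cubes h) (P a c) _))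
                 (trans (∑-cong (cubes h) λ a → ∑-*ʳ (cubes h) (∑² h Q) (P a)) (∑-*ʳ (cubes h) (∑² h Q) _))

  matched-product : ∀ h f → ∑² h (λ l r → ∏ (matched l r) f) ≡ pair-sum f ^ (2 ^ h)
  matched-product zero f = trans (∑-map labels leaf _) (trans (∑-cong labels λ a → trans (∑-map labels leaf _) (∑-cong labels λ b → *-identityʳ (f (a , b)))) (sym (*-identityʳ (pair-sum f))))
  matched-product (suc h) f = trans (∑²-suc h (λ l r → ∏ (matched l r) f))
    (trans (∑-cong (cubes h) λ a → ∑-cong (cubes h) λ c → ∑-cong (cubes h) λ b → ∑-cong (cubes h) λ d → ∏-++ (matched a c) (matched b d) f)
    (trans (∑²-* h _ _) (trans (cong₂ _*_ (matched-product h f) (matched-product h f))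
      (trans (sym (^-distribˡ-+-* (pair-sum f) (2 ^ h) (2 ^ h))) (cong (λ x → pair-sum f ^ (2 ^ h + x)) (sym (+-identityʳ (2 ^ h))))))))

  -- Independence along the 2^h edges of a perfect matching: the sum over all labellings factors
  -- into one pair sum per edge.
  dimension-product : ∀ h i f → i ≤ h → ∑ (cubes (suc h)) (λ π → ∏ (dimension i π) f) ≡ pair-sum f ^ (2 ^ h)
  dimension-product h zero f _ = trans (∑-product node (cubes h) (cubes h) _) (matched-product h f)
  dimension-product (suc h) (suc i) f (s≤s le) = trans (∑-product node (cubes (suc h)) (cubes (suc h)) _)
    (trans (∑-cong (cubes (suc h)) λ l → ∑-cong (cubes (suc h)) λ r → ∏-++ (dimension i l) (dimension i r) f)
    (trans (∑-*-∑ (cubes (suc h)) (cubes (suc h)) (λ l → ∏ (dimension i l) f) (λ r → ∏ (dimension i r) f))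
      (trans (cong₂ _*_ (dimension-product h i f le) (dimension-product h i f le))
      (trans (sym (^-distribˡ-+-* (pair-sum f) (2 ^ h) (2 ^ h))) (cong (λ x → pair-sum f ^ (2 ^ h + x)) (sym (+-identityʳ (2 ^ h))))))))

  private
    ∑-sum : ∀ {B : Set} (l : List B) (f g : B → ℕ) →
            ∑ l (λ a → ∑ l (λ b → f a + g b)) ≡ length l * ∑ l f + length l * ∑ l g
    ∑-sum l f g = trans (∑-cong l λ a → trans (∑-+ l (λ _ → f a) g) (cong (_+ ∑ l g) (∑-const l (f a))))
      (trans (∑-+ l _ _) (cong₂ _+_ (∑-*ˡ l (length l) f) (∑-const l (∑ l g))))

    length-cubes : ∀ h → length (cubes h) ≡ #cubes h
    length-cubes h = sym (trans (∑-const (cubes h) 1) (*-identityʳ _))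

  matched-sum : ∀ h f K → K * pair-sum f ≤ N * N → K * ∑² h (λ l r → ∑ (matched l r) f) ≤ 2 ^ h * (#cubes h * #cubes h)
  matched-sum zero f K le = ≤-trans (≤-reflexive (cong (K *_) (trans (∑-map labels leaf _)
      (∑-cong labels λ a → trans (∑-map labels leaf _) (∑-cong labels λ b → +-identityʳ (f (a , b)))))))
    (≤-trans le (≤-reflexive (trans (sym (cong₂ _*_ c≡N c≡N)) (sym (+-identityʳ _)))))
    where
    c≡N : #cubes 0 ≡ N
    c≡N = trans (#cubes≡ 0) (*-identityʳ N)
  matched-sum (suc h) f K le = begin
    K * ∑² (suc h) (λ l r → ∑ (matched l r) f)                      ≡⟨ cong (K *_) (trans (∑²-suc h _) expand) ⟩
    K * (2 * (c * c * S))                                           ≡⟨ e₁ K c S ⟩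
    2 * (c * c) * (K * S)                                           ≤⟨ *-monoʳ-≤ (2 * (c * c)) (matched-sum h f K le) ⟩
    2 * (c * c) * (2 ^ h * (c * c))                                 ≡⟨ e₂ (c * c) (2 ^ h) ⟩
    2 ^ suc h * (c * c * (c * c))                                   ≡⟨ cong (2 ^ suc h *_) (sym (cong₂ _*_ (#cubes-suc h) (#cubes-suc h))) ⟩
    2 ^ suc h * (#cubes (suc h) * #cubes (suc h))                   ∎
    where
    open ≤-Reasoning
    c = #cubes h
    S = ∑² h (λ l r → ∑ (matched l r) f)
    e₁ : ∀ K c S → K * (2 * (c * c * S)) ≡ 2 * (c * c) * (K * S)
    e₁ = solve-∀
    e₂ : ∀ c h → 2 * c * (h * c) ≡ 2 * h * (c * c)
    e₂ = solve-∀
    e₃ : ∀ c S → c * (c * S) + c * (c * S) ≡ 2 * (c * c * S)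
    e₃ = solve-∀
    const² : ∑² h (λ _ _ → S) ≡ c * (c * S)
    const² = trans (∑-cong (cubes h) λ _ → ∑-const (cubes h) S) (trans (∑-const (cubes h) _) (cong (λ x → x * (x * S)) (length-cubes h)))
    lift : ∀ x → ∑² h (λ _ _ → x) ≡ c * (c * x)
    lift x = trans (∑-cong (cubes h) λ _ → ∑-const (cubes h) x) (trans (∑-const (cubes h) _) (cong (λ y → y * (y * x)) (length-cubes h)))
    e₄ : ∀ c x → c * (c * x) ≡ c * c * x
    e₄ = solve-∀
    expand : ∑² h (λ a c′ → ∑² h (λ b d → ∑ (matched a c′ ++ matched b d) f)) ≡ 2 * (c * c * S)
    expand = trans (∑-cong (cubes h) λ a → ∑-cong (cubes h) λ c′ →
        trans (∑-cong (cubes h) λ b → trans (∑-cong (cubes h) λ d → ∑-++ (matched a c′) (matched b d) f) (∑-+ (cubes h) _ _))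
        (trans (∑-+ (cubes h) _ _) (cong (_+ S) (trans (lift (∑ (matched a c′) f)) (e₄ c _)))))
      (trans (∑-cong (cubes h) λ a → ∑-+ (cubes h) _ _)
      (trans (∑-+ (cubes h) _ _) (trans (cong₂ _+_
          (trans (∑-cong (cubes h) λ a → ∑-*ˡ (cubes h) (c * c) _) (trans (∑-*ˡ (cubes h) (c * c) _) (sym (e₄ c S)))) const²)
        (e₃ c S))))

  dimension-sum : ∀ h i f K → i ≤ h → K * pair-sum f ≤ N * N → K * ∑ (cubes (suc h)) (λ π → ∑ (dimension i π) f) ≤ 2 ^ h * #cubes (suc h)
  dimension-sum h zero f K _ le = ≤-trans (≤-reflexive (cong (K *_) (∑-product node (cubes h) (cubes h) _)))
    (≤-trans (matched-sum h f K le) (≤-reflexive (cong (2 ^ h *_) (sym (#cubes-suc h)))))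
  dimension-sum (suc h) (suc i) f K (s≤s i≤h) le = begin
    K * ∑ (cubes (suc (suc h))) (λ π → ∑ (dimension (suc i) π) f)  ≡⟨ cong (K *_) (trans (∑-product node (cubes (suc h)) (cubes (suc h)) _)
         (trans (∑-cong (cubes (suc h)) λ l → ∑-cong (cubes (suc h)) λ r → ∑-++ (dimension i l) (dimension i r) f)
                (∑-sum (cubes (suc h)) (λ l → ∑ (dimension i l) f) (λ r → ∑ (dimension i r) f)))) ⟩
    K * (length (cubes (suc h)) * S + length (cubes (suc h)) * S)   ≡⟨ cong (λ c → K * (c * S + c * S)) (length-cubes (suc h)) ⟩
    K * (c * S + c * S)                                             ≡⟨ e₁ K c S ⟩
    2 * c * (K * S)                                                 ≤⟨ *-monoʳ-≤ (2 * c) (dimension-sum h i f K i≤h le) ⟩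
    2 * c * (2 ^ h * c)                                             ≡⟨ e₂ c (2 ^ h) ⟩
    2 ^ suc h * (c * c)                                             ≡⟨ cong (2 ^ suc h *_) (sym (#cubes-suc (suc h))) ⟩
    2 ^ suc h * #cubes (suc (suc h))                                ∎
    where
    open ≤-Reasoning
    c = #cubes (suc h)
    S = ∑ (cubes (suc h)) (λ π → ∑ (dimension i π) f)
    e₁ : ∀ K c S → K * (c * S + c * S) ≡ 2 * c * (K * S)
    e₁ = solve-∀
    e₂ : ∀ c h → 2 * c * (h * c) ≡ 2 * h * (c * c)
    e₂ = solve-∀

  -- Markov's inequality for the exponential load potential and the number of failures at once.
  module _ {n : ℕ} (relevant : Fin n → Bool) (hits : Fin n → A × A → Bool) (fails : A × A → Bool) (h ℓ μ : ℕ)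
           (μ>0 : 0 < μ) (N>0 : 0 < N) (size≤ : 2 ^ h ≤ 2 * μ * ℓ) (n<2^ℓ : n < 2 ^ ℓ) (n>0 : 0 < n) (h< : 2 * suc h ≤ 2 ^ ℓ)
           (hits≤ : ∀ w → relevant w ≡ true → 2 * μ * pair-sum (⟦_⟧ ∘ hits w) ≤ N * N)
           (fails≤ : 4 * suc h * pair-sum (⟦_⟧ ∘ fails) ≤ N * N) where

    private
      -- Over the `c` labellings the potential averages at most `a`, and eight times the number of
      -- failed edges at most `z`. Some labelling has `potential π * z + 8 * failed π * a` at most
      -- 2az, and then both summands are small at once.
      c a z : ℕ
      c = #cubes (suc h)
      a = suc h * (n * 4 ^ ℓ)
      z = 2 ^ suc h

      potential failed : Cube A (suc h) → ℕ
      potential π = ∑ (downFrom (suc h)) (λ i → ∑ (allFin n) (λ w → ⟦ relevant w ⟧ * ∏ (dimension i π) (λ e → suc ⟦ hits w e ⟧)))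
      failed π = ∑ (edges π) (⟦_⟧ ∘ fails)

      growth : suc (2 * μ) ^ (2 ^ h) ≤ 4 ^ ℓ * (2 * μ) ^ (2 ^ h)
      growth = *-cancelʳ-≤ _ _ ((2 * μ) ^ d) {{Data.Nat.>-nonZero (^-pos d σ>0)}} (begin
        suc (2 * μ) ^ (2 ^ h) * (2 * μ) ^ d          ≤⟨ *-monoʳ-≤ (suc (2 * μ) ^ (2 ^ h)) (power-≤ d (n≤1+n (2 * μ))) ⟩
        suc (2 * μ) ^ (2 ^ h) * suc (2 * μ) ^ d      ≡⟨ combine (suc (2 * μ)) ⟩
        suc (2 * μ) ^ (2 * μ * ℓ)                    ≤⟨ exp-upper μ ℓ ⟩
        4 ^ ℓ * (2 * μ) ^ (2 * μ * ℓ)                ≡⟨ cong (4 ^ ℓ *_) (sym (combine (2 * μ))) ⟩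
        4 ^ ℓ * ((2 * μ) ^ (2 ^ h) * (2 * μ) ^ d)    ≡⟨ sym (*-assoc (4 ^ ℓ) _ _) ⟩
        4 ^ ℓ * (2 * μ) ^ (2 ^ h) * (2 * μ) ^ d      ∎)
        where
        open ≤-Reasoning
        d = 2 * μ * ℓ ∸ 2 ^ h
        σ>0 : 0 < 2 * μ
        σ>0 = *-pos (s≤s (z≤n {1})) μ>0
        combine : ∀ x → x ^ (2 ^ h) * x ^ d ≡ x ^ (2 * μ * ℓ)
        combine x = trans (sym (^-distribˡ-+-* x (2 ^ h) d)) (cong (x ^_) (m+[n∸m]≡n size≤))

      pair-hits : ∀ w → relevant w ≡ true → pair-sum (λ e → suc ⟦ hits w e ⟧) * (2 * μ) ≤ N * N * suc (2 * μ)
      pair-hits w r = begin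
        pair-sum (λ e → suc ⟦ hits w e ⟧) * (2 * μ)       ≡⟨ cong (_* (2 * μ)) split ⟩
        (N * N + pair-sum (⟦_⟧ ∘ hits w)) * (2 * μ)       ≡⟨ e₁ (N * N) (pair-sum (⟦_⟧ ∘ hits w)) (2 * μ) ⟩
        N * N * (2 * μ) + 2 * μ * pair-sum (⟦_⟧ ∘ hits w) ≤⟨ +-monoʳ-≤ (N * N * (2 * μ)) (hits≤ w r) ⟩
        N * N * (2 * μ) + N * N                           ≡⟨ e₂ (N * N) (2 * μ) ⟩
        N * N * suc (2 * μ)                               ∎
        where
        open ≤-Reasoning
        e₁ : ∀ a b c → (a + b) * c ≡ a * c + c * b
        e₁ = solve-∀
        e₂ : ∀ a b → a * b + a ≡ a * suc b
        e₂ = solve-∀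
        split : pair-sum (λ e → suc ⟦ hits w e ⟧) ≡ N * N + pair-sum (⟦_⟧ ∘ hits w)
        split = trans (∑-cong labels λ x → trans (∑-+ labels (λ _ → 1) _) (cong (_+ ∑ labels (λ y → ⟦ hits w (x , y) ⟧)) (trans (∑-const labels 1) (*-identityʳ N))))
          (trans (∑-+ labels _ _) (cong (_+ pair-sum (⟦_⟧ ∘ hits w)) (∑-const labels N)))

      expected-load : ∀ w i → relevant w ≡ true → i ≤ h → ∑ (cubes (suc h)) (λ π → ∏ (dimension i π) (λ e → suc ⟦ hits w e ⟧)) ≤ c * 4 ^ ℓ
      expected-load w i r i≤h = *-cancelʳ-≤ _ _ ((2 * μ) ^ (2 ^ h)) {{Data.Nat.>-nonZero (^-pos (2 ^ h) (*-pos (s≤s (z≤n {1})) μ>0))}} (begin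
        ∑ (cubes (suc h)) (λ π → ∏ (dimension i π) (λ e → suc ⟦ hits w e ⟧)) * (2 * μ) ^ (2 ^ h) ≡⟨ cong (_* (2 * μ) ^ (2 ^ h)) (dimension-product h i _ i≤h) ⟩
        P ^ (2 ^ h) * (2 * μ) ^ (2 ^ h)              ≡⟨ sym (*-^ (2 ^ h) P (2 * μ)) ⟩
        (P * (2 * μ)) ^ (2 ^ h)                      ≤⟨ power-≤ (2 ^ h) (pair-hits w r) ⟩
        (N * N * suc (2 * μ)) ^ (2 ^ h)              ≡⟨ *-^ (2 ^ h) (N * N) (suc (2 * μ)) ⟩
        (N * N) ^ (2 ^ h) * suc (2 * μ) ^ (2 ^ h)    ≤⟨ *-mono-≤ (≤-reflexive c≡) growth ⟩
        c * (4 ^ ℓ * (2 * μ) ^ (2 ^ h))              ≡⟨ sym (*-assoc c _ _) ⟩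
        c * 4 ^ ℓ * (2 * μ) ^ (2 ^ h)                ∎)
        where
        open ≤-Reasoning
        P = pair-sum (λ e → suc ⟦ hits w e ⟧)
        c≡ : (N * N) ^ (2 ^ h) ≡ c
        c≡ = trans (*-^ (2 ^ h) N N) (sym (trans (#cubes-suc h) (cong₂ _*_ (#cubes≡ h) (#cubes≡ h))))

      expected-potential : ∑ (cubes (suc h)) potential ≤ c * a
      expected-potential = begin
        ∑ (cubes (suc h)) potential      ≡⟨ trans (∑-swap (cubes (suc h)) (downFrom (suc h)) _) (∑-cong (downFrom (suc h)) λ i → ∑-swap (cubes (suc h)) (allFin n) _) ⟩
        ∑ (downFrom (suc h)) (λ i → ∑ (allFin n) (λ w → ∑ (cubes (suc h)) (λ π → ⟦ relevant w ⟧ * ∏ (dimension i π) (λ e → suc ⟦ hits w e ⟧))))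
                                         ≤⟨ ∑-mono-∈ (downFrom (suc h)) (λ {i} i∈ → ∑-mono (allFin n) λ w →
                                              ≤-trans (≤-reflexive (∑-*ˡ (cubes (suc h)) ⟦ relevant w ⟧ _)) (guarded (relevant w) λ r → expected-load w i r (≤-pred (∈-downFrom⇒< i∈)))) ⟩
        ∑ (downFrom (suc h)) (λ i → ∑ (allFin n) (λ w → c * 4 ^ ℓ)) ≡⟨ trans (∑-cong (downFrom (suc h)) λ _ → ∑-const (allFin n) _) (∑-const (downFrom (suc h)) _) ⟩
        length (downFrom (suc h)) * (length (allFin n) * (c * 4 ^ ℓ)) ≡⟨ cong₂ (λ x y → x * (y * (c * 4 ^ ℓ))) (length-downFrom (suc h)) (length-allFin n) ⟩
        suc h * (n * (c * 4 ^ ℓ))        ≡⟨ e (suc h) n c (4 ^ ℓ) ⟩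
        c * a                            ∎
        where
        open ≤-Reasoning
        e : ∀ h n c x → h * (n * (c * x)) ≡ c * (h * (n * x))
        e = solve-∀
        guarded : ∀ b {x y} → (b ≡ true → x ≤ y) → ⟦ b ⟧ * x ≤ y
        guarded true  le = ≤-trans (≤-reflexive (+-identityʳ _)) (le refl)
        guarded false le = z≤n

      expected-failed : 8 * ∑ (cubes (suc h)) failed ≤ z * c
      expected-failed = *-cancelˡ-≤ (suc h) (begin
        suc h * (8 * ∑ (cubes (suc h)) failed)                 ≡⟨ cong (λ x → suc h * (8 * x)) (trans (∑-cong (cubes (suc h)) λ π → ∑-edges π _) (∑-swap (cubes (suc h)) (downFrom (suc h)) _)) ⟩
        suc h * (8 * ∑ (downFrom (suc h)) F)                   ≡⟨ e₁ (suc h) (∑ (downFrom (suc h)) F) ⟩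
        2 * (4 * suc h * ∑ (downFrom (suc h)) F)               ≡⟨ cong (2 *_) (sym (∑-*ˡ (downFrom (suc h)) (4 * suc h) F)) ⟩
        2 * ∑ (downFrom (suc h)) (λ i → 4 * suc h * F i)       ≤⟨ *-monoʳ-≤ 2 (∑-mono-∈ (downFrom (suc h)) λ {i} i∈ →
                                                                     dimension-sum h i (⟦_⟧ ∘ fails) (4 * suc h) (≤-pred (∈-downFrom⇒< i∈)) fails≤) ⟩
        2 * ∑ (downFrom (suc h)) (λ _ → 2 ^ h * c)             ≡⟨ cong (2 *_) (trans (∑-const (downFrom (suc h)) _) (cong (_* (2 ^ h * c)) (length-downFrom (suc h)))) ⟩
        2 * (suc h * (2 ^ h * c))                              ≡⟨ e₂ (suc h) (2 ^ h) c ⟩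
        suc h * (2 ^ suc h * c)                                ∎)
        where
        open ≤-Reasoning
        F : ℕ → ℕ
        F i = ∑ (cubes (suc h)) (λ π → ∑ (dimension i π) (⟦_⟧ ∘ fails))
        e₁ : ∀ h x → h * (8 * x) ≡ 2 * (4 * h * x)
        e₁ = solve-∀
        e₂ : ∀ h p c → 2 * (h * (p * c)) ≡ h * (2 * p * c)
        e₂ = solve-∀

      c>0 : 0 < length (cubes (suc h))
      c>0 = ≤-trans (^-pos (2 ^ suc h) N>0) (≤-reflexive (trans (sym (#cubes≡ (suc h))) (sym (length-cubes (suc h)))))

      average : ∑ (cubes (suc h)) (λ π → potential π * z + 8 * failed π * a) ≤ ∑ (cubes (suc h)) (λ _ → 2 * (a * z))
      average = begin
        ∑ (cubes (suc h)) (λ π → potential π * z + 8 * failed π * a)    ≡⟨ trans (∑-+ (cubes (suc h)) _ _) (cong₂ _+_ (∑-*ʳ (cubes (suc h)) z potential)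
                                                                              (trans (∑-*ʳ (cubes (suc h)) a _) (cong (_* a) (∑-*ˡ (cubes (suc h)) 8 failed)))) ⟩
        ∑ (cubes (suc h)) potential * z + 8 * ∑ (cubes (suc h)) failed * a ≤⟨ +-mono-≤ (*-monoˡ-≤ z expected-potential) (*-monoˡ-≤ a expected-failed) ⟩
        c * a * z + z * c * a                                           ≡⟨ e c a z ⟩
        c * (2 * (a * z))                                               ≡⟨ cong (_* (2 * (a * z))) (sym (length-cubes (suc h))) ⟩
        length (cubes (suc h)) * (2 * (a * z))                          ≡⟨ sym (∑-const (cubes (suc h)) _) ⟩
        ∑ (cubes (suc h)) (λ _ → 2 * (a * z))                           ∎
        where
        open ≤-Reasoning
        e : ∀ c a z → c * a * z + z * c * a ≡ c * (2 * (a * z))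
        e = solve-∀

      -- A single term of the potential is 2 to the power of a load. It is at most 2(h+1) · n · 4^ℓ,
      -- where 2(h+1) and n are each at most 2^ℓ.
      load≤ : ∀ π → potential π ≤ 2 * a → ∀ w i → relevant w ≡ true → i ≤ h → ∑ (dimension i π) (⟦_⟧ ∘ hits w) ≤ 4 * ℓ
      load≤ π le w i r i≤h = 2^-cancel-≤ (begin
        2 ^ ∑ (dimension i π) (⟦_⟧ ∘ hits w)                 ≡⟨ sym (∏-2^ (dimension i π) (hits w)) ⟩
        ∏ (dimension i π) (λ e → suc ⟦ hits w e ⟧)           ≡⟨ sym (trans (cong (λ b → ⟦ b ⟧ * ∏ (dimension i π) (λ e → suc ⟦ hits w e ⟧)) r) (+-identityʳ _)) ⟩
        ⟦ relevant w ⟧ * ∏ (dimension i π) (λ e → suc ⟦ hits w e ⟧) ≤⟨ ∑-∈ (allFin n) (λ w → ⟦ relevant w ⟧ * ∏ (dimension i π) (λ e → suc ⟦ hits w e ⟧)) (∈-allFin w) ⟩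
        ∑ (allFin n) (λ w → ⟦ relevant w ⟧ * ∏ (dimension i π) (λ e → suc ⟦ hits w e ⟧))
                                                             ≤⟨ ∑-∈ (downFrom (suc h)) (λ i → ∑ (allFin n) (λ w → ⟦ relevant w ⟧ * ∏ (dimension i π) (λ e → suc ⟦ hits w e ⟧))) (<⇒∈-downFrom (s≤s i≤h)) ⟩
        potential π                                          ≤⟨ le ⟩
        2 * (suc h * (n * 4 ^ ℓ))                            ≡⟨ sym (*-assoc 2 (suc h) _) ⟩
        2 * suc h * (n * 4 ^ ℓ)                              ≤⟨ *-mono-≤ h< (*-monoˡ-≤ (4 ^ ℓ) (<⇒≤ n<2^ℓ)) ⟩
        2 ^ ℓ * (2 ^ ℓ * 4 ^ ℓ)                              ≡⟨ cong (λ x → 2 ^ ℓ * (2 ^ ℓ * x)) (^-*-assoc 2 2 ℓ) ⟩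
        2 ^ ℓ * (2 ^ ℓ * 2 ^ (2 * ℓ))                        ≡⟨ cong (2 ^ ℓ *_) (sym (^-distribˡ-+-* 2 ℓ (2 * ℓ))) ⟩
        2 ^ ℓ * 2 ^ (ℓ + 2 * ℓ)                              ≡⟨ sym (^-distribˡ-+-* 2 ℓ (ℓ + 2 * ℓ)) ⟩
        2 ^ (ℓ + (ℓ + 2 * ℓ))                                ≡⟨ cong (2 ^_) (e ℓ) ⟩
        2 ^ (4 * ℓ)                                          ∎)
        where
        open ≤-Reasoning
        e : ∀ ℓ → ℓ + (ℓ + 2 * ℓ) ≡ 4 * ℓ
        e = solve-∀

      finish : (∃ λ π → π ∈ₗ cubes (suc h) × potential π * z + 8 * failed π * a ≤ 2 * (a * z)) →
        ∃ λ (π : Cube A (suc h)) → 4 * ∑ (edges π) (⟦_⟧ ∘ fails) ≤ 2 ^ suc h ×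
          (∀ w → relevant w ≡ true → ∑ (edges π) (⟦_⟧ ∘ hits w) ≤ suc h * (4 * ℓ))
      finish (π , _ , le) = π , few , total
        where
        a>0 : 0 < a
        a>0 = *-pos (s≤s (z≤n {h})) (*-pos n>0 (^-pos ℓ (s≤s (z≤n {3}))))
        few : 4 * failed π ≤ z
        few = *-cancelʳ-≤ _ _ (2 * a) {{Data.Nat.>-nonZero (*-pos (s≤s (z≤n {1})) a>0)}}
          (≤-trans (≤-reflexive (e (failed π) a)) (≤-trans (m≤n+m _ (potential π * z)) (≤-trans le (≤-reflexive (e′ a z)))))
          where
          e : ∀ x a → 4 * x * (2 * a) ≡ 8 * x * a
          e = solve-∀
          e′ : ∀ a z → 2 * (a * z) ≡ z * (2 * a)
          e′ = solve-∀
        small : potential π ≤ 2 * a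
        small = *-cancelʳ-≤ _ _ z {{Data.Nat.>-nonZero (^-pos (suc h) (s≤s (z≤n {1})))}}
          (≤-trans (m≤m+n _ (8 * failed π * a)) (≤-trans le (≤-reflexive (sym (*-assoc 2 a z)))))
        total : ∀ w → relevant w ≡ true → ∑ (edges π) (⟦_⟧ ∘ hits w) ≤ suc h * (4 * ℓ)
        total w r = ≤-trans (≤-reflexive (∑-edges π _)) (≤-trans
          (∑-mono-∈ (downFrom (suc h)) λ {i} i∈ → load≤ π small w i r (≤-pred (∈-downFrom⇒< i∈)))
          (≤-reflexive (trans (∑-const (downFrom (suc h)) (4 * ℓ)) (cong (_* (4 * ℓ)) (length-downFrom (suc h))))))

    opaque
      good-cube : ∃ λ (π : Cube A (suc h)) → 4 * ∑ (edges π) (⟦_⟧ ∘ fails) ≤ 2 ^ suc h ×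
        (∀ w → relevant w ≡ true → ∑ (edges π) (⟦_⟧ ∘ hits w) ≤ suc h * (4 * ℓ))
      good-cube = finish (∑-pigeonhole-≤ (cubes (suc h)) (λ π → potential π * z + 8 * failed π * a) (λ _ → 2 * (a * z)) c>0 average)

-- Branches of a rooted tree at a node

module Branches (T : RootedTree) where

  Node : Set
  Node = Fin (nodes T)

  private
    branch-step : Node → Node → Maybe (Maybe Node) → Maybe (Maybe Node)
    branch-step x y b with y ≟ x | y ≟ root T | parent T y ≟ x
    ... | yes _ | _     | _     = nothing
    ... | no _  | yes _ | _     = just nothing
    ... | no _  | no _  | yes _ = just (just y)
    ... | no _  | no _  | no _  = b

    branch-fuel : ℕ → Node → Node → Maybe (Maybe Node)
    branch-fuel zero    x y = nothing
    branch-fuel (suc f) x y = branch-step x y (branch-fuel f x (parent T y))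

    branch-step-cong : ∀ x y b b′ → (y ≢ root T → b ≡ b′) → branch-step x y b ≡ branch-step x y b′
    branch-step-cong x y b b′ e with y ≟ x | y ≟ root T | parent T y ≟ x
    ... | yes _ | _     | _     = refl
    ... | no _  | yes _ | _     = refl
    ... | no _  | no _  | yes _ = refl
    ... | no _  | no r  | no _  = e r

    fuel-irrelevant : ∀ f f′ x y → depth T y < f → depth T y < f′ → branch-fuel f x y ≡ branch-fuel f′ x y
    fuel-irrelevant (suc f) (suc f′) x y (s≤s p) (s≤s q) = branch-step-cong x y _ _ λ r →
      fuel-irrelevant f f′ x (parent T y) (<-≤-trans (parent-closer T y r) p) (<-≤-trans (parent-closer T y r) q)

  -- nothing is x itself, just nothing the branch containing the root, just (just c) the branch of the child c.
  branch : Node → Node → Maybe (Maybe Node)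
  branch x y = branch-fuel (suc (depth T y)) x y

  private
    unfold : ∀ x y → branch x y ≡ branch-step x y (branch x (parent T y))
    unfold x y = branch-step-cong x y _ _ λ r → fuel-irrelevant _ _ x (parent T y) (parent-closer T y r) (n<1+n _)

  branch-parent : ∀ x y → y ≢ x → y ≢ root T → parent T y ≢ x → branch x y ≡ branch x (parent T y)
  branch-parent x y y≢x y≢r p≢x = trans (unfold x y) (eval (branch x (parent T y)))
    where
    eval : ∀ b → branch-step x y b ≡ b
    eval b with y ≟ x | y ≟ root T | parent T y ≟ x
    ... | yes e | _     | _     = ⊥-elim (y≢x e)
    ... | no _  | yes e | _     = ⊥-elim (y≢r e)
    ... | no _  | no _  | yes e = ⊥-elim (p≢x e)
    ... | no _  | no _  | no _  = refl

  branch-adj : ∀ x {y y′} → y ≢ x → y′ ≢ x → TreeAdj T y y′ → branch x y ≡ branch x y′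
  branch-adj x y≢x y′≢x (inj₁ (y≢r , refl)) = branch-parent x _ y≢x y≢r y′≢x
  branch-adj x y≢x y′≢x (inj₂ (y′≢r , refl)) = sym (branch-parent x _ y′≢x y′≢r y≢x)

  tree-induction : (P : Node → Set) → (∀ y → (y ≢ root T → P (parent T y)) → P y) → ∀ y → P y
  tree-induction P ih y = go′ (suc (depth T y)) y (n<1+n _)
    where
    go′ : ∀ f y → depth T y < f → P y
    go′ (suc f) y (s≤s p) = ih y λ r → go′ f (parent T y) (<-≤-trans (parent-closer T y r) p)

  branch-nothing : ∀ x y → branch x y ≡ nothing → y ≡ x
  branch-nothing x = tree-induction _ λ y ih e → case-step y ih (trans (sym (unfold x y)) e)
    where
    case-step : ∀ y → (y ≢ root T → branch x (parent T y) ≡ nothing → parent T y ≡ x) →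
                branch-step x y (branch x (parent T y)) ≡ nothing → y ≡ x
    case-step y ih e with y ≟ x | y ≟ root T | parent T y ≟ x
    ... | yes e′ | _     | _     = e′
    ... | no _   | no r  | no p  = ⊥-elim (p (ih r e))

  branch-child : ∀ x c y → branch x y ≡ just (just c) → c ≢ root T × parent T c ≡ x
  branch-child x c = tree-induction _ λ y ih e → case-step y ih (trans (sym (unfold x y)) e)
    where
    case-step : ∀ y → (y ≢ root T → branch x (parent T y) ≡ just (just c) → c ≢ root T × parent T c ≡ x) →
                branch-step x y (branch x (parent T y)) ≡ just (just c) → c ≢ root T × parent T c ≡ x
    case-step y ih e with y ≟ x | y ≟ root T | parent T y ≟ x
    case-step y ih refl | no _ | no r | yes p = r , p
    case-step y ih e    | no _ | no r | no _  = ih r e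

  -- The climb from `y` passes `c` just before `x`, so it meets `c` before it can reach the root.
  branch-descend : ∀ x c y → branch x y ≡ just (just c) → branch c y ≢ just nothing
  branch-descend x c = tree-induction _ λ y ih e e′ → case-step y ih (trans (sym (unfold x y)) e) (trans (sym (unfold c y)) e′)
    where
    case-step : ∀ y → (y ≢ root T → branch x (parent T y) ≡ just (just c) → branch c (parent T y) ≢ just nothing) →
                branch-step x y (branch x (parent T y)) ≡ just (just c) → branch-step c y (branch c (parent T y)) ≢ just nothing
    case-step y ih e e′ with y ≟ x | y ≟ root T | parent T y ≟ x
    case-step y ih refl e′ | no _ | no r | yes p with y ≟ y
    case-step y ih refl () | no _ | no r | yes p | yes _
    ... | no ¬e = ¬e refl
    case-step y ih e e′ | no _ | no r | no _ with y ≟ c | parent T y ≟ c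
    case-step y ih e e′ | no _ | no r | no _ | no _ | no _ = ih r e e′

  branch-root : ∀ y → branch (root T) y ≢ just nothing
  branch-root = tree-induction _ λ y ih e → case-step y ih (trans (sym (unfold (root T) y)) e)
    where
    case-step : ∀ y → (y ≢ root T → branch (root T) (parent T y) ≢ just nothing) →
                branch-step (root T) y (branch (root T) (parent T y)) ≢ just nothing
    case-step y ih e with y ≟ root T | parent T y ≟ root T
    ... | no r | no _ = ih r e

  module NoBalance {A : Set} (home : A → Maybe Node) {h : ℕ} (π : Cube A (suc h)) (B : ℕ) where

    colour : Node → A → Maybe (Maybe Node)
    colour x a with home a
    ... | nothing = nothing
    ... | just y  = branch x y

    colour-home : ∀ x {a y} → home a ≡ just y → colour x a ≡ branch x y
    colour-home x {a} e rewrite e = refl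

    colour-nothing : ∀ x {a} → colour x a ≡ nothing → home a ≡ nothing ⊎ home a ≡ just x
    colour-nothing x {a} e with home a
    ... | nothing = inj₁ refl
    ... | just y  = inj₂ (cong just (branch-nothing x y e))

    _≟ᶜ_ : (c c′ : Maybe (Maybe Node)) → Dec (c ≡ c′)
    _≟ᶜ_ = ≡-decᵐ (≡-decᵐ _≟_)

    module C (x : Node) = Colouring _≟ᶜ_ (colour x)

    length-leaves : ∀ {h} (π : Cube A h) → ∑ (leaves π) (λ _ → 1) ≡ 2 ^ h
    length-leaves (leaf _)   = refl
    length-leaves {suc h} (node l r) = trans (∑-++ (leaves l) (leaves r) _)
      (cong₂ _+_ (length-leaves l) (trans (length-leaves r) (sym (+-identityʳ (2 ^ h)))))

    -- Orienting every node towards its dominant branch gives an endless descent.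
    impossible : 3 * B < 2 ^ suc h →
      (∀ x → ∑ (edges π) (⟦_⟧ ∘ C.bichromatic x) ≤ B) →
      (∀ x → ∑ (edges π) (⟦_⟧ ∘ C.touching x nothing) ≤ B) → ⊥
    impossible 3B< bi≤ touch≤ = descend (suc deepest) (root T)
        (≤-trans (≤-reflexive (trans (∑-cong (leaves π) λ a → cong ⟦_⟧ (⌊⌋-false (colour (root T) a ≟ᶜ just nothing) (root-colour a))) (∑-zero (leaves π)))) z≤n)
        (m≤n+m (suc deepest) (depth T (root T)))
      where
      open ≤-Reasoning
      deepest : ℕ
      deepest = ∑ (allFin (nodes T)) (depth T)
      root-colour : ∀ a → colour (root T) a ≢ just nothing
      root-colour a e with home a
      ... | just y = branch-root y e
      -- Invariant: at most `B` labels lie in the branch of the root at `x`. As 3B is too small, the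
      -- dominant branch is neither `x` itself nor that of the root, hence that of a child `c`; all
      -- but `B` labels are below `c`, which restores the invariant one level deeper, and `deepest`
      -- bounds all depths.
      descend : ∀ f x → C.count x (just nothing) π ≤ B → suc deepest ≤ depth T x + f → ⊥
      next : ∀ f x → C.count x (just nothing) π ≤ B → suc deepest ≤ depth T x + suc f →
             ∀ c → 2 ^ suc h ≤ ∑ (edges π) (⟦_⟧ ∘ C.bichromatic x) + C.count x c π → ⊥
      descend zero x inv deep = <⇒≱ deep (≤-trans (≤-reflexive (+-identityʳ (depth T x))) (∑-∈ (allFin (nodes T)) (depth T) (∈-allFin x)))
      descend (suc f) x inv deep = let c , dom = C.dominant-colour x π in next f x inv deep c dom
      next f x inv deep nothing dom = <⇒≱ 3B< (begin
        2 ^ suc h                                                       ≤⟨ dom ⟩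
        ∑ (edges π) (⟦_⟧ ∘ C.bichromatic x) + C.count x nothing π       ≤⟨ +-mono-≤ (bi≤ x) (≤-trans (C.count≤touching x nothing π) (*-monoʳ-≤ 2 (touch≤ x))) ⟩
        3 * B                                                           ∎)
      next f x inv deep (just nothing) dom = <⇒≱ 3B< (begin
        2 ^ suc h                                                       ≤⟨ dom ⟩
        ∑ (edges π) (⟦_⟧ ∘ C.bichromatic x) + C.count x (just nothing) π ≤⟨ +-mono-≤ (bi≤ x) (≤-trans inv (m≤m+n B (B + 0))) ⟩
        3 * B                                                           ∎)
      next f x inv deep (just (just c)) dom = by-cases (∑ (leaves π) (λ a → ⟦ C.coloured x (just (just c)) a ⟧) ≟ⁿ 0)
        where
        big : 2 ^ suc h ≤ B + C.count x (just (just c)) π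
        big = ≤-trans dom (+-monoˡ-≤ (C.count x (just (just c)) π) (bi≤ x))
        disjoint : ∀ a → ⟦ C.coloured c (just nothing) a ⟧ + ⟦ C.coloured x (just (just c)) a ⟧ ≤ 1
        disjoint a with colour x a ≟ᶜ just (just c) | colour c a ≟ᶜ just nothing
        ... | no _  | no _  = z≤n
        ... | no _  | yes _ = ≤-refl
        ... | yes _ | no _  = ≤-refl
        ... | yes e | yes e′ = ⊥-elim (clash e e′)
          where
          clash : colour x a ≡ just (just c) → colour c a ≡ just nothing → ⊥
          clash e e′ with home a
          ... | just y = branch-descend x c y e e′
        inv′ : C.count c (just nothing) π ≤ B
        inv′ = +-cancelʳ-≤ (C.count x (just (just c)) π) _ _ (begin
          C.count c (just nothing) π + C.count x (just (just c)) π  ≡⟨ sym (∑-+ (leaves π) _ _) ⟩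
          ∑ (leaves π) (λ a → ⟦ C.coloured c (just nothing) a ⟧ + ⟦ C.coloured x (just (just c)) a ⟧) ≤⟨ ∑-mono (leaves π) disjoint ⟩
          ∑ (leaves π) (λ _ → 1)                                    ≡⟨ length-leaves π ⟩
          2 ^ suc h                                                 ≤⟨ big ⟩
          B + C.count x (just (just c)) π                           ∎)
        continue : ∀ a → colour x a ≡ just (just c) → ⊥
        continue a e with home a
        ... | just y = let c≢r , p = branch-child x c y e in
          descend f c inv′ (≤-trans deep (≤-trans (≤-reflexive (+-suc (depth T x) f))
            (+-monoˡ-≤ f (≤-trans (≤-reflexive (cong (suc ∘ depth T) (sym p))) (parent-closer T c c≢r)))))
        by-cases : Dec (C.count x (just (just c)) π ≡ 0) → ⊥
        by-cases (yes e) = <⇒≱ 3B< (≤-trans big (≤-trans (≤-reflexive (trans (cong (B +_) e) (+-identityʳ B))) (m≤m+n B (2 * B))))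
        by-cases (no ne) with ∑-pigeonhole-< (leaves π) (λ _ → 0) (λ a → ⟦ C.coloured x (just (just c)) a ⟧) (≤-<-trans (≤-reflexive (∑-zero (leaves π))) (n≢0⇒n>0 ne))
        ... | a , _ , lt with colour x a ≟ᶜ just (just c)
        ...   | yes e = continue a e

-- Induced subgraphs

module Induced (G : Graph) (P : V G → Bool) where

  open import Data.List using () renaming (lookup to lookupₗ; filter to filterₗ)
  open import Data.List.Relation.Unary.Unique.Propositional using (Unique; _∷_)
  open import Data.List.Relation.Unary.Unique.Propositional.Properties using (allFin⁺; filter⁺)
  open import Data.List.Relation.Unary.All using () renaming (lookup to lookupᵃ)
  open import Data.List.Membership.Propositional.Properties using (∈-lookup; ∈-filter⁺)
  open import Data.List.Relation.Unary.Any using (index)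
  open import Data.List.Relation.Unary.Any.Properties using (lookup-index)

  lookup-injective : {A : Set} {l : List A} → Unique l → ∀ i j → lookupₗ l i ≡ lookupₗ l j → i ≡ j
  lookup-injective (_ ∷ _)  zero    zero    e = refl
  lookup-injective (x ∷ _)  zero    (suc j) e = ⊥-elim (lookupᵃ x (∈-lookup j) e)
  lookup-injective (x ∷ _)  (suc i) zero    e = ⊥-elim (lookupᵃ x (∈-lookup i) (sym e))
  lookup-injective (_ ∷ u)  (suc i) (suc j) e = cong suc (lookup-injective u i j e)

  ∑-lookup : {A : Set} (l : List A) (f : A → ℕ) → ∑ (allFin (length l)) (f ∘ lookupₗ l) ≡ ∑ l f
  ∑-lookup []      f = refl
  ∑-lookup (x ∷ l) f = trans (allFin-suc {length l} (f ∘ lookupₗ (x ∷ l))) (cong (f x +_) (∑-lookup l f))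

  verticesP : List (V G)
  verticesP = filterₗ (λ v → P v ≟ᵇ true) (allFin (size G))

  ∑-verticesP : ∀ f → ∑ verticesP f ≡ ∑ (allFin (size G)) (λ v → ⟦ P v ⟧ * f v)
  ∑-verticesP f = on (allFin (size G))
    where
    on : ∀ l → ∑ (filterₗ (λ v → P v ≟ᵇ true) l) f ≡ ∑ l (λ v → ⟦ P v ⟧ * f v)
    on [] = refl
    on (v ∷ l) with P v ≟ᵇ true
    ... | yes e rewrite e = cong₂ _+_ (sym (+-identityʳ (f v))) (on l)
    ... | no ¬e rewrite ≢true⇒false ¬e = on l

  H : Graph
  H = record
    { size    = length verticesP
    ; adj     = λ i j → adj G (lookupₗ verticesP i) (lookupₗ verticesP j)
    ; adj-sym = λ i j → adj-sym G _ _
    ; adj-irr = λ i → adj-irr G _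
    }

  ι : V H → V G
  ι = lookupₗ verticesP

  ι-injective : ∀ i j → ι i ≡ ι j → i ≡ j
  ι-injective = lookup-injective (filter⁺ (λ v → P v ≟ᵇ true) (allFin⁺ (size G)))

  ι-surjective : ∀ v → P v ≡ true → ∃ λ i → ι i ≡ v
  ι-surjective v e = index v∈ , sym (lookup-index v∈)
    where
    v∈ : v ∈ₗ verticesP
    v∈ = ∈-filter⁺ (λ v → P v ≟ᵇ true) (∈-allFin v) e

  ι-P : ∀ i → P (ι i) ≡ true
  ι-P i = proj₂ (∈-filter⁻ (λ v → P v ≟ᵇ true) {xs = allFin (size G)} (∈-lookup i))
    where open import Data.List.Membership.Propositional.Properties using (∈-filter⁻)

  induced : InducedSubgraphOf H G
  induced = ι , (λ {i} {j} → ι-injective i j) , λ _ _ → refl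

  maxDegree≤ : ∀ Δ → (∀ v → P v ≡ true → # (λ u → P u ∧ adj G v u) ≤ Δ) → maxDegree H ≤ Δ
  maxDegree≤ Δ bound = all≤ (allFin (size H))
    where
    degree≤ : ∀ i → degree H i ≤ Δ
    degree≤ i = ≤-trans (≤-reflexive (trans (∣tabulate∣ (adj H i)) (trans (∑-lookup verticesP (λ v → ⟦ adj G (ι i) v ⟧))
        (trans (∑-verticesP _) (∑-cong (allFin (size G)) λ v → product (P v) (adj G (ι i) v)))))) (bound (ι i) (ι-P i))
      where
      product : ∀ a b → ⟦ a ⟧ * ⟦ b ⟧ ≡ ⟦ a ∧ b ⟧
      product true  b = *-identityˡ ⟦ b ⟧
      product false b = refl
    all≤ : ∀ l → foldr _⊔_ 0 (map (degree H) l) ≤ Δ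
    all≤ []      = z≤n
    all≤ (i ∷ l) = ⊔-lub (degree≤ i) (all≤ l)

-- A tree decomposition of the subgraph induced on `P`, expressed in vertices of `G`, so that walks
-- of `G` need not be transported along the embedding `ι`.
record SubsetDecomposition (G : Graph) (P : V G → Bool) (t : ℕ) : Set where
  field
    T         : RootedTree
    contains  : Fin (nodes T) → V G → Bool
    covered   : ∀ v → P v ≡ true → ∃ λ x → contains x v ≡ true
    covered₂  : ∀ u v → P u ≡ true → P v ≡ true → Adj G u v → ∃ λ x → contains x u ≡ true × contains x v ≡ true
    connected : ∀ v x y → contains x v ≡ true → contains y v ≡ true → PathWithin T (λ z → contains z v ≡ true) x y
    small     : ∀ x → # (contains x) ≤ suc t

module _ {G : Graph} {P : V G → Bool} where

  open Induced G P

  subset-decomposition : ∀ {s t} → s ≤ t → TreewidthAtMost H s → SubsetDecomposition G P t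
  subset-decomposition {s} {t} s≤t (D , bag≤) = record
    { T         = tree D
    ; contains  = contains
    ; covered   = λ v Pv → let i , e = ι-surjective v Pv ; x , i∈ = vertex-cover D i in x , intro e i∈
    ; covered₂  = λ u v Pu Pv a → let i , e = ι-surjective u Pu ; j , e′ = ι-surjective v Pv
                                      x , i∈ , j∈ = edge-cover D i j (trans (cong₂ (adj G) e e′) a)
                                  in x , intro e i∈ , intro e′ j∈
    ; connected = λ v x y p q → connect v x y (elim p) (elim q)
    ; small     = λ x → ≤-trans (few x) (≤-trans (bag≤ x) (s≤s s≤t))
    }
    where
    contains : Fin (nodes (tree D)) → V G → Bool
    contains x v = ⌊ any? (λ i → (ι i ≟ v) ×-dec (i ∈? bag D x)) ⌋
    intro : ∀ {x v i} → ι i ≡ v → i ∈ bag D x → contains x v ≡ true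
    intro {x} {v} e i∈ = ⌊⌋-true (any? (λ i → (ι i ≟ v) ×-dec (i ∈? bag D x))) (_ , e , i∈)
    elim : ∀ {x v} → contains x v ≡ true → ∃ λ i → ι i ≡ v × i ∈ bag D x
    elim {x} {v} = ⌊⌋-true⁻ {P? = any? (λ i → (ι i ≟ v) ×-dec (i ∈? bag D x))}
    connect : ∀ v x y → (∃ λ i → ι i ≡ v × i ∈ bag D x) → (∃ λ i → ι i ≡ v × i ∈ bag D y) →
              PathWithin (tree D) (λ z → contains z v ≡ true) x y
    connect v x y (i , refl , i∈) (j , e , j∈) = lift (bag-connected D i x y i∈ (subst (_∈ bag D y) (ι-injective j i e) j∈))
      where
      lift : ∀ {x y} → PathWithin (tree D) (λ z → i ∈ bag D z) x y → PathWithin (tree D) (λ z → contains z (ι i) ≡ true) x y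
      lift (here p)     = here (intro refl p)
      lift (step p a w) = step (intro refl p) a (lift w)
    few : ∀ x → # (contains x) ≤ ∣ bag D x ∣
    few x = begin
      # (contains x)                                                          ≤⟨ ∑-mono (allFin (size G)) pointwise ⟩
      ∑ (allFin (size G)) (λ v → ∑ (allFin (size H)) (λ i → ⟦ lookup (bag D x) i ⟧ * ⟦ ⌊ v ≟ ι i ⌋ ⟧)) ≡⟨ ∑-swap (allFin (size G)) (allFin (size H)) _ ⟩
      ∑ (allFin (size H)) (λ i → ∑ (allFin (size G)) (λ v → ⟦ lookup (bag D x) i ⟧ * ⟦ ⌊ v ≟ ι i ⌋ ⟧)) ≡⟨ ∑-cong (allFin (size H)) (λ i →
          trans (∑-*ˡ (allFin (size G)) ⟦ lookup (bag D x) i ⟧ _) (trans (cong (⟦ lookup (bag D x) i ⟧ *_) (#-singleton (ι i))) (*-identityʳ _))) ⟩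
      # (lookup (bag D x))                                                    ≡⟨ sym ∣ bag D x ∣-lookup ⟩
      ∣ bag D x ∣                                                             ∎
      where
      open ≤-Reasoning
      hit-term : ∀ {v i} → ι i ≡ v → i ∈ bag D x → 1 ≤ ⟦ lookup (bag D x) i ⟧ * ⟦ ⌊ v ≟ ι i ⌋ ⟧
      hit-term {v} {i} e i∈ = ≤-reflexive (sym (cong₂ (λ a b → ⟦ a ⟧ * ⟦ b ⟧) ([]=⇒lookup i∈) (⌊⌋-true (v ≟ ι i) (sym e))))
      pointwise : ∀ v → ⟦ contains x v ⟧ ≤ ∑ (allFin (size H)) (λ i → ⟦ lookup (bag D x) i ⟧ * ⟦ ⌊ v ≟ ι i ⌋ ⟧)
      pointwise v with true⊎false (contains x v)
      ... | inj₂ e rewrite e = z≤n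
      ... | inj₁ e with elim {x} {v} e
      ...   | i , e₁ , i∈ = ≤-trans (⟦⟧≤1 (contains x v)) (≤-trans (hit-term e₁ i∈)
                (∑-∈ (allFin (size H)) (λ i → ⟦ lookup (bag D x) i ⟧ * ⟦ ⌊ v ≟ ι i ⌋ ⟧) (∈-allFin i)))

-- Walks that avoid a bag stay in one branch

module SubsetBranches {G : Graph} {P : V G → Bool} {t : ℕ} (S : SubsetDecomposition G P t) where

  open SubsetDecomposition S public
  open Branches T public

  -- The nodes whose bags contain `v` form a subtree; if it misses `x`, it cannot leave a branch at
  -- `x`.
  path-branch : ∀ x v {y y′} → contains x v ≡ false → PathWithin T (λ z → contains z v ≡ true) y y′ → branch x y ≡ branch x y′
  path-branch x v v∉ (here _) = refl
  path-branch x v v∉ (step {y} {y′} p a w) =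
    trans (branch-adj x (avoids p) (avoids (start w)) a) (path-branch x v v∉ w)
    where
    avoids : ∀ {y} → contains y v ≡ true → y ≢ x
    avoids p refl = true≢false p v∉
    start : ∀ {y y′} → PathWithin T (λ z → contains z v ≡ true) y y′ → contains y v ≡ true
    start (here p)     = p
    start (step p _ _) = p

  -- Ends of failed routes may lie outside `P`; they have no home, and their edges are charged to
  -- the failures.
  homeAt : V G → Maybe Node
  homeAt v with P v ≟ᵇ true
  ... | yes e = just (proj₁ (covered v e))
  ... | no _  = nothing

  homeAt-just : ∀ v {y} → homeAt v ≡ just y → contains y v ≡ true
  homeAt-just v e with P v ≟ᵇ true
  homeAt-just v refl | yes p = proj₂ (covered v p)

  homeAt-P : ∀ v → P v ≡ true → ∃ λ y → homeAt v ≡ just y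
  homeAt-P v p with P v ≟ᵇ true
  ... | yes e = _ , refl
  ... | no ¬p = ⊥-elim (¬p p)

  open Walks (adj G) (adj-sym G)

  -- Adjacent vertices share a bag, which links the subtree of each vertex of the walk to the next,
  -- all of them missing `x`.
  walk-branch : ∀ {Q m a b} x (w : Walk Q m a b) → (∀ {v} → v ∈ₗ verts w → P v ≡ true) → (∀ {v} → v ∈ₗ verts w → contains x v ≡ false) →
                ∀ {y y′} → contains y a ≡ true → contains y′ b ≡ true → branch x y ≡ branch x y′
  walk-branch x (stop {a} _) inP out p q = path-branch x a (out (here refl)) (connected a _ _ p q)
  walk-branch x (go {a = a} {b} _ e w) inP out p q =
    let z , za , zb = covered₂ a b (inP (here refl)) (inP (there (start∈verts w))) e
    in trans (path-branch x a (out (here refl)) (connected a _ _ p za)) (walk-branch x w (inP ∘ there) (out ∘ there) zb q)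

-- Balanced separators consisting of few members

_∈ₗ?_ : ∀ {n} (v : Fin n) (l : List (Fin n)) → Dec (v ∈ₗ l)
_∈ₗ?_ = _∈?′_
  where open import Data.List.Membership.DecPropositional _≟_ using () renaming (_∈?_ to _∈?′_)

#-list : ∀ {n} (l : List (Fin n)) (Q : Fin n → Bool) → # (λ w → ⌊ w ∈ₗ? l ⌋ ∧ Q w) ≤ ∑ l (⟦_⟧ ∘ Q)
#-list {n} [] Q = ≤-reflexive (∑-zero (allFin n))
#-list {n} (x ∷ l) Q = begin
  # (λ w → ⌊ w ∈ₗ? (x ∷ l) ⌋ ∧ Q w)                      ≤⟨ ∑-mono (allFin n) pointwise ⟩
  ∑ (allFin n) (λ w → ⟦ Q x ⟧ * ⟦ ⌊ w ≟ x ⌋ ⟧ + ⟦ ⌊ w ∈ₗ? l ⌋ ∧ Q w ⟧) ≡⟨ ∑-+ (allFin n) _ _ ⟩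
  ∑ (allFin n) (λ w → ⟦ Q x ⟧ * ⟦ ⌊ w ≟ x ⌋ ⟧) + # (λ w → ⌊ w ∈ₗ? l ⌋ ∧ Q w) ≤⟨ +-mono-≤ (≤-reflexive single) (#-list l Q) ⟩
  ⟦ Q x ⟧ + ∑ l (⟦_⟧ ∘ Q)                                ∎
  where
  open ≤-Reasoning
  single : ∑ (allFin n) (λ w → ⟦ Q x ⟧ * ⟦ ⌊ w ≟ x ⌋ ⟧) ≡ ⟦ Q x ⟧
  single = trans (∑-*ˡ (allFin n) ⟦ Q x ⟧ _) (trans (cong (⟦ Q x ⟧ *_) (#-singleton x)) (*-identityʳ _))
  pointwise : ∀ w → ⟦ ⌊ w ∈ₗ? (x ∷ l) ⌋ ∧ Q w ⟧ ≤ ⟦ Q x ⟧ * ⟦ ⌊ w ≟ x ⌋ ⟧ + ⟦ ⌊ w ∈ₗ? l ⌋ ∧ Q w ⟧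
  pointwise w = cases (true⊎false (⌊ w ∈ₗ? (x ∷ l) ⌋ ∧ Q w))
    where
    found : Bool
    found = ⌊ w ∈ₗ? (x ∷ l) ⌋ ∧ Q w
    cases : found ≡ true ⊎ found ≡ false → ⟦ found ⟧ ≤ ⟦ Q x ⟧ * ⟦ ⌊ w ≟ x ⌋ ⟧ + ⟦ ⌊ w ∈ₗ? l ⌋ ∧ Q w ⟧
    cases (inj₂ e) = ≤-trans (≤-reflexive (cong ⟦_⟧ e)) z≤n
    cases (inj₁ e) = ≤-trans (⟦⟧≤1 found) (member (⌊⌋-true⁻ {P? = w ∈ₗ? (x ∷ l)} (∧-trueˡ {⌊ w ∈ₗ? (x ∷ l) ⌋} e)) (∧-trueʳ {⌊ w ∈ₗ? (x ∷ l) ⌋} e))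
      where
      member : w ∈ₗ (x ∷ l) → Q w ≡ true → 1 ≤ ⟦ Q x ⟧ * ⟦ ⌊ w ≟ x ⌋ ⟧ + ⟦ ⌊ w ∈ₗ? l ⌋ ∧ Q w ⟧
      member (here refl) q rewrite q | ⌊⌋-true (w ≟ w) refl = s≤s z≤n
      member (there w∈) q rewrite q | ⌊⌋-true (w ∈ₗ? l) w∈ = m≤n+m 1 _

module Separator
  (G : Graph) (hit : V G → V G → Bool) {k : ℕ} (axioms : SetSystem.Axioms (adj G) (adj-sym G) hit k) (c d : ℕ)
  (witness : ∀ u v → hit v u ≡ true → ∃ λ S → # S ≤ 4 * d × (∀ w → Adj G v w → hit w u ≡ false → S w ≡ true))
  (treewidth : ∀ P Δ → (∀ v → P v ≡ true → # (λ u → P u ∧ adj G v u) ≤ Δ) → SubsetDecomposition G P (Δ ^ c))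
  (h ℓ μ : ℕ) (μ>0 : 0 < μ) (ℓ≥1 : 1 ≤ ℓ) (n<2^ℓ : size G < 2 ^ ℓ) (size≤ : 2 ^ h ≤ 2 * μ * ℓ) (h< : 2 * suc h ≤ 2 ^ ℓ)
  (large : 12 * (suc ((4 * d + suc h * (4 * ℓ) * suc (k + k)) ^ c) * (suc h * (4 * ℓ))) < 2 ^ suc h)
  (X : V G → Bool) (x⋆ : V G) (x⋆∈X : X x⋆ ≡ true) (x⋆-center : hit x⋆ x⋆ ≡ true) where

  -- `γ` bounds the paths meeting a member: 4ℓ in each of `suc h` directions. `Δ` adds, to the 4d
  -- neighbours outside a member, 2k + 1 vertices in it from each of these paths. `σ` makes a member
  -- carry at most 1/(2μ) of the routes, and `g` lets at most 1/(4(h+1)) of them fail.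
  n γ Δ σ g : ℕ
  n = size G
  γ = suc h * (4 * ℓ)
  Δ = 4 * d + γ * suc (k + k)
  σ = 2 * (6 * μ)
  g = 8 * suc h

  σ>0 : 0 < σ
  σ>0 = *-pos (s≤s (z≤n {1})) (*-pos (s≤s (z≤n {5})) μ>0)

  open Play (adj G) (adj-sym G) hit axioms X σ ℓ g σ>0 ℓ≥1 n<2^ℓ x⋆ x⋆-center

  elements>0 : 0 < length elements
  elements>0 = ≤-trans (#-pos {P = X} x⋆∈X) (≤-reflexive #X≡length)

  pairs>0 : 0 < pairs
  pairs>0 = *-pos elements>0 elements>0

  M : ℕ
  M = σ * ℓ

  module Contradiction (r : Rounds σ g M (λ _ → 1)) where

    -- A label carries a routing besides an element of `X`, and an edge uses the routing of its
    -- first end. A random labelling thus chooses a random pair and a random routing for every edge,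
    -- independently within one direction.
    Label : Set
    Label = V G × Routing

    rs : List Routing
    rs = routings r

    labels : List Label
    labels = cartesianProductWith _,_ elements rs

    open Averaging labels using (pair-sum; N; good-cube)

    hits : V G → Label × Label → Bool
    hits w ((x , R) , (y , _)) = through R x y w

    fails : Label × Label → Bool
    fails ((x , R) , (y , _)) = fail R x y

    N≡ : N ≡ length elements * M
    N≡ = trans (sym (*-identityʳ N)) (trans (sym (∑-const labels 1)) (trans (∑-product _,_ elements rs (λ _ → 1))
      (trans (∑-cong elements λ _ → trans (∑-const rs 1) (trans (*-identityʳ _) (length-routings r))) (∑-const elements M))))

    N*N≡ : N * N ≡ M * (M * pairs)
    N*N≡ = trans (cong₂ _*_ N≡ N≡) (e (length elements) M)
      where
      e : ∀ a b → a * b * (a * b) ≡ b * (b * (a * a))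
      e = solve-∀

    pair-sum-routing : ∀ (f : V G → V G → Routing → ℕ) →
      pair-sum (λ ((x , R) , (y , _)) → f x y R) ≡ M * ∑ rs (λ R → ∑ elements (λ x → ∑ elements (λ y → f x y R)))
    pair-sum-routing f = begin
      ∑ labels (λ α → ∑ labels (λ β → f (proj₁ α) (proj₁ β) (proj₂ α)))
        ≡⟨ ∑-cong labels (λ α → trans (∑-product _,_ elements rs _) (trans (∑-cong elements λ y → trans (∑-const rs _) (cong (_* f (proj₁ α) y (proj₂ α)) (length-routings r))) (∑-*ˡ elements M _))) ⟩
      ∑ labels (λ α → M * ∑ elements (λ y → f (proj₁ α) y (proj₂ α)))
        ≡⟨ trans (∑-*ˡ labels M _) (cong (M *_) (trans (∑-product _,_ elements rs _) (∑-swap elements rs _))) ⟩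
      M * ∑ rs (λ R → ∑ elements (λ x → ∑ elements (λ y → f x y R))) ∎
      where open ≡-Reasoning

    hits≤ : ∀ w → center w ≡ true → 2 * μ * pair-sum (⟦_⟧ ∘ hits w) ≤ N * N
    hits≤ w cw = begin
      2 * μ * pair-sum (⟦_⟧ ∘ hits w)                   ≡⟨ cong (2 * μ *_) (pair-sum-routing (λ x y R → ⟦ through R x y w ⟧)) ⟩
      2 * μ * (M * ∑ rs (λ R → congestion R w))         ≤⟨ *-monoʳ-≤ (2 * μ) (*-monoʳ-≤ M (congestion-bound (6 * μ) ℓ (*-pos (s≤s (z≤n {5})) μ>0) n<2^ℓ pairs>0 r w cw)) ⟩
      2 * μ * (M * (6 * ℓ * pairs))                     ≡⟨ e μ M ℓ pairs ⟩
      M * (2 * (6 * μ) * ℓ * pairs)                     ≡⟨ sym N*N≡ ⟩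
      N * N                                             ∎
      where
      open ≤-Reasoning
      e : ∀ μ M ℓ p → 2 * μ * (M * (6 * ℓ * p)) ≡ M * (2 * (6 * μ) * ℓ * p)
      e = solve-∀

    fails≤ : 4 * suc h * pair-sum (⟦_⟧ ∘ fails) ≤ N * N
    fails≤ = *-cancelˡ-≤ 2 (begin
      2 * (4 * suc h * pair-sum (⟦_⟧ ∘ fails))          ≡⟨ cong (λ x → 2 * (4 * suc h * x)) (pair-sum-routing (λ x y R → ⟦ fail R x y ⟧)) ⟩
      2 * (4 * suc h * (M * ∑ rs failures))             ≡⟨ e (suc h) M (∑ rs failures) ⟩
      M * (8 * suc h * ∑ rs failures)                   ≤⟨ *-monoʳ-≤ M (failures-routings r) ⟩
      M * (M * (2 * pairs))                             ≡⟨ e′ M pairs ⟩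
      2 * (M * (M * pairs))                             ≡⟨ cong (2 *_) (sym N*N≡) ⟩
      2 * (N * N)                                       ∎)
      where
      open ≤-Reasoning
      e : ∀ h M x → 2 * (4 * h * (M * x)) ≡ M * (8 * h * x)
      e = solve-∀
      e′ : ∀ M p → M * (M * (2 * p)) ≡ 2 * (M * (M * p))
      e′ = solve-∀

    n>0 : 0 < n
    n>0 = ≤-<-trans z≤n (toℕ<n x⋆)

    N>0 : 0 < N
    N>0 = ≤-trans (*-pos elements>0 (*-pos σ>0 ℓ≥1)) (≤-reflexive (sym N≡))

    cube : ∃ λ (π : Cube Label (suc h)) → 4 * ∑ (edges π) (⟦_⟧ ∘ fails) ≤ 2 ^ suc h ×
             (∀ w → center w ≡ true → ∑ (edges π) (⟦_⟧ ∘ hits w) ≤ γ)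
    cube = good-cube center hits fails h ℓ μ μ>0 N>0 size≤ n<2^ℓ n>0 h< hits≤ fails≤

    module OnCube (π : Cube Label (suc h)) (few-fails : 4 * ∑ (edges π) (⟦_⟧ ∘ fails) ≤ 2 ^ suc h)
                  (load : ∀ w → center w ≡ true → ∑ (edges π) (⟦_⟧ ∘ hits w) ≤ γ) where

      route-vertices : ∀ R x y → fail R x y ≡ true ⊎ fail R x y ≡ false → List (V G)
      route-vertices R x y (inj₁ _)  = []
      route-vertices R x y (inj₂ ok) = verts (proj₁ (proj₂ (shortest (route R x y ok))))

      opaque
        path : Label × Label → List (V G)
        path ((x , R) , (y , _)) = route-vertices R x y (true⊎false (fail R x y))

        path-inside : ∀ e {v} → v ∈ₗ path e → inside hit (λ w → hits w e) v ≡ true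
        path-inside ((x , R) , (y , _)) {v} = on (true⊎false (fail R x y))
          where
          on : ∀ t → v ∈ₗ route-vertices R x y t → inside hit (through R x y) v ≡ true
          on (inj₂ ok) v∈ = verts-P (proj₁ (proj₂ (shortest (route R x y ok)))) v∈

        path-visits : ∀ e u → ∑ (path e) (λ v → ⟦ hit v u ⟧) ≤ suc (k + k)
        path-visits ((x , R) , (y , _)) u = on (true⊎false (fail R x y))
          where
          close : ∀ p q → inside hit (through R x y) p ≡ true → inside hit (through R x y) q ≡ true → hit p u ≡ true → hit q u ≡ true →
                  ∃ λ j → j ≤ k + k × Walk (inside hit (through R x y)) j p q
          close p q p-in q-in hp hq =
            let m , m≤ , w = up p u hp ; m′ , m′≤ , w′ = up q u hq
            -- Both climbs end at `u` and stay within the allowed members, because all members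
            -- through `p` and `q` are allowed.
            in m + m′ , +-mono-≤ m≤ m′≤ , append (walk-mono (inside-mono (inside-⊆ p-in)) w) (reverse (walk-mono (inside-mono (inside-⊆ q-in)) w′))
          on : ∀ t → ∑ (route-vertices R x y t) (λ v → ⟦ hit v u ⟧) ≤ suc (k + k)
          on (inj₁ _)  = z≤n
          on (inj₂ ok) = let _ , w , min = shortest (route R x y ok)
                         in visits≤ (inside hit (through R x y)) (λ v → hit v u) (k + k) close w min

        path-walk : ∀ x R y R′ → fail R x y ≡ false →
          ∃ λ m → Σ (Walk (inside hit (through R x y)) m x y) λ w → ∀ {v} → v ∈ₗ verts w → v ∈ₗ path ((x , R) , (y , R′))
        path-walk x R y R′ ok = on (true⊎false (fail R x y))
          where
          on : ∀ t → ∃ λ m → Σ (Walk (inside hit (through R x y)) m x y) λ w → ∀ {v} → v ∈ₗ verts w → v ∈ₗ route-vertices R x y t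
          on (inj₁ f)   = ⊥-elim (true≢false f ok)
          on (inj₂ ok′) = let _ , w , _ = shortest (route R x y ok′) in _ , w , λ v∈ → v∈

      onPath : V G → Label × Label → Bool
      onPath v e = ⌊ v ∈ₗ? path e ⌋

      onPath⁻ : ∀ {v e} → onPath v e ≡ true → v ∈ₗ path e
      onPath⁻ {v} {e} = ⌊⌋-true⁻ {P? = v ∈ₗ? path e}

      onPath⁺ : ∀ {v e} → v ∈ₗ path e → onPath v e ≡ true
      onPath⁺ {v} {e} = ⌊⌋-true (v ∈ₗ? path e)

      used : V G → Bool
      used v = ⌊ 0 <?ⁿ ∑ (edges π) (⟦_⟧ ∘ onPath v) ⌋

      used-intro : ∀ {v e} → e ∈ₗ edges π → v ∈ₗ path e → used v ≡ true
      used-intro {v} {e} e∈ v∈ = ⌊⌋-true (0 <?ⁿ ∑ (edges π) (⟦_⟧ ∘ onPath v))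
        (≤-trans (≤-reflexive (cong ⟦_⟧ (sym (onPath⁺ v∈)))) (∑-∈ (edges π) (⟦_⟧ ∘ onPath v) e∈))

      used-hit : ∀ v → used v ≡ true → ∃ λ u → hit v u ≡ true
      used-hit v e = from-edge (∑-pigeonhole-< (edges π) (λ _ → 0) (⟦_⟧ ∘ onPath v)
          (≤-<-trans (≤-reflexive (∑-zero (edges π))) (⌊⌋-true⁻ {P? = 0 <?ⁿ ∑ (edges π) (⟦_⟧ ∘ onPath v)} e)))
        where
        from-edge : (∃ λ e′ → e′ ∈ₗ edges π × 0 < ⟦ onPath v e′ ⟧) → ∃ λ u → hit v u ≡ true
        from-edge (e′ , _ , lt) = inside-hit (path-inside e′ (onPath⁻ {v} {e′} (≢false⇒true λ f → <⇒≱ lt (≤-reflexive (cong ⟦_⟧ f)))))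

      onPath-hits : ∀ {v u} → hit v u ≡ true → ∀ e → onPath v e ≡ true → hits u e ≡ true
      onPath-hits {v} {u} hv e on = inside-⊆ (path-inside e (onPath⁻ {v} {e} on)) u hv

      paths-through : ∀ v → ∑ (edges π) (⟦_⟧ ∘ onPath v) ≤ γ
      paths-through v = by-cases (true⊎false (used v))
        where
        by-cases : used v ≡ true ⊎ used v ≡ false → ∑ (edges π) (⟦_⟧ ∘ onPath v) ≤ γ
        by-cases (inj₂ e) = ≤-trans (≮⇒≥ (⌊⌋-false⁻ {P? = 0 <?ⁿ ∑ (edges π) (⟦_⟧ ∘ onPath v)} e)) z≤n
        by-cases (inj₁ e) = let u , hv = used-hit v e in
          ≤-trans (∑-mono (edges π) λ e′ → ⟦⟧-mono (onPath-hits hv e′)) (load u (hit⇒center hv))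

      degree≤ : ∀ v → used v ≡ true → # (λ w → used w ∧ adj G v w) ≤ Δ
      degree≤ v uv = let u , hv = used-hit v uv ; S , S≤ , S-wit = witness u v hv in begin
        # (λ w → used w ∧ adj G v w)                       ≤⟨ #-mono {P = λ w → used w ∧ adj G v w} {S ∪ᵇ (λ w → used w ∧ hit w u)} (λ w e → split u S S-wit w e (true⊎false (hit w u))) ⟩
        # (S ∪ᵇ (λ w → used w ∧ hit w u))                  ≤⟨ #-∪ S (λ w → used w ∧ hit w u) ⟩
        # S + # (λ w → used w ∧ hit w u)                   ≤⟨ +-mono-≤ S≤ (member u (hit⇒center hv)) ⟩
        Δ                                                  ∎
        where
        open ≤-Reasoning
        split : ∀ u S → (∀ w → Adj G v w → hit w u ≡ false → S w ≡ true) → ∀ w → used w ∧ adj G v w ≡ true →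
                hit w u ≡ true ⊎ hit w u ≡ false → (S ∪ᵇ (λ w → used w ∧ hit w u)) w ≡ true
        split u S S-wit w e (inj₁ h) = ∨-trueʳ {S w} (∧-true (∧-trueˡ e) h)
        split u S S-wit w e (inj₂ h) = ∨-trueˡ (S-wit w (∧-trueʳ {used w} e) h)
        member : ∀ u → center u ≡ true → # (λ w → used w ∧ hit w u) ≤ γ * suc (k + k)
        member u cu = begin
          # (λ w → used w ∧ hit w u)                                       ≤⟨ ∑-mono (allFin n) (λ w → pointwise w (true⊎false (used w ∧ hit w u))) ⟩
          ∑ (allFin n) (λ w → ∑ (edges π) (λ e → ⟦ onPath w e ∧ hit w u ⟧)) ≡⟨ ∑-swap (allFin n) (edges π) _ ⟩
          ∑ (edges π) (λ e → # (λ w → onPath w e ∧ hit w u))               ≤⟨ ∑-mono (edges π) (λ e → per-edge e (true⊎false (hits u e))) ⟩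
          ∑ (edges π) (λ e → ⟦ hits u e ⟧ * suc (k + k))                   ≡⟨ ∑-*ʳ (edges π) (suc (k + k)) _ ⟩
          ∑ (edges π) (⟦_⟧ ∘ hits u) * suc (k + k)                         ≤⟨ *-monoˡ-≤ (suc (k + k)) (load u cu) ⟩
          γ * suc (k + k)                                                  ∎
          where
          pointwise : ∀ w → used w ∧ hit w u ≡ true ⊎ used w ∧ hit w u ≡ false → ⟦ used w ∧ hit w u ⟧ ≤ ∑ (edges π) (λ e → ⟦ onPath w e ∧ hit w u ⟧)
          pointwise w (inj₂ e) = ≤-trans (≤-reflexive (cong ⟦_⟧ e)) z≤n
          pointwise w (inj₁ e) = ≤-trans (⟦⟧≤1 _) (≤-trans (⌊⌋-true⁻ {P? = 0 <?ⁿ ∑ (edges π) (⟦_⟧ ∘ onPath w)} (∧-trueˡ {used w} e))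
            (∑-mono (edges π) λ e′ → ⟦⟧-mono λ on → ∧-true on (∧-trueʳ {used w} e)))
          per-edge : ∀ e → hits u e ≡ true ⊎ hits u e ≡ false → # (λ w → onPath w e ∧ hit w u) ≤ ⟦ hits u e ⟧ * suc (k + k)
          per-edge e (inj₁ he) = ≤-trans (#-list (path e) (λ w → hit w u)) (≤-trans (path-visits e u)
            (≤-reflexive (sym (trans (cong (λ b → ⟦ b ⟧ * suc (k + k)) he) (+-identityʳ _)))))
          per-edge e (inj₂ he) = ≤-trans (≤-reflexive (trans (∑-cong (allFin n) λ w → cong ⟦_⟧ (≢true⇒false λ e′ →
              true≢false (onPath-hits (∧-trueʳ {onPath w e} e′) e (∧-trueˡ e′)) he)) (∑-zero (allFin n)))) z≤n

      open SubsetBranches (treewidth used Δ degree≤)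

      -- Failed edges, plus those whose path meets a given bag: at most Δ^c + 1 vertices with at
      -- most γ paths each.
      B : ℕ
      B = ∑ (edges π) (⟦_⟧ ∘ fails) + suc (Δ ^ c) * γ

      home : Label → Maybe Node
      home (x , _) = homeAt x

      open NoBalance home π B

      -- Failures take at most a quarter of 2^(h+1) and, by `large`, a bag takes less than a
      -- twelfth; three times the sum stays below the whole.
      3B< : 3 * B < 2 ^ suc h
      3B< = *-cancelˡ-< 4 _ _ (begin-strict
        4 * (3 * B)                                                 ≡⟨ e (∑ (edges π) (⟦_⟧ ∘ fails)) (suc (Δ ^ c) * γ) ⟩
        3 * (4 * ∑ (edges π) (⟦_⟧ ∘ fails)) + 12 * (suc (Δ ^ c) * γ) <⟨ +-mono-≤-< (*-monoʳ-≤ 3 few-fails) large ⟩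
        3 * 2 ^ suc h + 2 ^ suc h                                   ≡⟨ e′ (2 ^ suc h) ⟩
        4 * 2 ^ suc h                                               ∎)
        where
        open ≤-Reasoning
        e : ∀ a b → 4 * (3 * (a + b)) ≡ 3 * (4 * a) + 12 * b
        e = solve-∀
        e′ : ∀ a → 3 * a + a ≡ 4 * a
        e′ = solve-∀

      blocked : Node → Label × Label → ℕ
      blocked x e = ∑ (allFin n) (λ v → ⟦ contains x v ⟧ * ⟦ onPath v e ⟧)

      blocked-intro : ∀ x e {v} → contains x v ≡ true → v ∈ₗ path e → 1 ≤ ⟦ fails e ⟧ + blocked x e
      blocked-intro x e {v} xv v∈ = ≤-trans (≤-trans (≤-reflexive (sym (cong₂ (λ a b → ⟦ a ⟧ * ⟦ b ⟧) xv (onPath⁺ {v} {e} v∈))))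
        (∑-∈ (allFin n) (λ v → ⟦ contains x v ⟧ * ⟦ onPath v e ⟧) (∈-allFin v))) (m≤n+m _ ⟦ fails e ⟧)

      total-blocked : ∀ x (f : Label × Label → Bool) → (∀ e → e ∈ₗ edges π → f e ≡ true → 1 ≤ ⟦ fails e ⟧ + blocked x e) →
                      ∑ (edges π) (⟦_⟧ ∘ f) ≤ B
      total-blocked x f h = begin
        ∑ (edges π) (⟦_⟧ ∘ f)                               ≤⟨ ∑-mono-∈ (edges π) (λ {e} e∈ → pointwise e e∈ (true⊎false (f e))) ⟩
        ∑ (edges π) (λ e → ⟦ fails e ⟧ + blocked x e)       ≡⟨ ∑-+ (edges π) _ _ ⟩
        ∑ (edges π) (⟦_⟧ ∘ fails) + ∑ (edges π) (blocked x) ≤⟨ +-monoʳ-≤ (∑ (edges π) (⟦_⟧ ∘ fails)) few ⟩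
        B                                                   ∎
        where
        open ≤-Reasoning
        pointwise : ∀ e → e ∈ₗ edges π → f e ≡ true ⊎ f e ≡ false → ⟦ f e ⟧ ≤ ⟦ fails e ⟧ + blocked x e
        pointwise e e∈ (inj₁ t) = ≤-trans (⟦⟧≤1 (f e)) (h e e∈ t)
        pointwise e e∈ (inj₂ t) = ≤-trans (≤-reflexive (cong ⟦_⟧ t)) z≤n
        few : ∑ (edges π) (blocked x) ≤ suc (Δ ^ c) * γ
        few = begin
          ∑ (edges π) (blocked x)                                                    ≡⟨ ∑-swap (edges π) (allFin n) _ ⟩
          ∑ (allFin n) (λ v → ∑ (edges π) (λ e → ⟦ contains x v ⟧ * ⟦ onPath v e ⟧)) ≤⟨ ∑-mono (allFin n) (λ v →
              ≤-trans (≤-reflexive (∑-*ˡ (edges π) ⟦ contains x v ⟧ _)) (*-monoʳ-≤ ⟦ contains x v ⟧ (paths-through v))) ⟩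
          ∑ (allFin n) (λ v → ⟦ contains x v ⟧ * γ)                                  ≡⟨ ∑-*ʳ (allFin n) γ _ ⟩
          # (contains x) * γ                                                         ≤⟨ *-monoˡ-≤ γ (small x) ⟩
          suc (Δ ^ c) * γ                                                            ∎

      end∈verts : ∀ {Q m a b} (w : Walk Q m a b) → b ∈ₗ verts w
      end∈verts (stop _)   = here refl
      end∈verts (go _ _ w) = there (end∈verts w)

      -- A route that succeeds and misses the bag at `x` keeps its two ends in one branch.
      bichromatic-blocked : ∀ x e → e ∈ₗ edges π → C.bichromatic x e ≡ true → 1 ≤ ⟦ fails e ⟧ + blocked x e
      bichromatic-blocked x e@((a , R) , (b , R′)) e∈ bi = by-fail (true⊎false (fail R a b))
        where
        by-walk : ∀ {m} (w : Walk (inside hit (through R a b)) m a b) → (∀ {v} → v ∈ₗ verts w → v ∈ₗ path e) →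
                  Dec (∃ λ v → contains x v ≡ true × v ∈ₗ path e) → 1 ≤ ⟦ fails e ⟧ + blocked x e
        by-walk w sub (yes (v , xv , v∈)) = blocked-intro x e xv v∈
        by-walk w sub (no none) =
          let ya , ea = homeAt-P a (used-intro e∈ (sub (start∈verts w)))
              yb , eb = homeAt-P b (used-intro e∈ (sub (end∈verts w)))
              same = walk-branch x w (λ v∈ → used-intro e∈ (sub v∈)) (λ {v} v∈ → ≢true⇒false λ xv → none (v , xv , sub v∈))
                       (homeAt-just a ea) (homeAt-just b eb)
          in ⊥-elim (⌊⌋-false⁻ {P? = colour x (a , R) ≟ᶜ colour x (b , R′)} (not-true⁻ bi)
               (trans (colour-home x {a , R} ea) (trans same (sym (colour-home x {b , R′} eb)))))
        by-fail : fail R a b ≡ true ⊎ fail R a b ≡ false → 1 ≤ ⟦ fails e ⟧ + blocked x e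
        by-fail (inj₁ f)  = ≤-trans (≤-reflexive (cong ⟦_⟧ (sym f))) (m≤m+n _ _)
        by-fail (inj₂ ok) = let _ , w , sub = path-walk a R b R′ ok in
          by-walk w sub (any? λ v → (contains x v ≟ᵇ true) ×-dec (v ∈ₗ? path e))

      touching-blocked : ∀ x e → e ∈ₗ edges π → C.touching x nothing e ≡ true → 1 ≤ ⟦ fails e ⟧ + blocked x e
      touching-blocked x e@((a , R) , (b , R′)) e∈ tch = by-fail (true⊎false (fail R a b))
        where
        endpoint : ∀ v (R : Routing) → v ∈ₗ path e → C.coloured x nothing (v , R) ≡ true → 1 ≤ ⟦ fails e ⟧ + blocked x e
        endpoint v R v∈ e′ = at (colour-nothing x {v , R} (⌊⌋-true⁻ {P? = colour x (v , R) ≟ᶜ nothing} e′))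
          where
          at : homeAt v ≡ nothing ⊎ homeAt v ≡ just x → 1 ≤ ⟦ fails e ⟧ + blocked x e
          at (inj₂ j) = blocked-intro x e (homeAt-just v j) v∈
          at (inj₁ j) = let y , j′ = homeAt-P v (used-intro e∈ v∈) in ⊥-elim (absurd (trans (sym j) j′))
            where
            absurd : ∀ {y : Node} → nothing ≡ just y → ⊥
            absurd ()
        by-fail : fail R a b ≡ true ⊎ fail R a b ≡ false → 1 ≤ ⟦ fails e ⟧ + blocked x e
        by-fail (inj₁ f)  = ≤-trans (≤-reflexive (cong ⟦_⟧ (sym f))) (m≤m+n _ _)
        by-fail (inj₂ ok) = let _ , w , sub = path-walk a R b R′ ok in
          [ endpoint a R (sub (start∈verts w)) , endpoint b R′ (sub (end∈verts w)) ]′ (∨-true⁻ {C.coloured x nothing (a , R)} tch)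

      contradiction : ⊥
      contradiction = impossible 3B< (λ x → total-blocked x (C.bichromatic x) (bichromatic-blocked x))
                                     (λ x → total-blocked x (C.touching x nothing) (touching-blocked x))

    contradiction : ⊥
    contradiction = let π , few-fails , load = cube in OnCube.contradiction π few-fails load

  opaque
    separator : Separation
    separator = [ id , (λ r → ⊥-elim (Contradiction.contradiction r)) ]′ (play pairs>0 M (λ _ → 1) (λ _ → s≤s z≤n))

-- Layered families

module Layered (G : Graph) {m : ℕ} (layer : V G → Fin m) where

  Desc′ : V G → V G → Set
  Desc′ = Desc G layer

  arc? : ∀ u v → Dec (Arc G layer u v)
  arc? u v = (adj G u v ≟ᵇ true) ×-dec (toℕ (layer v) <?ⁿ toℕ (layer u))

  desc-trans : ∀ {u v w} → Desc′ u v → Desc′ v w → Desc′ u w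
  desc-trans desc-refl       q = q
  desc-trans (desc-step a p) q = desc-step a (desc-trans p q)

  opaque
    desc? : ∀ u v → Dec (Desc′ u v)
    desc? u v = search (suc (toℕ (layer u))) u (n<1+n _)
      where
      search : ∀ f u → toℕ (layer u) < f → Dec (Desc′ u v)
      search (suc f) u (s≤s le) with u ≟ v
      ... | yes refl = yes desc-refl
      ... | no u≢v = map′ (λ (w , a , p) → desc-step a p) (λ { desc-refl → ⊥-elim (u≢v refl) ; (desc-step a p) → _ , a , p })
                          (any? step?)
        where
        step? : ∀ w → Dec (Arc G layer u w × Desc′ w v)
        step? w with arc? u w
        ... | no ¬a = no (¬a ∘ proj₁)
        ... | yes a = map′ (a ,_) proj₂ (search f w (<-≤-trans (proj₂ a) le))

    center? : ∀ u → Dec (IsCenter G layer u)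
    center? u = all? λ w → ¬? (arc? w u)

  descᵇ : V G → V G → Bool
  descᵇ u v = ⌊ desc? u v ⌋

  desc-last : ∀ {u v} → Desc′ u v → u ≡ v ⊎ ∃ λ w → Arc G layer w v
  desc-last desc-refl = inj₁ refl
  desc-last (desc-step a p) with desc-last p
  ... | inj₁ refl = inj₂ (_ , a)
  ... | inj₂ r    = inj₂ r

  center-above : ∀ v → ∃ λ u → IsCenter G layer u × Desc′ u v
  center-above v = climb m v (m≤m+n m _)
    where
    climb : ∀ f v → m ≤ f + toℕ (layer v) → ∃ λ u → IsCenter G layer u × Desc′ u v
    climb f v le with any? (λ w → arc? w v)
    ... | no none = v , (λ w a → none (w , a)) , desc-refl
    climb zero    v le | yes (w , a) = ⊥-elim (<⇒≱ (toℕ<n (layer v)) le)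
    climb (suc f) v le | yes (w , a) =
      let u , c , p = climb f w (≤-trans le (≤-trans (≤-reflexive (sym (+-suc f _))) (+-monoʳ-≤ f (proj₂ a))))
      in u , c , desc-trans p (desc-step a desc-refl)

  -- The restriction to centers in `C` is needed because the recursion separates subfamilies.
  hit : (V G → Bool) → V G → V G → Bool
  hit C v w = C w ∧ descᵇ w v

  hit-intro : ∀ {C v w} → C w ≡ true → Desc′ w v → hit C v w ≡ true
  hit-intro {v = v} {w} c p = ∧-true c (⌊⌋-true (desc? w v) p)

  hit-C : ∀ {C v w} → hit C v w ≡ true → C w ≡ true
  hit-C = ∧-trueˡ

  hit-desc : ∀ {C v w} → hit C v w ≡ true → Desc′ w v
  hit-desc {C} {v} {w} e = ⌊⌋-true⁻ {P? = desc? w v} (∧-trueʳ {C w} e)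

  module _ {k : ℕ} (thin : ThicknessAtMost G layer k) (C : V G → Bool) (C⊆ : ∀ w → C w ≡ true → IsCenter G layer w) where

    open SetSystem (adj G) (adj-sym G) (hit C) using (Axioms)
    open Walks (adj G) (adj-sym G) using (Walk; stop; go; reverse)

    private
      below : Subset m → Fin m → Fin m → Bool
      below S i j = lookup S j ∧ ⌊ toℕ j ≤?ⁿ toℕ i ⌋

      -- Layers strictly decrease along arcs and all belong to `S`; the remaining length is thus
      -- smaller than the number of layers of `S` not above the current one.
      down : ∀ {v} (P : V G → Bool) w (S : Subset m) → (∀ p → Desc′ w p → layer p ∈ S) →
             (∀ p → Desc′ w p → Desc′ p v → P p ≡ true) →
             ∀ {p} → Desc′ w p → Desc′ p v → ∃ λ j → suc j ≤ # (below S (layer p)) × Walk P j p v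
      down P w S in-S inP {p} wp desc-refl = 0 ,
        #-pos {P = below S (layer p)} (∧-true ([]=⇒lookup (in-S p wp)) (⌊⌋-true (toℕ (layer p) ≤?ⁿ toℕ (layer p)) ≤-refl)) ,
        stop (inP p wp desc-refl)
      down P w S in-S inP {p} wp (desc-step {w = q} a pv) =
        let j , le , walk = down P w S in-S inP (desc-trans wp (desc-step a desc-refl)) pv
        in suc j , ≤-trans (s≤s le) (#-strict (layer p) mono (≢true⇒false λ e → <⇒≱ (proj₂ a) (⌊⌋-true⁻ {P? = toℕ (layer p) ≤?ⁿ toℕ (layer q)} (∧-trueʳ {lookup S (layer p)} e)))
                     (∧-true ([]=⇒lookup (in-S p wp)) (⌊⌋-true (toℕ (layer p) ≤?ⁿ toℕ (layer p)) ≤-refl))) ,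
           go (inP p wp (desc-step a pv)) (proj₁ a) walk
        where
        mono : below S (layer q) ⊆ᵇ below S (layer p)
        mono i e = ∧-true (∧-trueˡ e) (⌊⌋-true (toℕ i ≤?ⁿ toℕ (layer p))
          (≤-trans (⌊⌋-true⁻ {P? = toℕ i ≤?ⁿ toℕ (layer q)} (∧-trueʳ {lookup S i} e)) (<⇒≤ (proj₂ a))))

    -- Having no in-arcs, a center descends only from itself. For `up`, a directed path from `w` to
    -- `v` is reversed: a member containing a vertex of the path contains everything further down,
    -- in particular `v`.
    layered-axioms : Axioms k
    layered-axioms = record
      { hit-center = λ v w w′ h h′ → unique (C⊆ w (hit-C {C} {v} h)) (hit-desc {C} {w} h′)
      ; up         = up
      }
      where
      unique : ∀ {w w′} → IsCenter G layer w → Desc′ w′ w → w′ ≡ w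
      unique c p = [ id , (λ (x , a) → ⊥-elim (c x a)) ]′ (desc-last p)
      up : ∀ v w → hit C v w ≡ true → ∃ λ j → j ≤ k × Walk (inside (hit C) (hit C v)) j v w
      up v w h =
        let S , S≤k , in-S = thin w (C⊆ w (hit-C {C} {v} h))
            j , le , walk = down (inside (hit C) (hit C v)) w S in-S
              (λ p wp pv → inside-intro {w = w} (hit-intro {C} (hit-C {C} {v} h) wp)
                 λ w′ h′ → hit-intro {C} (hit-C {C} {p} h′) (desc-trans (hit-desc {C} {p} h′) pv))
              desc-refl (hit-desc {C} {v} h)
        in j , ≤-trans (n≤1+n j) (≤-trans le (≤-trans (#-mono {P = below S (layer w)} {lookup S} (λ _ → ∧-trueˡ))
                 (≤-trans (≤-reflexive (sym ∣ S ∣-lookup)) S≤k))) , reverse walk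

  witnesses : ∀ {t} → NeighborhoodWitnessing G layer t → (C : V G → Bool) → (∀ w → C w ≡ true → IsCenter G layer w) →
    ∀ u v → hit C v u ≡ true → ∃ λ S → # S ≤ t × (∀ w → Adj G v w → hit C w u ≡ false → S w ≡ true)
  witnesses wit C C⊆ u v h =
    let cu = hit-C {C} {v} h
        S , S≤ , in-S = wit u (C⊆ u cu) v (hit-desc {C} {v} h)
    in lookup S , ≤-trans (≤-reflexive (sym ∣ S ∣-lookup)) S≤ ,
       λ w a nh → []=⇒lookup (in-S w (lookup⇒[]= w _ (trans (lookup∘tabulate _ w) (∨-trueˡ a)))
         (λ p → true≢false (hit-intro {C} cu p) nh))

-- Gluing tree decompositions

path-append : ∀ {T P x y z} → PathWithin T P x y → PathWithin T P y z → PathWithin T P x z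
path-append (here _)     q = q
path-append (step p a w) q = step p a (path-append w q)

path-reverse : ∀ {T P x y} → PathWithin T P x y → PathWithin T P y x
path-reverse (here p) = here p
path-reverse {T} {P} (step p a w) = path-append (path-reverse w) (step (start w) (flip-adj a) (here p))
  where
  start : ∀ {x y} → PathWithin T P x y → P x
  start (here p)     = p
  start (step p _ _) = p
  flip-adj : ∀ {x y} → TreeAdj T x y → TreeAdj T y x
  flip-adj (inj₁ r) = inj₂ r
  flip-adj (inj₂ r) = inj₁ r

-- The root of `T₂` becomes a child of the root of `T₁`, and depths in `T₂` are shifted past that of
-- the new parent.
module Attach (T₁ T₂ : RootedTree) where

  private
    n₁ = nodes T₁
    n₂ = nodes T₂

    parent′ : Fin n₁ ⊎ Fin n₂ → Fin (n₁ + n₂)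
    parent′ (inj₁ i) = parent T₁ i ↑ˡ n₂
    parent′ (inj₂ j) with j ≟ root T₂
    ... | yes _ = root T₁ ↑ˡ n₂
    ... | no _  = n₁ ↑ʳ parent T₂ j

    depth′ : Fin n₁ ⊎ Fin n₂ → ℕ
    depth′ (inj₁ i) = depth T₁ i
    depth′ (inj₂ j) = suc (depth T₁ (root T₁)) + depth T₂ j

    closer : ∀ s → join n₁ n₂ s ≢ root T₁ ↑ˡ n₂ → depth′ (splitAt n₁ (parent′ s)) < depth′ s
    closer (inj₁ i) ne rewrite splitAt-↑ˡ n₁ (parent T₁ i) n₂ = parent-closer T₁ i λ e → ne (cong (_↑ˡ n₂) e)
    closer (inj₂ j) ne with j ≟ root T₂
    ... | yes refl rewrite splitAt-↑ˡ n₁ (root T₁) n₂ = s≤s (m≤m+n _ _)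
    ... | no j≢r   rewrite splitAt-↑ʳ n₁ n₂ (parent T₂ j) = +-monoʳ-< (suc (depth T₁ (root T₁))) (parent-closer T₂ j j≢r)

  tree′ : RootedTree
  tree′ = record
    { nodes  = n₁ + n₂
    ; root   = root T₁ ↑ˡ n₂
    ; parent = parent′ ∘ splitAt n₁
    ; depth  = depth′ ∘ splitAt n₁
    ; parent-closer = λ x ne → closer (splitAt n₁ x) λ e → ne (trans (sym (join-splitAt n₁ n₂ x)) e)
    }

  left : Fin n₁ → Fin (n₁ + n₂)
  left i = i ↑ˡ n₂

  right : Fin n₂ → Fin (n₁ + n₂)
  right j = n₁ ↑ʳ j

  private
    left-injective : ∀ {i j} → left i ≡ left j → i ≡ j
    left-injective {i} {j} e = inj₁-injective (trans (sym (splitAt-↑ˡ n₁ i n₂)) (trans (cong (splitAt n₁) e) (splitAt-↑ˡ n₁ j n₂)))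
      where
      inj₁-injective : ∀ {i j : Fin n₁} → inj₁ {B = Fin n₂} i ≡ inj₁ j → i ≡ j
      inj₁-injective refl = refl

    right≢left : ∀ {i j} → right j ≢ left i
    right≢left {i} {j} e = absurd (trans (sym (splitAt-↑ʳ n₁ n₂ j)) (trans (cong (splitAt n₁) e) (splitAt-↑ˡ n₁ i n₂)))
      where
      absurd : ∀ {i j} → inj₂ {A = Fin n₁} {B = Fin n₂} j ≡ inj₁ i → ⊥
      absurd ()

    parent-left : ∀ i → parent tree′ (left i) ≡ left (parent T₁ i)
    parent-left i = cong parent′ (splitAt-↑ˡ n₁ i n₂)

    parent-right : ∀ j → j ≢ root T₂ → parent tree′ (right j) ≡ right (parent T₂ j)
    parent-right j ne = trans (cong parent′ (splitAt-↑ʳ n₁ n₂ j)) eval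
      where
      eval : parent′ (inj₂ j) ≡ right (parent T₂ j)
      eval with j ≟ root T₂
      ... | yes e = ⊥-elim (ne e)
      ... | no _  = refl

    parent-root : parent tree′ (right (root T₂)) ≡ left (root T₁)
    parent-root = trans (cong parent′ (splitAt-↑ʳ n₁ n₂ (root T₂))) eval
      where
      eval : parent′ (inj₂ (root T₂)) ≡ left (root T₁)
      eval with root T₂ ≟ root T₂
      ... | yes _ = refl
      ... | no ¬e = ⊥-elim (¬e refl)

    up-left : ∀ {x y} → x ≢ root T₁ × parent T₁ x ≡ y → left x ≢ root tree′ × parent tree′ (left x) ≡ left y
    up-left {x} (ne , refl) = (λ e → ne (left-injective e)) , parent-left x

    up-right : ∀ {x y} → x ≢ root T₂ × parent T₂ x ≡ y → right x ≢ root tree′ × parent tree′ (right x) ≡ right y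
    up-right {x} (ne , refl) = right≢left , parent-right x ne

    adj-left : ∀ {x y} → TreeAdj T₁ x y → TreeAdj tree′ (left x) (left y)
    adj-left (inj₁ r) = inj₁ (up-left r)
    adj-left (inj₂ r) = inj₂ (up-left r)

    adj-right : ∀ {x y} → TreeAdj T₂ x y → TreeAdj tree′ (right x) (right y)
    adj-right (inj₁ r) = inj₁ (up-right r)
    adj-right (inj₂ r) = inj₂ (up-right r)

  module _ {P : Fin (n₁ + n₂) → Set} where

    path-left : ∀ {x y} → PathWithin T₁ (P ∘ left) x y → PathWithin tree′ P (left x) (left y)
    path-left (here p)     = here p
    path-left (step p a w) = step p (adj-left a) (path-left w)

    path-right : ∀ {x y} → PathWithin T₂ (P ∘ right) x y → PathWithin tree′ P (right x) (right y)
    path-right (here p)     = here p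
    path-right (step p a w) = step p (adj-right a) (path-right w)

    path-cross : ∀ {x y} → PathWithin T₁ (P ∘ left) x (root T₁) → P (left (root T₁)) →
                 PathWithin T₂ (P ∘ right) (root T₂) y → PathWithin tree′ P (left x) (right y)
    path-cross w p w′ = path-append (path-left w) (step p (inj₂ (right≢left , parent-root)) (path-right w′))

    glue-connected :
      (∀ x y → P (left x) → P (left y) → PathWithin T₁ (P ∘ left) x y) →
      (∀ x y → P (right x) → P (right y) → PathWithin T₂ (P ∘ right) x y) →
      (∀ x y → P (left x) → P (right y) → P (left (root T₁)) × P (right (root T₂))) →
      ∀ x y → P x → P y → PathWithin tree′ P x y
    glue-connected c₁ c₂ meet x y px py =
      subst₂ (PathWithin tree′ P) (join-splitAt n₁ n₂ x) (join-splitAt n₁ n₂ y)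
        (by-sides (splitAt n₁ x) (splitAt n₁ y) (subst P (sym (join-splitAt n₁ n₂ x)) px) (subst P (sym (join-splitAt n₁ n₂ y)) py))
      where
      crossing : ∀ i j → P (left i) → P (right j) → PathWithin tree′ P (left i) (right j)
      crossing i j p q = let r₁ , r₂ = meet i j p q in path-cross (c₁ i (root T₁) p r₁) r₁ (c₂ (root T₂) j r₂ q)
      by-sides : ∀ s t → P (join n₁ n₂ s) → P (join n₁ n₂ t) → PathWithin tree′ P (join n₁ n₂ s) (join n₁ n₂ t)
      by-sides (inj₁ i) (inj₁ j) p q = path-left (c₁ i j p q)
      by-sides (inj₂ i) (inj₂ j) p q = path-right (c₂ i j p q)
      by-sides (inj₁ i) (inj₂ j) p q = crossing i j p q
      by-sides (inj₂ i) (inj₁ j) p q = path-reverse (crossing j i q p)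

-- The recursion along separators

module Recursion (G : Graph) {m : ℕ} (layer : V G → Fin m) {k : ℕ} (thin : ThicknessAtMost G layer k)
                 (s g B : ℕ) (g>0 : 0 < g) (B≥ : g * suc s ≤ B) where

  open Layered G layer

  private
    Set′ : Set
    Set′ = V G → Bool

  Centers : Set′ → Set
  Centers C = ∀ w → C w ≡ true → IsCenter G layer w

  F : Set′ → V G → Set
  F S v = ∃ λ w → S w ≡ true × Desc′ w v

  F? : ∀ S v → Dec (F S v)
  F? S v = any? λ w → (S w ≟ᵇ true) ×-dec desc? w v

  F-mono : ∀ {S S′} → S ⊆ᵇ S′ → ∀ {v} → F S v → F S′ v
  F-mono sub (w , e , p) = w , sub w e , p

  module Sys (C : Set′) = SetSystem (adj G) (adj-sym G) (hit C)

  SeparatorFor : (C X : Set′) → Set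
  SeparatorFor C X = ∃ λ Y → # Y ≤ s × (∀ x₀ → C x₀ ≡ true → Y x₀ ≡ false → Sys.Balanced C g X Y x₀)

  -- Bags are recorded by their sets of centers, which keeps them unions of members. A bag has up to
  -- `B` centers inherited from above and up to `suc s` from a separator.
  record Partial (C X : Set′) : Set where
    field
      T         : RootedTree
      chosen    : Fin (nodes T) → Set′
      chosen⊆   : ∀ x → chosen x ⊆ᵇ C
      few       : ∀ x → # (chosen x) ≤ B + suc s
      root⊇     : X ⊆ᵇ chosen (root T)
      vertex    : ∀ v → F C v → ∃ λ x → F (chosen x) v
      edge      : ∀ u v → Adj G u v → F C u → F C v → ∃ λ x → F (chosen x) u × F (chosen x) v
      connected : ∀ v x y → F (chosen x) v → F (chosen y) v → PathWithin T (λ z → F (chosen z) v) x y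

  single : ∀ C X → # C ≤ B + suc s → X ⊆ᵇ C → Partial C X
  single C X C≤ X⊆ = record
    { T         = record { nodes = 1 ; root = zero ; parent = λ _ → zero ; depth = λ _ → 0
                         ; parent-closer = λ { zero ne → ⊥-elim (ne refl) } }
    ; chosen    = λ _ → C
    ; chosen⊆   = λ _ _ e → e
    ; few       = λ _ → C≤
    ; root⊇     = X⊆
    ; vertex    = λ v f → zero , f
    ; edge      = λ u v _ f f′ → zero , f , f′
    ; connected = λ { v zero zero f _ → here f }
    }

  weaken : ∀ {C X C′} → (∀ w → C w ≡ true → C′ w ≡ true) → (∀ w → C′ w ≡ true → C w ≡ true) → Partial C X → Partial C′ X
  weaken to from D = record
    { T = T ; chosen = chosen ; chosen⊆ = λ x w e → to w (chosen⊆ x w e) ; few = few ; root⊇ = root⊇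
    ; vertex = λ v f → vertex v (F-mono from f) ; edge = λ u v a f f′ → edge u v a (F-mono from f) (F-mono from f′)
    ; connected = connected }
    where open Partial D

  -- Everything shared by the two parts lies in members of `X₂`, and both root bags contain these;
  -- joining the roots therefore keeps the bags of each vertex connected.
  attach : ∀ {C₁ X₁ C₂ X₂} (D₁ : Partial C₁ X₁) (D₂ : Partial C₂ X₂) → X₂ ⊆ᵇ X₁ →
    (∀ v → F C₁ v → F C₂ v → F X₂ v) →
    (∀ u v → Adj G u v → F (C₁ ∪ᵇ C₂) u → F (C₁ ∪ᵇ C₂) v → (F C₁ u × F C₁ v) ⊎ (F C₂ u × F C₂ v)) →
    Partial (C₁ ∪ᵇ C₂) X₁
  attach {C₁} {X₁} {C₂} {X₂} D₁ D₂ X₂⊆X₁ meet edges = record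
    { T         = tree′
    ; chosen    = chosen
    ; chosen⊆   = λ x → sub (splitAt (nodes P₁.T) x)
    ; few       = λ x → few′ (splitAt (nodes P₁.T) x)
    ; root⊇     = λ w e → trans (cong (λ S → S w) chosen-left) (P₁.root⊇ w e)
    ; vertex    = λ v f → [ (λ f₁ → let x , fx = P₁.vertex v f₁ in left x , from-left fx)
                          , (λ f₂ → let x , fx = P₂.vertex v f₂ in right x , from-right fx) ]′ (split v f)
    ; edge      = λ u v a fu fv → [ (λ (f , f′) → let x , p , q = P₁.edge u v a f f′ in left x , from-left p , from-left q)
                                  , (λ (f , f′) → let x , p , q = P₂.edge u v a f f′ in right x , from-right p , from-right q) ]′ (edges u v a fu fv)
    ; connected = λ v → glue-connected {P = λ z → F (chosen z) v}
        (λ x y p q → path-map from-left (P₁.connected v x y (to-left p) (to-left q)))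
        (λ x y p q → path-map from-right (P₂.connected v x y (to-right p) (to-right q)))
        (λ x y p q → let f = meet v (F-mono (P₁.chosen⊆ x) (to-left p)) (F-mono (P₂.chosen⊆ y) (to-right q))
                     in from-left (F-mono P₁.root⊇ (F-mono X₂⊆X₁ f)) , from-right (F-mono P₂.root⊇ f))
    }
    where
    module P₁ = Partial D₁
    module P₂ = Partial D₂
    open Attach P₁.T P₂.T
    chosen′ : Fin (nodes P₁.T) ⊎ Fin (nodes P₂.T) → Set′
    chosen′ = [ P₁.chosen , P₂.chosen ]′
    chosen : Fin (nodes P₁.T + nodes P₂.T) → Set′
    chosen x = chosen′ (splitAt (nodes P₁.T) x)
    sub : ∀ s → chosen′ s ⊆ᵇ (C₁ ∪ᵇ C₂)
    sub (inj₁ i) w e = ∨-trueˡ (P₁.chosen⊆ i w e)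
    sub (inj₂ j) w e = ∨-trueʳ {C₁ w} (P₂.chosen⊆ j w e)
    few′ : ∀ t → # (chosen′ t) ≤ B + suc s
    few′ (inj₁ i) = P₁.few i
    few′ (inj₂ j) = P₂.few j
    chosen-left : ∀ {i} → chosen (left i) ≡ P₁.chosen i
    chosen-left {i} = cong chosen′ (splitAt-↑ˡ (nodes P₁.T) i (nodes P₂.T))
    chosen-right : ∀ {j} → chosen (right j) ≡ P₂.chosen j
    chosen-right {j} = cong chosen′ (splitAt-↑ʳ (nodes P₁.T) (nodes P₂.T) j)
    from-left : ∀ {v i} → F (P₁.chosen i) v → F (chosen (left i)) v
    from-left {v} = subst (λ S → F S v) (sym chosen-left)
    to-left : ∀ {v i} → F (chosen (left i)) v → F (P₁.chosen i) v
    to-left {v} = subst (λ S → F S v) chosen-left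
    from-right : ∀ {v j} → F (P₂.chosen j) v → F (chosen (right j)) v
    from-right {v} = subst (λ S → F S v) (sym chosen-right)
    to-right : ∀ {v j} → F (chosen (right j)) v → F (P₂.chosen j) v
    to-right {v} = subst (λ S → F S v) chosen-right
    split : ∀ v → F (C₁ ∪ᵇ C₂) v → F C₁ v ⊎ F C₂ v
    split v (w , e , p) = [ (λ e₁ → inj₁ (w , e₁ , p)) , (λ e₂ → inj₂ (w , e₂ , p)) ]′ (∨-true⁻ {C₁ w} e)
    path-map : ∀ {T} {P Q : Fin (nodes T) → Set} → (∀ {x} → P x → Q x) → ∀ {x y} → PathWithin T P x y → PathWithin T Q x y
    path-map f (here p)     = here (f p)
    path-map f (step p a w) = step (f p) a (path-map f w)

  module Split (C X : Set′) (C-centers : Centers C) (X⊆C : X ⊆ᵇ C) (X≤B : # X ≤ B)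
               (sep : SeparatorFor C X) (w₀ : V G) (w₀∈C : C w₀ ≡ true) (w₀∉X : X w₀ ≡ false) where

    open Sys C
    open Axioms (layered-axioms thin C C-centers)

    -- `w₀` joins the separator to guarantee progress: it lies in `C` but not in `X`, and it enters
    -- the prescribed root set of every child, so the measure drops even if the separator itself is
    -- empty. Hence `suc s`. `R` becomes the root bag.
    Y R rest : Set′
    Y = λ w → C w ∧ (proj₁ sep w ∨ ⌊ w ≟ w₀ ⌋)
    R = X ∪ᵇ Y
    rest = C ∖ R

    Y≤ : # Y ≤ suc s
    Y≤ = begin
      # Y                                       ≤⟨ #-mono {P = Y} (λ w → ∧-trueʳ {C w}) ⟩
      # (proj₁ sep ∪ᵇ (λ w → ⌊ w ≟ w₀ ⌋))       ≤⟨ #-∪ (proj₁ sep) _ ⟩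
      # (proj₁ sep) + # (λ w → ⌊ w ≟ w₀ ⌋)      ≤⟨ +-mono-≤ (proj₁ (proj₂ sep)) (≤-reflexive (#-singleton w₀)) ⟩
      s + 1                                     ≡⟨ +-comm s 1 ⟩
      suc s                                     ∎
      where open ≤-Reasoning

    R⊆C : R ⊆ᵇ C
    R⊆C w e = [ X⊆C w , ∧-trueˡ ]′ (∨-true⁻ {X w} e)

    R≤ : # R ≤ B + suc s
    R≤ = ≤-trans (#-∪ X Y) (+-mono-≤ X≤B Y≤)

    rest-elim : ∀ {w} → rest w ≡ true → C w ≡ true × X w ≡ false × Y w ≡ false
    rest-elim {w} e with C w | X w | Y w
    ... | true | false | false = refl , refl , refl

    rest-intro : ∀ {w} → C w ≡ true → X w ≡ false → Y w ≡ false → rest w ≡ true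
    rest-intro {w} c x y = ∧-true c (not-true (trans (cong (_∨ Y w) x) y))

    region : Set′
    region = C ∖ Y

    rest⊆region : rest ⊆ᵇ region
    rest⊆region w e = let c , _ , y = rest-elim e in ∧-true c (not-true y)

    region-or-Y : ∀ v → F C v → F Y v ⊎ inside (hit C) region v ≡ true
    region-or-Y v (w , c , p) with F? Y v
    ... | yes f = inj₁ f
    ... | no ¬f = inj₂ (inside-intro {w = w} (hit-intro {C} c p) λ w′ h →
            ∧-true (hit-C {C} {v} h) (not-true (≢true⇒false λ y → ¬f (w′ , y , hit-desc {C} {v} h))))

    rest-or-X : ∀ v → inside (hit C) region v ≡ true → (∃ λ x → X x ≡ true × Desc′ x v) ⊎ inside (hit C) rest v ≡ true
    rest-or-X v v-in with F? X v
    ... | yes f = inj₁ f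
    ... | no ¬f = inj₂ (inside-intro (proj₂ (inside-hit v-in)) λ w h →
            rest-intro (hit-C {C} {v} h) (≢true⇒false λ x → ¬f (w , x , hit-desc {C} {v} h)) (not-true⁻ (∧-trueʳ {C w} (inside-⊆ v-in w h))))

    module Component (w : V G) (w∈rest : rest w ≡ true) where

      w∈C : C w ≡ true
      w∈C = proj₁ (rest-elim w∈rest)

      -- `K` is one component after the deletion of `R`. The members of `X` that can touch it have
      -- centers in the larger component of `w` obtained when only `Y` is deleted, and these are the
      -- ones that the balance condition counts.
      K X′ C′ : Set′
      K v = C v ∧ ⌊ conn? (inside (hit C) rest) w v ⌋
      X′ = Y ∪ᵇ (λ x → X x ∧ ⌊ conn? (inside (hit C) region) w x ⌋)
      C′ = K ∪ᵇ X′

      K-conn : ∀ {v} → K v ≡ true → Conn (inside (hit C) rest) w v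
      K-conn {v} e = ⌊⌋-true⁻ {P? = conn? (inside (hit C) rest) w v} (∧-trueʳ {C v} e)

      K-intro : ∀ {v} → C v ≡ true → Conn (inside (hit C) rest) w v → K v ≡ true
      K-intro {v} c p = ∧-true c (⌊⌋-true (conn? (inside (hit C) rest) w v) p)

      K⊆rest : K ⊆ᵇ rest
      K⊆rest v e = inside-⊆ (walk-end (proj₂ (K-conn e))) v (hit-intro {C} (∧-trueˡ e) desc-refl)

      X′⊆R : X′ ⊆ᵇ R
      X′⊆R v e = [ ∨-trueʳ {X v} , (λ e′ → ∨-trueˡ {X v} (∧-trueˡ {X v} e′)) ]′ (∨-true⁻ {Y v} e)

      X′⊆C′ : X′ ⊆ᵇ C′
      X′⊆C′ v e = ∨-trueʳ {K v} e

      C′⊆C : C′ ⊆ᵇ C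
      C′⊆C v e = [ ∧-trueˡ , (λ e′ → R⊆C v (X′⊆R v e′)) ]′ (∨-true⁻ {K v} e)

      X′-intro : ∀ {x} → X x ≡ true → Conn (inside (hit C) region) w x → X′ x ≡ true
      X′-intro {x} e p = ∨-trueʳ {Y x} (∧-true e (⌊⌋-true (conn? (inside (hit C) region) w x) p))

      -- Either a member of `Y` contains `v`; or a member of `X` does, whose center is reached from
      -- `v` by climbing and so is counted in `X′`; or no member of `R` does. The two premises carry
      -- connectivity to `v` in the last two cases.
      trichotomy : ∀ v → F C v → (inside (hit C) region v ≡ true → Conn (inside (hit C) region) w v) →
                   (inside (hit C) rest v ≡ true → Conn (inside (hit C) rest) w v) →
                   F X′ v ⊎ (inside (hit C) rest v ≡ true × Conn (inside (hit C) rest) w v)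
      trichotomy v f reg res with region-or-Y v f
      ... | inj₁ fy = inj₁ (F-mono (λ x → ∨-trueˡ) fy)
      ... | inj₂ v-reg with rest-or-X v v-reg
      ...   | inj₂ v-rest = inj₂ (v-rest , res v-rest)
      ...   | inj₁ (x , ex , p) = inj₁ (x , X′-intro ex (conn-trans (reg v-reg) (up-conn (hit-intro {C} (X⊆C x ex) p) (inside-⊆ v-reg))) , p)

      member : ∀ v → F K v → F X′ v ⊎ (inside (hit C) rest v ≡ true × Conn (inside (hit C) rest) w v)
      member v (w′ , e , p) = trichotomy v (w′ , ∧-trueˡ e , p)
        (λ v-reg → conn-trans (conn-mono (inside-mono rest⊆region) (K-conn e)) (conn-sym (up-conn (hit-intro {C} (∧-trueˡ e) p) (inside-⊆ v-reg))))
        (λ v-rest → conn-trans (K-conn e) (conn-sym (up-conn (hit-intro {C} (∧-trueˡ e) p) (inside-⊆ v-rest))))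

      component : ∀ v → inside (hit C) rest v ≡ true → Conn (inside (hit C) rest) w v → F K v
      component v v-rest conn = let w′ , h = inside-hit v-rest in
        w′ , K-intro (hit-C {C} {v} h) (conn-trans conn (up-conn h (inside-⊆ v-rest))) , hit-desc {C} {v} h

      neighbour : ∀ a b → Adj G a b → inside (hit C) rest a ≡ true → Conn (inside (hit C) rest) w a → F C b → F C′ b
      neighbour a b e a-rest conn fb = [ F-mono X′⊆C′ , (λ (b-rest , conn′) → F-mono (λ v → ∨-trueˡ) (component b b-rest conn′)) ]′
        (trichotomy b fb
          (λ b-reg → conn-trans (conn-mono (inside-mono rest⊆region) conn) (conn-edge (inside-mono rest⊆region a a-rest) b-reg e))
          (λ b-rest → conn-trans conn (conn-edge a-rest b-rest e)))

      -- The size is at most s + 1 + (1 - 1/g)|X|, where s + 1 ≤ B/g and |X| ≤ B. The computation is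
      -- multiplied by g, with |X| added on both sides in place of the subtraction.
      X′≤B : # X′ ≤ B
      X′≤B = *-cancelˡ-≤ g {{Data.Nat.>-nonZero g>0}} (+-cancelʳ-≤ (# X) _ _ (begin
        g * # X′ + # X                                   ≤⟨ +-monoˡ-≤ (# X) (*-monoʳ-≤ g (≤-trans (#-∪ Y (λ x → X x ∧ ⌊ conn? (inside (hit C) region) w x ⌋)) (+-mono-≤ Y≤ (#-mono {P = λ x → X x ∧ ⌊ conn? (inside (hit C) region) w x ⌋} {reachable X (proj₁ sep) w} fewer)))) ⟩
        g * (suc s + # (reachable X (proj₁ sep) w)) + # X ≡⟨ e₁ g (suc s) (# (reachable X (proj₁ sep) w)) (# X) ⟩
        g * suc s + (g * # (reachable X (proj₁ sep) w) + # X) ≤⟨ +-mono-≤ B≥ (proj₂ (proj₂ sep) w w∈C sep-w) ⟩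
        B + g * # X                                      ≤⟨ exchange g>0 X≤B ⟩
        g * B + # X                                      ∎))
        where
        open ≤-Reasoning
        e₁ : ∀ g a b x → g * (a + b) + x ≡ g * a + (g * b + x)
        e₁ = solve-∀
        exchange : ∀ {g x B} → 0 < g → x ≤ B → B + g * x ≤ g * B + x
        exchange {suc g} {x} {B} _ x≤B = ≤-trans (+-monoʳ-≤ B (+-monoʳ-≤ x (*-monoʳ-≤ g x≤B))) (≤-reflexive (e₂ B x (g * B)))
          where
          e₂ : ∀ B x y → B + (x + y) ≡ B + y + x
          e₂ = solve-∀
        sep-w : proj₁ sep w ≡ false
        sep-w = ≢true⇒false λ e → true≢false (∧-true w∈C (∨-trueˡ e)) (proj₂ (proj₂ (rest-elim w∈rest)))
        fewer : ∀ x → X x ∧ ⌊ conn? (inside (hit C) region) w x ⌋ ≡ true → reachable X (proj₁ sep) w x ≡ true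
        fewer x e = ∧-true (∧-trueˡ {X x} e) (⌊⌋-true (conn? (inside (hit C) (center ∖ proj₁ sep)) w x)
          (conn-mono (inside-mono λ v e′ → ∧-true (hit-intro {C} (∧-trueˡ e′) desc-refl)
             (not-true (≢true⇒false λ e″ → true≢false (∧-true (∧-trueˡ e′) (∨-trueˡ e″)) (not-true⁻ (∧-trueʳ {C v} e′)))))
            (⌊⌋-true⁻ {P? = conn? (inside (hit C) region) w x} (∧-trueʳ {X x} e))))

      measure : # (C′ ∖ X′) < # (C ∖ X)
      measure = #-strict {P = C′ ∖ X′} {C ∖ X} w₀ sub (≢true⇒false λ e → true≢false (∨-trueˡ {Y w₀} w₀∈Y) (not-true⁻ (∧-trueʳ {C′ w₀} e))) (∧-true w₀∈C (not-true w₀∉X))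
        where
        w₀∈Y : Y w₀ ≡ true
        w₀∈Y = ∧-true w₀∈C (∨-trueʳ {proj₁ sep w₀} (⌊⌋-true (w₀ ≟ w₀) refl))
        sub : (C′ ∖ X′) ⊆ᵇ (C ∖ X)
        sub v e = [ (λ eK → let c , x , _ = rest-elim (K⊆rest v eK) in ∧-true c (not-true x))
                  , (λ eX → ⊥-elim (true≢false eX (not-true⁻ (∧-trueʳ {C′ v} e)))) ]′ (∨-true⁻ {K v} (∧-trueˡ {C′ v} e))

    -- `Z` collects the components already attached; being a union of components, it is disjoint
    -- from any component with a center outside it.
    Closed : Set′ → Set
    Closed Z = (Z ⊆ᵇ rest) × (∀ a b → Z a ≡ true → C b ≡ true → Conn (inside (hit C) rest) a b → Z b ≡ true)

    module AddComponent (Z : Set′) (closed : Closed Z) (D : Partial (R ∪ᵇ Z) R)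
                        (w : V G) (w∈rest : rest w ≡ true) (w∉Z : Z w ≡ false)
                        (D′ : Partial (Component.C′ w w∈rest) (Component.X′ w w∈rest)) where

      open Component w w∈rest

      Z′ : Set′
      Z′ = Z ∪ᵇ K

      -- A common vertex would climb to a center of `Z` inside the component of `w`, and `closed`
      -- would put `w` into `Z`.
      apart : ∀ v → F (R ∪ᵇ Z) v → inside (hit C) rest v ≡ true → Conn (inside (hit C) rest) w v → ⊥
      apart v (w₂ , e , p) v-rest conn = [ (λ r → true≢false r (cong₂ _∨_ (proj₁ (proj₂ w₂-rest)) (proj₂ (proj₂ w₂-rest)))) , in-Z ]′ (∨-true⁻ {R w₂} e)
        where
        w₂∈C : C w₂ ≡ true
        w₂∈C = [ R⊆C w₂ , (λ z → proj₁ (rest-elim (proj₁ closed w₂ z))) ]′ (∨-true⁻ {R w₂} e)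
        h : hit C v w₂ ≡ true
        h = hit-intro {C} w₂∈C p
        w₂-rest = rest-elim (inside-⊆ v-rest w₂ h)
        in-Z : Z w₂ ≡ true → ⊥
        in-Z z = true≢false (proj₂ closed w₂ w z w∈C (conn-sym (conn-trans conn (up-conn h (inside-⊆ v-rest))))) w∉Z

      meet : ∀ v → F (R ∪ᵇ Z) v → F C′ v → F X′ v
      meet v f (w′ , e , p) = [ (λ eK → [ id , (λ (v-rest , conn) → ⊥-elim (apart v f v-rest conn)) ]′ (member v (w′ , eK , p)))
                              , (λ eX → w′ , eX , p) ]′ (∨-true⁻ {K w′} e)

      into-C : ∀ {v} → F ((R ∪ᵇ Z) ∪ᵇ C′) v → F C v
      into-C = F-mono λ w′ e → [ (λ e₁ → [ R⊆C w′ , (λ z → proj₁ (rest-elim (proj₁ closed w′ z))) ]′ (∨-true⁻ {R w′} e₁)) , C′⊆C w′ ]′ (∨-true⁻ {(R ∪ᵇ Z) w′} e)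

      outside : ∀ a b → Adj G a b → F ((R ∪ᵇ Z) ∪ᵇ C′) a → F ((R ∪ᵇ Z) ∪ᵇ C′) b → ¬ F (R ∪ᵇ Z) a → F C′ a × F C′ b
      outside a b e (w′ , e′ , p) fb ¬f = [ (λ e₁ → ⊥-elim (¬f (w′ , e₁ , p))) , (λ e₂ → (w′ , e₂ , p) , other e₂) ]′ (∨-true⁻ {(R ∪ᵇ Z) w′} e′)
        where
        from-X′ : F X′ a → F C′ b
        from-X′ f = ⊥-elim (¬f (F-mono (λ v x → ∨-trueˡ (X′⊆R v x)) f))
        other : C′ w′ ≡ true → F C′ b
        other e₂ = [ (λ eK → [ from-X′ , (λ (a-rest , conn) → neighbour a b e a-rest conn (into-C fb)) ]′ (member a (w′ , eK , p)))
                   , (λ eX → from-X′ (w′ , eX , p)) ]′ (∨-true⁻ {K w′} e₂)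

      cover : ∀ u v → Adj G u v → F ((R ∪ᵇ Z) ∪ᵇ C′) u → F ((R ∪ᵇ Z) ∪ᵇ C′) v →
              (F (R ∪ᵇ Z) u × F (R ∪ᵇ Z) v) ⊎ (F C′ u × F C′ v)
      cover u v e fu fv with F? (R ∪ᵇ Z) u | F? (R ∪ᵇ Z) v
      ... | yes p | yes q = inj₁ (p , q)
      ... | no ¬p | _     = inj₂ (outside u v e fu fv ¬p)
      ... | yes _ | no ¬q = let q , p = outside v u (trans (adj-sym G v u) e) fv fu ¬q in inj₂ (p , q)

      extended : Partial (R ∪ᵇ Z′) R
      extended = weaken to from (attach D D′ X′⊆R meet cover)
        where
        to : ∀ v → ((R ∪ᵇ Z) ∪ᵇ C′) v ≡ true → (R ∪ᵇ Z′) v ≡ true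
        to v e = [ (λ e₁ → [ ∨-trueˡ , (λ z → ∨-trueʳ {R v} (∨-trueˡ z)) ]′ (∨-true⁻ {R v} e₁))
                 , (λ e₂ → [ (λ eK → ∨-trueʳ {R v} (∨-trueʳ {Z v} eK)) , (λ eX → ∨-trueˡ (X′⊆R v eX)) ]′ (∨-true⁻ {K v} e₂)) ]′ (∨-true⁻ {(R ∪ᵇ Z) v} e)
        from : ∀ v → (R ∪ᵇ Z′) v ≡ true → ((R ∪ᵇ Z) ∪ᵇ C′) v ≡ true
        from v e = [ (λ r → ∨-trueˡ {(R ∪ᵇ Z) v} (∨-trueˡ r))
                   , (λ z′ → [ (λ z → ∨-trueˡ {(R ∪ᵇ Z) v} (∨-trueʳ {R v} z)) , (λ eK → ∨-trueʳ {(R ∪ᵇ Z) v} (∨-trueˡ eK)) ]′ (∨-true⁻ {Z v} z′)) ]′ (∨-true⁻ {R v} e)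

      closed′ : Closed Z′
      closed′ = (λ v e → [ proj₁ closed v , K⊆rest v ]′ (∨-true⁻ {Z v} e)) ,
        λ a b e c conn → [ (λ z → ∨-trueˡ (proj₂ closed a b z c conn)) , (λ eK → ∨-trueʳ {Z b} (K-intro c (conn-trans (K-conn eK) conn))) ]′ (∨-true⁻ {Z a} e)

      w∈Z′ : Z′ w ≡ true
      w∈Z′ = ∨-trueʳ {Z w} (K-intro w∈C (conn-refl (inside-intro {w = w} (hit-intro {C} w∈C desc-refl)
               λ w′ h → subst (λ x → rest x ≡ true) (sym (hit-center w w w′ (hit-intro {C} w∈C desc-refl) h)) w∈rest)))

    collect : (∀ w (w∈rest : rest w ≡ true) → Partial (Component.C′ w w∈rest) (Component.X′ w w∈rest)) →
              ∀ l Z → Closed Z → Partial (R ∪ᵇ Z) R →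
              ∃ λ Z′ → Closed Z′ × Partial (R ∪ᵇ Z′) R × (Z ⊆ᵇ Z′) × (∀ w → w ∈ₗ l → rest w ≡ true → Z′ w ≡ true)
    collect child []      Z closed D = Z , closed , D , (λ _ e → e) , λ _ ()
    collect child (w ∷ l) Z closed D = by-cases (true⊎false (rest w)) (true⊎false (Z w))
      where
      Result : Set
      Result = ∃ λ Z′ → Closed Z′ × Partial (R ∪ᵇ Z′) R × (Z ⊆ᵇ Z′) × (∀ v → v ∈ₗ (w ∷ l) → rest v ≡ true → Z′ v ≡ true)
      skip : (rest w ≡ true → Z w ≡ true) → Result
      skip done-w = let Z′ , closed′ , D′ , sub , all = collect child l Z closed D in
        Z′ , closed′ , D′ , sub , λ { v (here refl) r → sub v (done-w r) ; v (there v∈) r → all v v∈ r }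
      by-cases : rest w ≡ true ⊎ rest w ≡ false → Z w ≡ true ⊎ Z w ≡ false → Result
      by-cases (inj₂ r) _        = skip λ r′ → ⊥-elim (true≢false r′ r)
      by-cases (inj₁ r) (inj₁ z) = skip λ _ → z
      by-cases (inj₁ r) (inj₂ z) =
        let Z″ , closed″ , D″ , sub , all = collect child l A.Z′ A.closed′ A.extended
        in Z″ , closed″ , D″ , (λ v e → sub v (∨-trueˡ e)) , λ { v (here refl) _ → sub v A.w∈Z′ ; v (there v∈) r → all v v∈ r }
        where
        module A = AddComponent Z closed D w r z (child w r)

    combine : (∀ w (w∈rest : rest w ≡ true) → Partial (Component.C′ w w∈rest) (Component.X′ w w∈rest)) → Partial C X
    combine child =
      let Z , closed , D , _ , all = collect child (allFin (size G)) (λ _ → false) ((λ _ ()) , λ _ _ ())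
                                       (weaken (λ w e → ∨-trueˡ e) (λ w e → [ id , (λ ()) ]′ (∨-true⁻ {R w} e)) (single R R R≤ (λ _ e → e)))
          D′ = weaken {C′ = C} (λ w e → [ R⊆C w , (λ z → proj₁ (rest-elim (proj₁ closed w z))) ]′ (∨-true⁻ {R w} e))
                 (λ w c → [ ∨-trueˡ , (λ r → ∨-trueʳ {R w} (all w (∈-allFin w) (∧-true c (not-true r)))) ]′ (true⊎false (R w))) D
      in record { T = Partial.T D′ ; chosen = Partial.chosen D′ ; chosen⊆ = Partial.chosen⊆ D′ ; few = Partial.few D′
                ; root⊇ = λ w e → Partial.root⊇ D′ w (∨-trueˡ e) ; vertex = Partial.vertex D′ ; edge = Partial.edge D′
                ; connected = Partial.connected D′ }

  module _ (separators : ∀ C X → Centers C → X ⊆ᵇ C → SeparatorFor C X) where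

    build : ∀ fuel C X → Centers C → X ⊆ᵇ C → # X ≤ B → # (C ∖ X) ≤ fuel → Partial C X
    build fuel C X C-centers X⊆C X≤B le = by-cases fuel le (any? λ w → (C w ≟ᵇ true) ×-dec (X w ≟ᵇ false))
      where
      by-cases : ∀ fuel → # (C ∖ X) ≤ fuel → Dec (∃ λ w → C w ≡ true × X w ≡ false) → Partial C X
      by-cases fuel le (no none) = weaken X⊆C (λ w c → ≢false⇒true λ x → none (w , c , x))
        (single X X (≤-trans X≤B (m≤m+n B (suc s))) (λ _ e → e))
      by-cases zero le (yes (w₀ , c , x)) = ⊥-elim (<⇒≱ (#-pos {P = C ∖ X} (∧-true c (not-true x))) le)
      by-cases (suc fuel) le (yes (w₀ , c , x)) = combine λ w r →
          build fuel (Component.C′ w r) (Component.X′ w r) (λ v e → C-centers v (Component.C′⊆C w r v e))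
            (Component.X′⊆C′ w r) (Component.X′≤B w r) (≤-pred (≤-trans (Component.measure w r) le))
        where
        open Split C X C-centers X⊆C X≤B (separators C X C-centers X⊆C) w₀ c x

-- Numerical estimates

log₂ : ∀ a → 1 ≤ a → ∃ λ e → 2 ^ e ≤ a × a < 2 ^ suc e
log₂ (suc zero)    _ = 0 , s≤s z≤n , s≤s (s≤s z≤n)
log₂ (suc (suc a)) _ with log₂ (suc a) (s≤s z≤n)
... | e , lo , hi with suc (suc a) <?ⁿ 2 ^ suc e
...   | yes lt = e , m≤n⇒m≤1+n lo , lt
...   | no ¬lt = suc e , ≮⇒≥ ¬lt , <-≤-trans (s≤s hi) (≤-trans (m<m+n (2 ^ suc e) (^-pos (suc e) (s≤s (z≤n {1})))) (≤-reflexive (cong (2 ^ suc e +_) (sym (+-identityʳ _)))))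

≤-literal : ∀ a b {_ : Data.Bool.T (a ≤ᵇⁿ b)} → a ≤ b
≤-literal a b {t} = ≤ᵇ⇒≤ a b t

a≤a*b : ∀ a {b} → 1 ≤ b → a ≤ a * b
a≤a*b a {b} b≥1 = ≤-trans (≤-reflexive (sym (*-identityʳ a))) (*-monoʳ-≤ a b≥1)

a≤b*a : ∀ a {b} → 1 ≤ b → a ≤ b * a
a≤b*a a {b} b≥1 = ≤-trans (a≤a*b a b≥1) (≤-reflexive (*-comm a b))

-- E is at most every value K / D considered in BoundExceeded.
bound-monotone : ∀ Q n k d c ℓ g a b p q → 1 ≤ b → 2 ^ ℓ ≤ 2 * n → (2 * n) ^ b ≤ 2 ^ a →
  2 ^ g ≤ 4 * (Q * d * k ^ 2 * ℓ ^ 3) ^ c → (4 * (Q * d * k ^ 2 * a ^ 3) ^ c) ^ q ≤ 2 ^ p * b ^ (3 * c * q) →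
  k * ℓ ^ 2 * (Q * d * k ^ 2 * ℓ ^ 3) ^ c * g * (b ^ (2 + 3 * c) * q) ≤ k * a ^ 2 * (Q * d * k ^ 2 * a ^ 3) ^ c * p
bound-monotone Q n k d c ℓ g a b p q b≥1 lo ha hg hp = begin
  k * ℓ ^ 2 * f * g * (b ^ (2 + 3 * c) * q)          ≡⟨ cong (λ x → k * ℓ ^ 2 * f * g * (x * q)) (^-distribˡ-+-* b 2 (3 * c)) ⟩
  k * ℓ ^ 2 * f * g * (b ^ 2 * b ^ (3 * c) * q)      ≡⟨ e₁ k (ℓ ^ 2) f g (b ^ 2) (b ^ (3 * c)) q ⟩
  k * (ℓ ^ 2 * b ^ 2) * (f * b ^ (3 * c)) * (g * q)  ≤⟨ *-mono-≤ (*-mono-≤ (*-monoʳ-≤ k (≤-trans (≤-reflexive (sym (*-^ 2 ℓ b))) (power-≤ 2 ℓb≤a))) fb≤N) gq≤p ⟩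
  k * a ^ 2 * N * p                                  ∎
  where
  open ≤-Reasoning
  f = (Q * d * k ^ 2 * ℓ ^ 3) ^ c
  N = (Q * d * k ^ 2 * a ^ 3) ^ c
  e₁ : ∀ k l f g b x q → k * l * f * g * (b * x * q) ≡ k * (l * b) * (f * x) * (g * q)
  e₁ = solve-∀
  ℓb≤a : ℓ * b ≤ a
  ℓb≤a = 2^-cancel-≤ (≤-trans (≤-reflexive (sym (^-*-assoc 2 ℓ b))) (≤-trans (power-≤ b lo) ha))
  fb≤N : f * b ^ (3 * c) ≤ N
  fb≤N = begin
    f * b ^ (3 * c)                       ≡⟨ cong (f *_) (sym (^-*-assoc b 3 c)) ⟩
    f * (b ^ 3) ^ c                       ≡⟨ sym (*-^ c (Q * d * k ^ 2 * ℓ ^ 3) (b ^ 3)) ⟩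
    (Q * d * k ^ 2 * ℓ ^ 3 * b ^ 3) ^ c   ≡⟨ cong (_^ c) (trans (*-assoc (Q * d * k ^ 2) (ℓ ^ 3) (b ^ 3)) (cong (Q * d * k ^ 2 *_) (sym (*-^ 3 ℓ b)))) ⟩
    (Q * d * k ^ 2 * (ℓ * b) ^ 3) ^ c     ≤⟨ power-≤ c (*-monoʳ-≤ (Q * d * k ^ 2) (power-≤ 3 ℓb≤a)) ⟩
    N                                     ∎
  gq≤p : g * q ≤ p
  gq≤p = 2^-cancel-≤ (*-cancelʳ-≤ _ _ (b ^ (3 * c * q)) {{Data.Nat.>-nonZero (^-pos (3 * c * q) b≥1)}} (begin
    2 ^ (g * q) * b ^ (3 * c * q)         ≡⟨ cong₂ _*_ (sym (^-*-assoc 2 g q)) (sym (^-*-assoc b (3 * c) q)) ⟩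
    (2 ^ g) ^ q * (b ^ (3 * c)) ^ q       ≡⟨ sym (*-^ q (2 ^ g) (b ^ (3 * c))) ⟩
    (2 ^ g * b ^ (3 * c)) ^ q             ≤⟨ power-≤ q (≤-trans (*-monoˡ-≤ (b ^ (3 * c)) hg) (≤-trans (≤-reflexive (*-assoc 4 f _)) (*-monoʳ-≤ 4 fb≤N))) ⟩
    (4 * N) ^ q                           ≤⟨ hp ⟩
    2 ^ p * b ^ (3 * c * q)               ∎))

-- `ℓ` and `g` do not exceed the true logarithms, so `E` is at most the real quantity; the two
-- alternatives correspond to the two arguments of the maximum.
within-bound : ∀ n k d c x y ℓ g E → E ≡ k * ℓ ^ 2 * (1000000 * d * k ^ 2 * ℓ ^ 3) ^ c * g →
  2 ^ ℓ ≤ 2 * n → 2 ^ g ≤ 4 * (1000000 * d * k ^ 2 * ℓ ^ 3) ^ c →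
  y ≤ x + 5000 * E ⊎ y ≤ 115000 * E → WithinBound n k d c x y
within-bound n k d c x y ℓ g E E≡ lo hg y≤ (a , b , p , q , b≥1 , q≥1 , ha , hp , h₁ , h₂) =
  refute x y E (b ^ (2 + 3 * c) * q) (k * a ^ 2 * (1000000 * d * k ^ 2 * a ^ 3) ^ c * p) 5000 115000 y≤
    (≤-trans (≤-reflexive (cong (_* (b ^ (2 + 3 * c) * q)) E≡)) (bound-monotone 1000000 n k d c ℓ g a b p q b≥1 lo ha hg hp)) h₁ h₂
  where
  refute : ∀ x y E D K c₁ c₂ → y ≤ x + c₁ * E ⊎ y ≤ c₂ * E → E * D ≤ K → x * D + c₁ * K < y * D → c₂ * K < y * D → ⊥
  refute x y E D K c₁ c₂ (inj₁ le) ED h₁ h₂ = <⇒≱ h₁ (≤-trans (*-monoˡ-≤ D le) (≤-trans (≤-reflexive (*-distribʳ-+ D x (c₁ * E)))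
    (+-monoʳ-≤ (x * D) (≤-trans (≤-reflexive (*-assoc c₁ E D)) (*-monoʳ-≤ c₁ ED)))))
  refute x y E D K c₁ c₂ (inj₂ le) ED h₁ h₂ = <⇒≱ h₂ (≤-trans (*-monoˡ-≤ D le) (≤-trans (≤-reflexive (*-assoc c₂ E D)) (*-monoʳ-≤ c₂ ED)))

-- For t = 25 + 3b the increment 6t + 9 of the square is at most t², so the left side at most
-- doubles with each step.
square-≤-exp : ∀ b → (25 + 3 * b) * (25 + 3 * b) ≤ 1300 * 2 ^ b
square-≤-exp zero    = ≤-literal 625 1300
square-≤-exp (suc b) = begin
  (25 + 3 * suc b) * (25 + 3 * suc b)      ≡⟨ e₁ b ⟩
  t * t + (6 * t + 9)                      ≤⟨ +-monoʳ-≤ (t * t) small ⟩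
  t * t + t * t                            ≤⟨ +-mono-≤ (square-≤-exp b) (square-≤-exp b) ⟩
  1300 * 2 ^ b + 1300 * 2 ^ b              ≡⟨ e₂ 1300 (2 ^ b) ⟩
  1300 * (2 * 2 ^ b)                       ∎
  where
  open ≤-Reasoning
  t = 25 + 3 * b
  e₁ : ∀ b → (25 + 3 * suc b) * (25 + 3 * suc b) ≡ (25 + 3 * b) * (25 + 3 * b) + (6 * (25 + 3 * b) + 9)
  e₁ = solve-∀
  e₂ : ∀ c x → c * x + c * x ≡ c * (2 * x)
  e₂ = solve-∀
  small : 6 * t + 9 ≤ t * t
  small = ≤-trans (+-monoʳ-≤ (6 * t) (≤-trans (≤-literal 9 25) (m≤m+n 25 (3 * b))))
    (≤-trans (≤-reflexive (+-comm (6 * t) t)) (*-monoˡ-≤ t {7} {t} (≤-trans (≤-literal 7 25) (m≤m+n 25 (3 * b)))))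

linear-≤-exp : ∀ i → 2 * (5 + i) ≤ 2 ^ (4 + i)
linear-≤-exp zero    = ≤-literal 10 16
linear-≤-exp (suc i) = begin
  2 * (5 + suc i)               ≡⟨ e i ⟩
  2 * (5 + i) + 2               ≤⟨ +-mono-≤ (linear-≤-exp i) (≤-trans (≤-trans (s≤s (s≤s z≤n)) (m≤m+n 2 (3 + i + (5 + i + 0)))) (≤-trans (≤-reflexive (e′ i)) (linear-≤-exp i))) ⟩
  2 ^ (4 + i) + 2 ^ (4 + i)     ≡⟨ cong (2 ^ (4 + i) +_) (sym (+-identityʳ _)) ⟩
  2 ^ (5 + i)                   ∎
  where
  open ≤-Reasoning
  e : ∀ i → 2 * (5 + suc i) ≡ 2 * (5 + i) + 2
  e = solve-∀
  e′ : ∀ i → 2 + (3 + i + (5 + i + 0)) ≡ 2 * (5 + i)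
  e′ = solve-∀

-- `Q` stands for 1000000 and `v` for 22, as 4000000 ≤ 2^22; the bound 750000 is what the case c = 1
-- consumes. `f<n` holds because the other case is settled by a single bag.
module Parameters (Q : ℕ) (Q≥ : 750000 ≤ Q) (v : ℕ) (v≤22 : v ≤ 22) (Q≤ : 4 * Q ≤ 2 ^ v) (n k d c ℓ g : ℕ)
  (c≥1 : 1 ≤ c) (d≥1 : 1 ≤ d) (k≥1 : 1 ≤ k) (ℓ≥1 : 1 ≤ ℓ) (n<2^ℓ : n < 2 ^ ℓ)
  (g-lower : 2 ^ g ≤ 4 * (Q * d * k ^ 2 * ℓ ^ 3) ^ c) (g-upper : 4 * (Q * d * k ^ 2 * ℓ ^ 3) ^ c < 2 ^ suc g)
  (f<n : (Q * d * k ^ 2 * ℓ ^ 3) ^ c < n) where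

  private
    P F f : ℕ
    P = d * k ^ 2 * ℓ ^ 3
    F = Q * d * k ^ 2 * ℓ ^ 3
    f = F ^ c

    open ≤-Reasoning

    F≡ : F ≡ Q * P
    F≡ = e Q d (k ^ 2) (ℓ ^ 3)
      where
      e : ∀ Q d k l → Q * d * k * l ≡ Q * (d * k * l)
      e = solve-∀

    d*k²≥1 : 1 ≤ d * k ^ 2
    d*k²≥1 = *-pos d≥1 (^-pos 2 k≥1)

    F≥Qℓ : Q * ℓ ≤ F
    F≥Qℓ = ≤-trans (*-monoʳ-≤ Q (≤-trans (a≤b*a ℓ d*k²≥1) (*-monoʳ-≤ (d * k ^ 2) (a≤a*b ℓ (^-pos 2 ℓ≥1))))) (≤-reflexive (sym F≡))

    Q≥1 : 1 ≤ Q
    Q≥1 = ≤-trans (≤-literal 1 750000) Q≥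

    F≥Q : Q ≤ F
    F≥Q = ≤-trans (a≤a*b Q ℓ≥1) F≥Qℓ

    f≥F : F ≤ f
    f≥F = ≤-trans (≤-reflexive (sym (*-identityʳ F))) (^-monoʳ-≤ F {{Data.Nat.>-nonZero (≤-trans Q≥1 F≥Q)}} c≥1)

    f<2^ℓ : f < 2 ^ ℓ
    f<2^ℓ = <-trans f<n n<2^ℓ

    ℓ≥4 : 4 ≤ ℓ
    ℓ≥4 = 2^-cancel-≤ (≤-trans (≤-trans (≤-literal 16 750000) Q≥) (≤-trans F≥Q (≤-trans f≥F (<⇒≤ f<2^ℓ))))

    g≤ : g ≤ suc ℓ
    g≤ = ≤-pred (2^-cancel-< (begin-strict
      2 ^ g            ≤⟨ g-lower ⟩
      4 * f            <⟨ *-monoʳ-< 4 f<2^ℓ ⟩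
      4 * 2 ^ ℓ        ≡⟨ *-assoc 2 2 (2 ^ ℓ) ⟩
      2 ^ suc (suc ℓ)  ∎))
      where
      2^-cancel-< : ∀ {x y} → 2 ^ x < 2 ^ y → x < y
      2^-cancel-< lt = ≰⇒> λ le → <⇒≱ lt (^-monoʳ-≤ 2 le)

    g≤2ℓ : g ≤ 2 * ℓ
    g≤2ℓ = ≤-trans g≤ (≤-trans (+-monoˡ-≤ ℓ ℓ≥1) (≤-reflexive (cong (ℓ +_) (sym (+-identityʳ ℓ)))))

  g≥2 : 2 ≤ g
  g≥2 = ≤-pred (2^-cancel-≤ {3} (≤-trans (*-monoʳ-≤ 4 {2} (≤-trans (≤-trans (≤-literal 2 750000) Q≥) (≤-trans F≥Q f≥F))) (<⇒≤ g-upper)))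

  f>0 : 0 < f
  f>0 = ≤-trans Q≥1 (≤-trans F≥Q f≥F)

  g-small : 2 * g ≤ 2 ^ ℓ
  g-small = ≤-trans (*-monoʳ-≤ 2 g≤) (exp ℓ ℓ≥4)
    where
    exp : ∀ ℓ → 4 ≤ ℓ → 2 * suc ℓ ≤ 2 ^ ℓ
    exp (suc (suc (suc (suc i)))) _ = linear-≤-exp i
    exp zero ()
    exp (suc zero) (s≤s ())
    exp (suc (suc zero)) (s≤s (s≤s ()))
    exp (suc (suc (suc zero))) (s≤s (s≤s (s≤s ())))

  private
    γ Δ : ℕ
    γ = g * (4 * ℓ)
    Δ = 4 * d + γ * suc (k + k)

    Δ≤ : Δ ≤ 4 * d + 12 * (g * ℓ * k)
    Δ≤ = +-monoʳ-≤ (4 * d) (≤-trans (*-monoʳ-≤ γ (+-monoˡ-≤ (k + k) k≥1)) (≤-reflexive (e g ℓ k)))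
      where
      e : ∀ g ℓ k → g * (4 * ℓ) * (k + (k + k)) ≡ 12 * (g * ℓ * k)
      e = solve-∀

    Δ>0 : 0 < Δ
    Δ>0 = ≤-trans (*-pos (s≤s (z≤n {3})) d≥1) (m≤m+n (4 * d) _)

    ℓ²≤ℓ³ : ℓ * ℓ ≤ ℓ ^ 3
    ℓ²≤ℓ³ = ≤-trans (≤-reflexive (sym (cong (ℓ *_) (*-identityʳ ℓ)))) (^-monoʳ-≤ ℓ {{Data.Nat.>-nonZero ℓ≥1}} (s≤s (s≤s (z≤n {1}))))

    first : d * (ℓ * g) ≤ 2 * P
    first = begin
      d * (ℓ * g)               ≤⟨ *-monoʳ-≤ d (*-monoʳ-≤ ℓ g≤2ℓ) ⟩
      d * (ℓ * (2 * ℓ))         ≡⟨ e d ℓ ⟩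
      2 * (d * (ℓ * ℓ))         ≤⟨ *-monoʳ-≤ 2 (*-mono-≤ (a≤a*b d (^-pos 2 k≥1)) ℓ²≤ℓ³) ⟩
      2 * P                     ∎
      where
      e : ∀ d ℓ → d * (ℓ * (2 * ℓ)) ≡ 2 * (d * (ℓ * ℓ))
      e = solve-∀

    y : ℕ
    y = d * k * ℓ

    y≥1 : 1 ≤ y
    y≥1 = *-pos (*-pos d≥1 k≥1) ℓ≥1

    P≤y³ : P ≤ y ^ 3
    P≤y³ = begin
      d * k ^ 2 * ℓ ^ 3         ≤⟨ *-monoˡ-≤ (ℓ ^ 3) (*-mono-≤ (≤-trans (≤-reflexive (sym (*-identityʳ d))) (^-monoʳ-≤ d {{Data.Nat.>-nonZero d≥1}} (s≤s (z≤n {2})))) (^-monoʳ-≤ k {{Data.Nat.>-nonZero k≥1}} (s≤s (s≤s (z≤n {1}))))) ⟩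
      d ^ 3 * k ^ 3 * ℓ ^ 3     ≡⟨ sym (trans (*-^ 3 (d * k) ℓ) (cong (_* ℓ ^ 3) (*-^ 3 d k))) ⟩
      y ^ 3                     ∎

    -- For c = 1 the load is compensated by log² y ≤ C y, for c ≥ 2 by the exponent.
    g²-1 : 2 ^ g ≤ 4 * F → g * g ≤ 1300 * y
    g²-1 g-lower = from-log (log₂ y y≥1)
      where
      e : ∀ b → 22 + suc b * 3 ≡ 25 + 3 * b
      e = solve-∀
      from-log : (∃ λ b → 2 ^ b ≤ y × y < 2 ^ suc b) → g * g ≤ 1300 * y
      from-log (b , lo , hi) = ≤-trans (*-mono-≤ g< g<) (≤-trans (square-≤-exp b) (*-monoʳ-≤ 1300 lo))
        where
        -- 2^g ≤ 4QP ≤ 2^22 y³ and y < 2^(b+1), whence 25 = 22 + 3.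
        g< : g ≤ 25 + 3 * b
        g< = ≤-trans (2^-cancel-≤ (begin
          2 ^ g                              ≤⟨ g-lower ⟩
          4 * F                              ≡⟨ cong (4 *_) F≡ ⟩
          4 * (Q * P)                        ≡⟨ sym (*-assoc 4 Q P) ⟩
          4 * Q * P                          ≤⟨ *-mono-≤ Q≤ P≤y³ ⟩
          2 ^ v * y ^ 3                      ≤⟨ *-monoʳ-≤ (2 ^ v) (power-≤ 3 (<⇒≤ hi)) ⟩
          2 ^ v * (2 ^ suc b) ^ 3            ≡⟨ cong (2 ^ v *_) (^-*-assoc 2 (suc b) 3) ⟩
          2 ^ v * 2 ^ (suc b * 3)            ≡⟨ sym (^-distribˡ-+-* 2 v (suc b * 3)) ⟩
          2 ^ (v + suc b * 3)                ∎)) (≤-trans (+-monoˡ-≤ (suc b * 3) v≤22) (≤-reflexive (e b)))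

    -- With Δ ≤ 4d + 12gℓk the product splits into 192·dℓg ≤ 384 P and 576·kℓ²g² ≤ 576·1300 P,
    -- together 749184 P.
    key-1 : 2 ^ g ≤ 4 * F → 48 * (ℓ * g) * Δ ≤ F
    key-1 g-lower = ≤-trans (combine 48 4 12 1300 Δ≤ first (g²-1 g-lower) (≤-trans (≤-literal 749184 750000) Q≥)) (≤-reflexive (sym F≡))
      where
      combine : ∀ a b c C → Δ ≤ b * d + c * (g * ℓ * k) → d * (ℓ * g) ≤ 2 * P → g * g ≤ C * y → a * b * 2 + a * c * C ≤ Q → a * (ℓ * g) * Δ ≤ Q * P
      combine a b c C Δ≤ p q r = begin
        a * (ℓ * g) * Δ                                          ≤⟨ *-monoʳ-≤ (a * (ℓ * g)) Δ≤ ⟩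
        a * (ℓ * g) * (b * d + c * (g * ℓ * k))                  ≡⟨ e₁ a b c ℓ g d k ⟩
        a * b * (d * (ℓ * g)) + a * c * (k * (ℓ * ℓ) * (g * g))  ≤⟨ +-mono-≤ (*-monoʳ-≤ (a * b) p) (*-monoʳ-≤ (a * c) (≤-trans (*-monoʳ-≤ (k * (ℓ * ℓ)) q) (≤-reflexive (e₃ C d k ℓ)))) ⟩
        a * b * (2 * P) + a * c * (C * P)                        ≡⟨ e₂ (a * b) (a * c) C P ⟩
        (a * b * 2 + a * c * C) * P                              ≤⟨ *-monoˡ-≤ P r ⟩
        Q * P                                                    ∎
        where
        e₁ : ∀ a b c ℓ g d k → a * (ℓ * g) * (b * d + c * (g * ℓ * k)) ≡ a * b * (d * (ℓ * g)) + a * c * (k * (ℓ * ℓ) * (g * g))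
        e₁ = solve-∀
        e₂ : ∀ a b c P → a * (2 * P) + b * (c * P) ≡ (a * 2 + b * c) * P
        e₂ = solve-∀
        e₃ : ∀ C d k ℓ → k * (ℓ * ℓ) * (C * (d * k * ℓ)) ≡ C * (d * (k * (k * 1)) * (ℓ * (ℓ * (ℓ * 1))))
        e₃ = solve-∀

    -- For c ≥ 2 the crude g ≤ 2ℓ suffices: 48ℓg ≤ (100ℓ)² ≤ (100ℓ)^c goes under the exponent, and
    -- 100ℓΔ ≤ 2800 P ≤ F.
    key-2 : ∀ c′ → c ≡ 2 + c′ → 48 * (ℓ * g) * Δ ^ c ≤ f
    key-2 c′ refl = begin
      48 * (ℓ * g) * Δ ^ c                ≤⟨ *-monoˡ-≤ (Δ ^ c) (≤-trans (*-monoʳ-≤ 48 (*-monoʳ-≤ ℓ g≤2ℓ)) (≤-reflexive (e₁ 48 ℓ))) ⟩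
      48 * 2 * (ℓ * ℓ) * Δ ^ c            ≤⟨ *-monoˡ-≤ (Δ ^ c) (≤-trans (*-monoˡ-≤ (ℓ * ℓ) {48 * 2} {100 * 100} (≤-literal 96 10000)) (≤-reflexive (e₂ 100 ℓ))) ⟩
      (100 * ℓ) ^ 2 * Δ ^ c               ≤⟨ *-monoˡ-≤ (Δ ^ c) (^-monoʳ-≤ (100 * ℓ) {{Data.Nat.>-nonZero (*-pos (s≤s (z≤n {99})) ℓ≥1)}} (m≤m+n 2 c′)) ⟩
      (100 * ℓ) ^ c * Δ ^ c               ≡⟨ sym (*-^ c (100 * ℓ) Δ) ⟩
      (100 * ℓ * Δ) ^ c                   ≤⟨ power-≤ c ΔF ⟩
      f                                   ∎
      where
      e₁ : ∀ a ℓ → a * (ℓ * (2 * ℓ)) ≡ a * 2 * (ℓ * ℓ)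
      e₁ = solve-∀
      e₂ : ∀ C ℓ → C * C * (ℓ * ℓ) ≡ (C * ℓ) * ((C * ℓ) * 1)
      e₂ = solve-∀
      ΔF : 100 * ℓ * Δ ≤ F
      ΔF = begin
        100 * ℓ * Δ                                       ≤⟨ *-monoʳ-≤ (100 * ℓ) (≤-trans Δ≤ (+-monoʳ-≤ (4 * d) (*-monoʳ-≤ 12 (*-monoˡ-≤ k (*-monoˡ-≤ ℓ g≤2ℓ))))) ⟩
        100 * ℓ * (4 * d + 12 * (2 * ℓ * ℓ * k))          ≡⟨ e₃ 100 ℓ d k ⟩
        100 * (4 * (d * ℓ) + 24 * (k * (ℓ * ℓ * ℓ)))      ≤⟨ *-monoʳ-≤ 100 (+-mono-≤ (*-monoʳ-≤ 4 (*-mono-≤ (a≤a*b d (^-pos 2 k≥1)) (a≤a*b ℓ (^-pos 2 ℓ≥1)))) (*-monoʳ-≤ 24 kℓ³≤P)) ⟩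
        100 * (4 * P + 24 * P)                            ≡⟨ e₄ 100 P ⟩
        100 * 28 * P                                      ≤⟨ *-monoˡ-≤ P {100 * 28} {Q} (≤-trans (≤-literal 2800 750000) Q≥) ⟩
        Q * P                                             ≡⟨ sym F≡ ⟩
        F                                                 ∎
        where
        e₃ : ∀ C ℓ d k → C * ℓ * (4 * d + 12 * (2 * ℓ * ℓ * k)) ≡ C * (4 * (d * ℓ) + 24 * (k * (ℓ * ℓ * ℓ)))
        e₃ = solve-∀
        e₄ : ∀ C P → C * (4 * P + 24 * P) ≡ C * 28 * P
        e₄ = solve-∀
        cube : ∀ ℓ → ℓ * ℓ * ℓ ≡ ℓ * (ℓ * (ℓ * 1))
        cube = solve-∀
        kℓ³≤P : k * (ℓ * ℓ * ℓ) ≤ P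
        kℓ³≤P = *-mono-≤ (≤-trans (a≤a*b k (≤-trans k≥1 (≤-reflexive (sym (*-identityʳ k))))) (a≤b*a (k ^ 2) d≥1)) (≤-reflexive (cube ℓ))

    key : 48 * (ℓ * g) * Δ ^ c ≤ f
    key = by-cases c refl c≥1
      where
      by-cases : ∀ c₀ → c ≡ c₀ → 1 ≤ c₀ → 48 * (ℓ * g) * Δ ^ c ≤ f
      by-cases (suc zero) refl _ = ≤-trans (*-monoʳ-≤ (48 * (ℓ * g)) (≤-reflexive (*-identityʳ Δ))) (≤-trans (key-1 (≤-trans g-lower (*-monoʳ-≤ 4 (≤-reflexive (*-identityʳ F))))) (≤-reflexive (sym (*-identityʳ F))))
      by-cases (suc (suc c′)) e _ = key-2 c′ e

    2f<2^g : 2 * f < 2 ^ g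
    2f<2^g = *-cancelˡ-< 2 _ _ (≤-<-trans (≤-reflexive (sym (*-assoc 2 2 f))) g-upper)

  -- Bounding Δ^c + 1 by 2Δ^c turns the left side into 96ℓg Δ^c, at most 2f, and 2^g exceeds half of
  -- 4f.
  large : 12 * (suc ((4 * d + g * (4 * ℓ) * suc (k + k)) ^ c) * (g * (4 * ℓ))) < 2 ^ g
  large = begin-strict
    12 * (suc (Δ ^ c) * γ)             ≤⟨ *-monoʳ-≤ 12 (*-monoˡ-≤ γ (+-monoˡ-≤ (Δ ^ c) (^-pos c Δ>0))) ⟩
    12 * ((Δ ^ c + Δ ^ c) * γ)         ≡⟨ e 12 (Δ ^ c) g ℓ ⟩
    2 * (12 * 4 * (ℓ * g) * Δ ^ c)     ≤⟨ *-monoʳ-≤ 2 key ⟩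
    2 * f                              <⟨ 2f<2^g ⟩
    2 ^ g                              ∎
    where
    e : ∀ a x g ℓ → a * ((x + x) * (g * (4 * ℓ))) ≡ 2 * (a * 4 * (ℓ * g) * x)
    e = solve-∀

  module _ (h : ℕ) (g≡ : g ≡ suc h) where

    private
      2^h≤2f : 2 ^ h ≤ 2 * f
      2^h≤2f = *-cancelˡ-≤ 2 (≤-trans (≤-reflexive (cong (2 ^_) (sym g≡))) (≤-trans g-lower (≤-reflexive (*-assoc 2 2 f))))

      f≤2^h : f ≤ 2 ^ h
      f≤2^h = *-cancelˡ-≤ 2 (≤-trans (<⇒≤ 2f<2^g) (≤-reflexive (cong (2 ^_) g≡)))

      division : ∃ λ q → 2 ^ h ≤ suc q * (2 * ℓ) × q * (2 * ℓ) ≤ 2 ^ h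
      division = quotient (2 ^ h) (2 * ℓ) (*-pos (s≤s (z≤n {1})) ℓ≥1)

    -- About 2^h/(2ℓ). A direction of the cube has 2^h edges, each meeting a given member with
    -- probability at most 1/(2μ), so the expected load is at most ℓ; a larger μ would enlarge the
    -- separator.
    μ : ℕ
    μ = suc (proj₁ division)

    μ-lower : 2 ^ h ≤ 2 * μ * ℓ
    μ-lower = ≤-trans (proj₁ (proj₂ division)) (≤-reflexive (e μ ℓ))
      where
      e : ∀ μ ℓ → μ * (2 * ℓ) ≡ 2 * μ * ℓ
      e = solve-∀

    private
      μℓ≤2^h : μ * ℓ ≤ 2 ^ h
      μℓ≤2^h = *-cancelˡ-≤ 2 (begin
        2 * (μ * ℓ)                              ≡⟨ e (proj₁ division) ℓ ⟩
        2 * ℓ + proj₁ division * (2 * ℓ)         ≤⟨ +-mono-≤ (≤-trans (*-monoˡ-≤ ℓ (≤-trans (≤-literal 2 750000) Q≥)) (≤-trans F≥Qℓ (≤-trans f≥F f≤2^h))) (proj₂ (proj₂ division)) ⟩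
        2 ^ h + 2 ^ h                            ≡⟨ cong (2 ^ h +_) (sym (+-identityʳ (2 ^ h))) ⟩
        2 * 2 ^ h                                ∎)
        where
        e : ∀ q ℓ → 2 * (suc q * ℓ) ≡ 2 * ℓ + q * (2 * ℓ)
        e = solve-∀

    -- Here σ = 12μ, and μℓ ≤ 2^h ≤ 2f leaves the factors 4 + 2ℓ ≤ 3ℓ and 25 + 24ℓ ≤ 31ℓ, both valid
    -- for ℓ ≥ 4; the constant is 8928.
    separator-size : ∀ A → A ≡ f * ℓ ^ 2 → ∀ C → C ≡ 2 * 2 * 4 * 6 * 3 * (7 + 24) → scaled-separator-size (2 * (6 * μ)) ℓ ≤ C * A
    separator-size A A≡ C C≡ = ≤-trans bounded (≤-reflexive (sym (cong₂ _*_ C≡ A≡)))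
      where
      bounded : scaled-separator-size (2 * (6 * μ)) ℓ ≤ 2 * 2 * 4 * 6 * 3 * (7 + 24) * (f * ℓ ^ 2)
      bounded = *-cancelˡ-≤ 2 (begin
        2 * (2 * (4 * (2 * (6 * μ)) * (2 + ℓ)) * (ℓ + ℓ * (24 * suc ℓ))) ≡⟨ e₁ 6 4 24 μ ℓ ⟩
        2 * 2 * 4 * 6 * (μ * ℓ) * ((4 + 2 * ℓ) * (25 + 24 * ℓ)) ≤⟨ *-mono-≤ (*-monoʳ-≤ (2 * 2 * 4 * 6) (≤-trans μℓ≤2^h 2^h≤2f)) (*-mono-≤ (+-monoˡ-≤ (2 * ℓ) ℓ≥4) (+-monoˡ-≤ (24 * ℓ) (≤-trans (≤-literal 25 28) (*-monoʳ-≤ 7 ℓ≥4)))) ⟩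
        2 * 2 * 4 * 6 * (2 * f) * ((ℓ + 2 * ℓ) * (7 * ℓ + 24 * ℓ)) ≡⟨ e₂ (2 * 2 * 4 * 6) 7 24 f ℓ ⟩
        2 * (2 * 2 * 4 * 6 * 3 * (7 + 24) * (f * ℓ ^ 2)) ∎)
        where
        e₁ : ∀ a b c μ ℓ → 2 * (2 * (b * (2 * (a * μ)) * (2 + ℓ)) * (ℓ + ℓ * (c * suc ℓ))) ≡ 2 * 2 * b * a * (μ * ℓ) * ((4 + 2 * ℓ) * (1 + c + c * ℓ))
        e₁ = solve-∀
        e₂ : ∀ C a b f ℓ → C * (2 * f) * ((ℓ + 2 * ℓ) * (a * ℓ + b * ℓ)) ≡ 2 * (C * 3 * (a + b) * (f * (ℓ * (ℓ * 1))))
        e₂ = solve-∀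

-- Choice of the parameters and assembly

module Main (c d : ℕ) (c≥1 : 1 ≤ c) (d≥1 : 1 ≤ d) (𝒞 : Graph → Set) (hereditary : ClosedUnderInducedSubgraphs 𝒞)
  (tw≤ : ∀ G′ → 𝒞 G′ → TreewidthAtMost G′ (maxDegree G′ ^ c)) (G : Graph) (G∈𝒞 : 𝒞 G) (k : ℕ) (k≥1 : 1 ≤ k)
  (m : ℕ) (layer : V G → Fin m) (wit : NeighborhoodWitnessing G layer (4 * d)) (thin : ThicknessAtMost G layer k)
  (X : Subset (size G)) (X-centers : ∀ w → w ∈ X → IsCenter G layer w) where

  open Layered G layer

  Goal : Set
  Goal = Σ (RootedTreeDecomposition G) λ D →
    (∀ w → w ∈ X → ∀ v → Desc G layer w v → v ∈ bag D (root (tree D)))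
    × (∀ x → ∃ λ (X′ : Subset (size G)) →
    (∀ w → w ∈ X′ → IsCenter G layer w)
    × WithinBound (size G) k d c ∣ X ∣ ∣ X′ ∣
    × (∀ v → v ∈ bag D x → ∃ λ w → w ∈ X′ × Desc G layer w v)
    × (∀ v → (∃ λ w → w ∈ X′ × Desc G layer w v) → v ∈ bag D x))

  centers Xᵇ : V G → Bool
  centers w = ⌊ center? w ⌋
  Xᵇ = lookup X

  centers-sound : ∀ w → centers w ≡ true → IsCenter G layer w
  centers-sound w = ⌊⌋-true⁻ {P? = center? w}

  Xᵇ⊆ : Xᵇ ⊆ᵇ centers
  Xᵇ⊆ w e = ⌊⌋-true (center? w) (X-centers w (lookup⇒[]= w X e))

  ∈-tabulate⁺ : ∀ {P : V G → Bool} {v} → P v ≡ true → v ∈ tabulate P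
  ∈-tabulate⁺ {P} {v} e = lookup⇒[]= v (tabulate P) (trans (lookup∘tabulate P v) e)

  ∈-tabulate⁻ : ∀ {P : V G → Bool} {v} → v ∈ tabulate P → P v ≡ true
  ∈-tabulate⁻ {P} {v} v∈ = trans (sym (lookup∘tabulate P v)) ([]=⇒lookup v∈)

  module Finish (s g B : ℕ) (g>0 : 0 < g) (B≥ : g * suc s ≤ B) where

    open Recursion G layer thin s g B g>0 B≥ public

    finish : (D : Partial centers Xᵇ) → (∀ x → WithinBound (size G) k d c ∣ X ∣ (# (Partial.chosen D x))) → Goal
    finish D within = decomposition ,
      (λ w w∈ v p → bag⁺ (w , root⊇ w ([]=⇒lookup w∈) , p)) ,
      λ x → tabulate (chosen x) , (λ w w∈ → centers-sound w (chosen⊆ x w (∈-tabulate⁻ w∈))) ,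
        subst (WithinBound (size G) k d c ∣ X ∣) (sym (∣tabulate∣ (chosen x))) (within x) ,
        (λ v v∈ → let w , e , p = bag⁻ v∈ in w , ∈-tabulate⁺ e , p) ,
        (λ v (w , w∈ , p) → bag⁺ (w , ∈-tabulate⁻ w∈ , p))
      where
      open Partial D
      bag′ : Fin (nodes T) → Subset (size G)
      bag′ x = tabulate (λ v → ⌊ F? (chosen x) v ⌋)
      bag⁺ : ∀ {x v} → F (chosen x) v → v ∈ bag′ x
      bag⁺ {x} {v} f = ∈-tabulate⁺ (⌊⌋-true (F? (chosen x) v) f)
      bag⁻ : ∀ {x v} → v ∈ bag′ x → F (chosen x) v
      bag⁻ {x} {v} v∈ = ⌊⌋-true⁻ {P? = F? (chosen x) v} (∈-tabulate⁻ v∈)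
      everywhere : ∀ v → F centers v
      everywhere v = let u , cu , p = center-above v in u , ⌊⌋-true (center? u) cu , p
      lift : ∀ {v x y} → PathWithin T (λ z → F (chosen z) v) x y → PathWithin T (λ z → v ∈ bag′ z) x y
      lift (here p)     = here (bag⁺ p)
      lift (step p a w) = step (bag⁺ p) a (lift w)
      decomposition : RootedTreeDecomposition G
      decomposition = record
        { tree = T
        ; bag  = bag′
        ; vertex-cover  = λ v → let x , f = vertex v (everywhere v) in x , bag⁺ f
        ; edge-cover    = λ u v a → let x , p , q = edge u v a (everywhere u) (everywhere v) in x , bag⁺ p , bag⁺ q
        ; bag-connected = λ v x y p q → lift (connected v x y (bag⁻ p) (bag⁻ q))
        }

  one-bag : WithinBound (size G) k d c ∣ X ∣ (# centers) → Goal
  one-bag within = finish (single centers Xᵇ (≤-trans (#≤n centers) (≤-trans (n≤1+n (size G)) (m≤m+n (suc (size G)) 1))) Xᵇ⊆) (λ _ → within)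
    -- `B` is so large that a bag of all centers is admissible.
    where open Finish 0 1 (suc (size G)) (s≤s z≤n) (s≤s z≤n)

  treewidth : ∀ P Δ → (∀ v → P v ≡ true → # (λ u → P u ∧ adj G v u) ≤ Δ) → SubsetDecomposition G P (Δ ^ c)
  treewidth P Δ deg = subset-decomposition (power-≤ c (maxDegree≤ Δ deg)) (tw≤ H (hereditary G H G∈𝒞 induced))
    where open Induced G P

  separator-cost : ∀ a b C s A g E → s ≤ b * A → 1 ≤ A → A * g ≤ E → a * suc b ≤ C → a * g * suc s ≤ C * E
  separator-cost a b C s A g E s≤ A≥1 Ag≤E ab≤C = begin
    a * g * suc s          ≤⟨ *-monoʳ-≤ (a * g) (+-mono-≤ A≥1 s≤) ⟩
    a * g * (suc b * A)    ≡⟨ e a g (suc b) A ⟩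
    a * suc b * (A * g)    ≤⟨ *-mono-≤ ab≤C Ag≤E ⟩
    C * E                  ∎
    where
    open ≤-Reasoning
    e : ∀ a g b A → a * g * (b * A) ≡ a * b * (A * g)
    e = solve-∀

  either-bound : ∀ y x C₁ C₂ C₃ E t → C₁ + C₂ ≡ C₃ → y ≤ x ⊔ C₁ * E + t → t ≤ C₂ * E → y ≤ x + C₂ * E ⊎ y ≤ C₃ * E
  either-bound y x C₁ C₂ C₃ E t eq y≤ t≤ = [ (λ le → inj₂ (≤-trans y≤ (≤-trans (+-mono-≤ (⊔-lub le ≤-refl) t≤)
                                                 (≤-reflexive (trans (sym (*-distribʳ-+ E C₁ C₂)) (cong (_* E) eq))))))
                                           , (λ ge → inj₁ (≤-trans y≤ (+-mono-≤ (⊔-lub ≤-refl ge) t≤))) ]′ (≤-total x (C₁ * E))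

  module Large (ℓ h : ℕ) (ℓ≥1 : 1 ≤ ℓ) (2^ℓ≤ : 2 ^ ℓ ≤ 2 * size G) (n<2^ℓ : size G < 2 ^ ℓ)
    (g-lower : 2 ^ suc h ≤ 4 * (1000000 * d * k ^ 2 * ℓ ^ 3) ^ c) (g-upper : 4 * (1000000 * d * k ^ 2 * ℓ ^ 3) ^ c < 2 ^ suc (suc h))
    (f<n : (1000000 * d * k ^ 2 * ℓ ^ 3) ^ c < size G) where

    private
      module Param = Parameters 1000000 (≤-literal 750000 1000000) 22 ≤-refl (≤-literal 4000000 4194304) (size G) k d c ℓ (suc h)
        c≥1 d≥1 k≥1 ℓ≥1 n<2^ℓ g-lower g-upper f<n

    f E A s B : ℕ
    f = (1000000 * d * k ^ 2 * ℓ ^ 3) ^ c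
    E = k * ℓ ^ 2 * f * suc h
    A = f * ℓ ^ 2
    s = scaled-separator-size (2 * (6 * Param.μ h refl)) ℓ
    B = # Xᵇ ⊔ 110000 * E

    A≥1 : 1 ≤ A
    A≥1 = *-pos Param.f>0 (^-pos 2 ℓ≥1)

    Ag≤E : A * suc h ≤ E
    Ag≤E = *-monoˡ-≤ (suc h) (≤-trans (≤-reflexive (*-comm f (ℓ ^ 2))) (*-monoˡ-≤ f (a≤b*a (ℓ ^ 2) k≥1)))

    -- The left side is at most 8·(8928 + 1) = 71432 times `E`, within the 110000 available.
    B≥ : 8 * suc h * suc s ≤ B
    B≥ = ≤-trans (separator-cost 8 8928 110000 s A (suc h) E (Param.separator-size h refl A refl 8928 refl) A≥1 Ag≤E (≤-literal 71432 110000)) (m≤n⊔m (# Xᵇ) (110000 * E))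

    -- Since `suc h` is at least 2, twice s + 1 is at most (h+1)(s+1), hence at most 8929 times `E`.
    s≤ : suc s ≤ 5000 * E
    s≤ = *-cancelˡ-≤ 2 (≤-trans (≤-trans (*-monoˡ-≤ (suc s) Param.g≥2) (≤-reflexive (cong (_* suc s) (sym (*-identityˡ (suc h))))))
      (≤-trans (separator-cost 1 8928 10000 s A (suc h) E (Param.separator-size h refl A refl 8928 refl) A≥1 Ag≤E (≤-literal 8929 10000))
        (≤-reflexive (e 2 5000 10000 E refl))))
      where
      e : ∀ a b C E → a * b ≡ C → C * E ≡ a * (b * E)
      e a b C E refl = *-assoc a b E

    open Finish s (8 * suc h) B (s≤s z≤n) B≥

    separators : ∀ C Z → Centers C → Z ⊆ᵇ C → SeparatorFor C Z
    separators C Z C-centers Z⊆C = by-cases (any? λ x → Z x ≟ᵇ true)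
      where
      by-cases : Dec (∃ λ x → Z x ≡ true) → SeparatorFor C Z
      -- The separator construction starts from an element of `Z`; without one the balance condition
      -- reads 0 ≤ 0 and the empty set will do.
      by-cases (no none) = (λ _ → false) , ≤-trans (≤-reflexive (∑-zero (allFin (size G)))) z≤n , λ x₀ _ _ →
          ≤-trans (+-mono-≤ (*-monoʳ-≤ (8 * suc h) (≤-trans (#-mono {P = Sys.reachable C Z (λ _ → false) x₀} {Z} (λ _ → ∧-trueˡ)) Z≤0)) Z≤0)
                  (≤-trans (≤-reflexive (trans (+-identityʳ (8 * suc h * 0)) (*-zeroʳ (8 * suc h)))) z≤n)
        where
        Z≤0 : # Z ≤ 0
        Z≤0 = ≮⇒≥ λ pos → none (#-pos⁻ {P = Z} pos)
      by-cases (yes (x⋆ , e)) =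
        let Y , few , balanced = Separator.separator G (hit C) (layered-axioms thin C C-centers) c d (witnesses wit C C-centers) treewidth
              h ℓ (Param.μ h refl) (s≤s z≤n) ℓ≥1 n<2^ℓ (Param.μ-lower h refl) Param.g-small Param.large Z x⋆ e (hit-intro {C} (Z⊆C x⋆ e) desc-refl)
        in Y , few , λ x₀ cx → balanced x₀ (hit-intro {C} cx desc-refl)

    result : Goal
    result = finish D λ x → within-bound (size G) k d c ∣ X ∣ (# (chosen x)) ℓ (suc h) E refl 2^ℓ≤ g-lower
        (subst (λ y → # (chosen x) ≤ y + 5000 * E ⊎ # (chosen x) ≤ 115000 * E) (sym ∣ X ∣-lookup)
          (either-bound (# (chosen x)) (# Xᵇ) 110000 5000 115000 E (suc s) refl (few x) s≤))
      where
      D : Partial centers Xᵇ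
      D = build separators (# (centers ∖ Xᵇ)) centers Xᵇ centers-sound Xᵇ⊆ (m≤m⊔n (# Xᵇ) (110000 * E)) ≤-refl
      open Partial D

  nonempty : 1 ≤ size G → Goal
  nonempty n≥1 = from-ℓ (log₂ (2 * size G) (*-pos (s≤s (z≤n {1})) n≥1))
    where
    from-ℓ : (∃ λ ℓ → 2 ^ ℓ ≤ 2 * size G × 2 * size G < 2 ^ suc ℓ) → Goal
    from-ℓ (ℓ , lo , hi) = from-g (log₂ (4 * f) (*-pos (s≤s (z≤n {3})) f>0))
      where
      f : ℕ
      f = (1000000 * d * k ^ 2 * ℓ ^ 3) ^ c
      n<2^ℓ : size G < 2 ^ ℓ
      n<2^ℓ = *-cancelˡ-< 2 _ _ hi
      ℓ≥1 : 1 ≤ ℓ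
      ℓ≥1 = positive ℓ n<2^ℓ
        where
        positive : ∀ ℓ → size G < 2 ^ ℓ → 1 ≤ ℓ
        positive zero    lt = ⊥-elim (<⇒≱ lt n≥1)
        positive (suc ℓ) _  = s≤s z≤n
      f>0 : 0 < f
      f>0 = ^-pos c (*-pos (*-pos (*-pos (≤-literal 1 1000000) d≥1) (^-pos 2 k≥1)) (^-pos 3 ℓ≥1))
      from-g : (∃ λ g → 2 ^ g ≤ 4 * f × 4 * f < 2 ^ suc g) → Goal
      -- Up to this threshold the single bag of all centers obeys the bound; beyond it f < n, which
      -- makes the estimates in terms of ℓ available.
      from-g (g , g-lo , g-hi) = by-size (size G ≤?ⁿ 5000 * (k * ℓ ^ 2 * f * g))
        where
        g≥1 : 1 ≤ g
        g≥1 = positive g g-hi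
          where
          positive : ∀ g → 4 * f < 2 ^ suc g → 1 ≤ g
          positive zero    lt = ⊥-elim (<⇒≱ lt (≤-trans (≤-literal 2 4) (*-monoʳ-≤ 4 f>0)))
          positive (suc g) _  = s≤s z≤n
        shape : ∀ g → 1 ≤ g → 2 ^ g ≤ 4 * f → 4 * f < 2 ^ suc g → f < size G → Goal
        shape (suc h) _ lo′ hi′ f<n = Large.result ℓ h ℓ≥1 lo n<2^ℓ lo′ hi′ f<n
        f≤ : ∀ C → 1 ≤ C → f ≤ C * (k * ℓ ^ 2 * f * g)
        f≤ C C≥1 = ≤-trans (a≤b*a f (*-pos k≥1 (^-pos 2 ℓ≥1))) (≤-trans (a≤a*b _ g≥1) (a≤b*a _ C≥1))
        by-size : Dec (size G ≤ 5000 * (k * ℓ ^ 2 * f * g)) → Goal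
        by-size (yes le) = one-bag (within-bound (size G) k d c ∣ X ∣ (# centers) ℓ g (k * ℓ ^ 2 * f * g) refl lo g-lo
          (inj₁ (≤-trans (≤-trans (#≤n centers) le) (m≤n+m _ ∣ X ∣))))
        by-size (no ¬le) = shape g g≥1 g-lo g-hi (≤-<-trans (f≤ 5000 (≤-literal 1 5000)) (≰⇒> ¬le))

  result : Goal
  result = by-size (size G ≟ⁿ 0)
    where
    by-size : Dec (size G ≡ 0) → Goal
    by-size (no n≢0) = nonempty (n≢0⇒n>0 n≢0)
    -- Without vertices there are no centers, and an excess would require a number below 0.
    by-size (yes e)  = one-bag λ (a , b , p , q , _ , _ , _ , _ , _ , h) →
      n≮0 (subst (λ y → _ < y * (b ^ (2 + 3 * c) * q)) (n≤0⇒n≡0 (≤-trans (#≤n centers) (≤-reflexive e))) h)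

theorem8p5 : (c d : ℕ) → 1 ≤ c → 1 ≤ d →
    (𝒞 : Graph → Set) → ClosedUnderInducedSubgraphs 𝒞 →
    (∀ G′ → 𝒞 G′ → TreewidthAtMost G′ (maxDegree G′ ^ c)) →
    (G : Graph) → 𝒞 G → DegeneracyAtMost G d →
    (k : ℕ) → 1 ≤ k →
    (m : ℕ) (layer : V G → Fin m) →
    NeighborhoodWitnessing G layer (4 * d) →
    ThicknessAtMost G layer k →
    (X : Subset (size G)) → (∀ w → w ∈ X → IsCenter G layer w) →
    Σ (RootedTreeDecomposition G) λ D →
    (∀ w → w ∈ X → ∀ v → Desc G layer w v → v ∈ bag D (root (tree D)))
    × (∀ x → ∃ λ (X′ : Subset (size G)) →
    (∀ w → w ∈ X′ → IsCenter G layer w)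
    × WithinBound (size G) k d c ∣ X ∣ ∣ X′ ∣
    × (∀ v → v ∈ bag D x → ∃ λ w → w ∈ X′ × Desc G layer w v)
    × (∀ v → (∃ λ w → w ∈ X′ × Desc G layer w v) → v ∈ bag D x))
theorem8p5 c d c≥1 d≥1 𝒞 hereditary tw≤ G G∈𝒞 _ k k≥1 m layer wit thin X X-centers =
  Main.result c d c≥1 d≥1 𝒞 hereditary tw≤ G G∈𝒞 k k≥1 m layer wit thin X X-centers
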